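{- Let $t\ge 4$ be an integer. Then $s_{2,2}(K^{(3)}_t)=0$ and $s'_{2,2}(K^{(3)}_t)=(t-2)^2$.
   Context: A $3$-uniform hypergraph $H=(V,E)$ has $E\subseteq\binom{V}{3}$. $K^{(3)}_t$ is the complete $3$-uniform hypergraph on $t$ vertices. $H$ is $2$-Ramsey for $F$ if every coloring of $E(H)$ with $2$ colors contains a monochromatic copy of $F$; $H$ is minimal $2$-Ramsey for $F$ if it is $2$-Ramsey for $F$ but no proper subhypergraph is; $\mathcal{M}_2(F)$ denotes the set of minimal $2$-Ramsey $3$-uniform hypergraphs for $F$. For a $2$-set $S=\{u,v\}\subseteq V$, its codegree $\deg_G(S)$ is the number of edges containing $S$; $\delta_2(G)=\min_{S\in\binom{V(G)}{2}}\deg_G(S)$. Define $s_{2,2}(K^{(3)}_t)=\min_{G\in\mathcal{M}_2(K^{(3)}_t)}\delta_2(G)$ and \[ s'_{2,2}(K^{(3)}_t)=\min_{G\in\mathcal{M}_2(K^{(3)}_t)}\Bigl(\min\{\deg_G(S): S\in\tbinom{V(G)}{2},\ \deg_G(S)>0\}\Bigr). \] -}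

module Defs where

open import Data.Nat using (ℕ; _≤_; _<_)
open import Data.Bool using (Bool; true; false; not; _∧_)
open import Data.Fin using (Fin) renaming (_≟_ to _≟F_)
open import Data.Fin.Subset using (Subset; ⁅_⁆; _∪_; ∣_∣; ⊤; _⊆_)
open import Data.List using (length; filterᵇ; allFin)
open import Data.Product using (Σ; _×_; ∃; ∃-syntax)
open import Data.Sum using (_⊎_)
open import Relation.Nullary using (¬_; does)
open import Relation.Binary.PropositionalEquality using (_≡_; _≢_)
open import Function.Definitions using (Injective)

-- A 3-uniform hypergraph on vertex set Fin n is given by its edge
-- predicate E on subsets of Fin n, with every edge of size 3.
EdgeSet : ℕ → Set
EdgeSet n = Subset n → Bool

Uniform3 : {n : ℕ} → EdgeSet n → Set
Uniform3 {n} E = ∀ (s : Subset n) → E s ≡ true → ∣ s ∣ ≡ 3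

tri : {n : ℕ} → Fin n → Fin n → Fin n → Subset n
tri x y z = ⁅ x ⁆ ∪ ⁅ y ⁆ ∪ ⁅ z ⁆

-- a 2-colouring of the edges (values on non-edges are irrelevant)
Colouring : ℕ → Set
Colouring n = Subset n → Bool

MonoCopy : {n : ℕ} → ℕ → EdgeSet n → Colouring n → Set
MonoCopy {n} t E χ =
  ∃[ c ] ∃[ f ] (Injective _≡_ _≡_ f ×
    (∀ (a b d : Fin t) → a ≢ b → b ≢ d → a ≢ d →
       (E (tri (f a) (f b) (f d)) ≡ true) × (χ (tri (f a) (f b) (f d)) ≡ c)))

Ramsey : {n : ℕ} → ℕ → EdgeSet n → Set
Ramsey {n} t E = ∀ (χ : Colouring n) → MonoCopy t E χ

ProperSub : {n : ℕ} → EdgeSet n → Subset n → EdgeSet n → Set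
ProperSub {n} E S E' =
  (∀ s → E' s ≡ true → E s ≡ true) ×
  (∀ s → E' s ≡ true → s ⊆ S) ×
  (S ≢ ⊤ ⊎ ∃[ s ] (E s ≡ true × E' s ≡ false))

MinimalRamsey : {n : ℕ} → ℕ → EdgeSet n → Set
MinimalRamsey {n} t E =
  Uniform3 E × Ramsey t E ×
  (∀ (S : Subset n) (E' : EdgeSet n) → ProperSub E S E' → ¬ Ramsey t E')

codeg : {n : ℕ} → EdgeSet n → Fin n → Fin n → ℕ
codeg {n} E u v =
  length (filterᵇ (λ w → not (does (w ≟F u)) ∧ not (does (w ≟F v)) ∧ E (tri u v w))
                  (allFin n))

IsMin : (ℕ → Set) → ℕ → Set
IsMin P m = P m × (∀ k → P k → m ≤ k)

IsMinCodeg : {n : ℕ} → EdgeSet n → ℕ → Set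
IsMinCodeg {n} E m =
  IsMin (λ d → ∃[ u ] ∃[ v ] (u ≢ v × codeg E u v ≡ d)) m

IsMinPosCodeg : {n : ℕ} → EdgeSet n → ℕ → Set
IsMinPosCodeg {n} E m =
  IsMin (λ d → ∃[ u ] ∃[ v ] (u ≢ v × codeg E u v ≡ d × 0 < d)) m

S22 : ℕ → ℕ → Set
S22 t m = IsMin (λ k → Σ ℕ λ n → Σ (EdgeSet n) λ E →
                     MinimalRamsey t E × IsMinCodeg E k) m

S22' : ℕ → ℕ → Set
S22' t m = IsMin (λ k → Σ ℕ λ n → Σ (EdgeSet n) λ E →
                      MinimalRamsey t E × IsMinPosCodeg E k) m

{-# OPTIONS --safe #-}
module Submission where

-- Lower bound.  Delete all edges through u v and colour the rest without monochromatic cliques.  If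
-- there are fewer than (t-2)² deleted edges, a maximal family of disjoint (t-2)-sets in the link of u v
-- that are red towards u has at most t-3 members; colour u v w blue for w in their union and red
-- otherwise.  A red clique through u v contradicts maximality, a blue one has two vertices in one member.
--
-- Upper bound.  Take a (t-2)×(t-2) grid W of vertices and u , v such that the triples within a row (and
-- u or v) are forced to be red and those across distinct rows blue, up to exchanging the colours.  Once
-- all edges u v w are added, either some row is red towards u v, or a blue choice in each row gives a
-- blue clique.  The colours are forced by signal senders: hypergraphs with two disjoint edges that
-- differ in every good colouring.  Let H be Ramsey and H - e not; every good colouring of H - e has a
-- red and a blue clique minus e.  The partite construction over the edges of H - e, via Hales–Jewett,
-- yields a hypergraph mapping to H - e in which every good colouring contains a red and a blue clique
-- minus a common missing edge, while each designated missing edge is completed by only two such cliques.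
-- Adding the missing edges one at a time until the hypergraph becomes Ramsey singles out a missing edge
-- whose two near-cliques have opposite colours in every good colouring.

open import Data.Nat using (_*_; _+_; _<_; _^_; _∸_; _≤_; suc; s≤s; zero; z≤n; ℕ)
open import Data.Bool using (Bool; _∧_; _∨_; false; if_then_else_; not; true)
open import Data.Fin using (Fin; finToFun; funToFin; inject≤; punchIn; punchOut; remQuot; suc; zero)
open import Data.List using (List; []; _++_; _∷_; allFin; cartesianProduct; concatMap; deduplicate; filter; filterᵇ; length; map; upTo)
open import Data.List.Membership.Propositional using (_∈_; lose)
open import Data.List.Membership.Propositional.Properties
open import Data.List.Relation.Unary.Any using (Any; any?; here; index; satisfied; there)
open import Data.Vec using (Vec; []; _∷_; lookup; tabulate)
open import Data.Vec.Properties using (lookup∘tabulate)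
open import Data.Product using (_,_; _×_; proj₁; proj₂; Σ; ∃; ∃-syntax; ∃₂)
open import Data.Product.Properties using (≡-dec)
open import Data.Sum using ([_,_]′; _⊎_; inj₁; inj₂)
open import Data.Empty using (⊥; ⊥-elim)
open import Function using (Equivalence; _∘_; case_of_; id)
open import Relation.Nullary using (Dec; contradiction; does; no; yes; ¬_)
open import Relation.Nullary.Decidable using (T?; _×-dec_; _→-dec_; _⊎-dec_; dec-false; dec-true; does; map′; ¬?)
open import Relation.Binary using (DecidableEquality; tri<; tri>; tri≈)
open import Relation.Binary.PropositionalEquality using (_≡_; _≢_; cong; cong₂; refl; subst; subst₂; sym; trans)
open import Data.List.Relation.Unary.All as All using (All; []; _∷_)
open import Data.List.Relation.Unary.AllPairs using (AllPairs; []; _∷_)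
open import Data.List.Relation.Binary.Sublist.Propositional using ([]; _∷_; _∷ʳ_; minimum; ⊆-refl; ⊆-trans) renaming (_⊆_ to _⊑_)
open import Data.Maybe using (Maybe; fromMaybe; just; nothing)
open import Function.Definitions using (Injective)
open import Data.List.Properties using (++-identityʳ)
open import Defs
open import Data.Fin.Subset using (Subset; _∪_; ⁅_⁆; ∣_∣; ⊤) renaming (_∈_ to _∈ˢ_; _∉_ to _∉ˢ_; _⊆_ to _⊆ˢ_)
import Data.Bool.Properties as Bool
import Data.Fin as F
import Data.Fin.Properties as Fin
import Data.Fin.Subset.Properties as Subset
import Data.List as List
import Data.List.Properties as List
import Data.List.Relation.Binary.Sublist.Propositional.Properties as Sublist
import Data.List.Relation.Unary.AllPairs.Properties as AllPairs
import Data.List.Relation.Unary.Any as Any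
import Data.List.Relation.Unary.Any.Properties as Any
import Data.List.Relation.Unary.Unique.DecPropositional.Properties as DecUnique
import Data.List.Relation.Unary.Unique.Propositional.Properties as Unique
import Data.Maybe as Maybe
import Data.Maybe.Properties as Maybe
import Data.Nat.Properties as ℕ
import Data.Sum as Sum
import Data.Sum.Properties as Sum
import Data.Unit as Unit
import Data.Vec as Vec
import Data.Vec.Properties as Vec

-- The obstacle behind the senders: a good colouring of H - e has a red and a blue near-clique, but
-- which ones depends on the colouring, so no fixed pair of edges is forced to differ. The remedy is
-- a separate missing edge for every pair of candidate near-cliques. Hales-Jewett yields a copy of
-- the initial picture whose edge colours depend only on the edge of H - e below, so the pair that
-- the colouring shows is realised at its own missing edge. That no further near-cliques arise there
-- uses t ≥ 4: a near-clique has a vertex off the missing edge, which ties it to one copy and one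
-- fragment.
--
-- Passing to a minimal subhypergraph may lose edges of the construction. The pair u v keeps an
-- edge, because some colouring has monochromatic cliques only through u v; the lower bound itself
-- then shows that all (t-2)² edges at u v survive. For codegree 0: private vertices of senders are
-- never adjacent to both u and v, while the remaining vertices alone have a colouring without
-- monochromatic cliques, so some vertex of the minimal subhypergraph misses u or v.

Triple : Set → Set
Triple V = V × V × V

Distinct : {V : Set} → V → V → V → Set
Distinct a b c = a ≢ b × b ≢ c × a ≢ c

-- Hypergraphs are lists of triples; Edge closes them under reordering.
data Edge {V : Set} (es : List (Triple V)) : V → V → V → Set where
  edge : ∀ {a b c} → (a , b , c) ∈ es → Edge es a b c
  sw₁₂ : ∀ {a b c} → Edge es a b c → Edge es b a c
  sw₂₃ : ∀ {a b c} → Edge es a b c → Edge es a c b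

Proper : {V : Set} → List (Triple V) → Set
Proper es = ∀ {a b c} → Edge es a b c → Distinct a b c

-- Colours are given to all triples, so that colourings pull back along arbitrary vertex maps; only
-- the values on edges matter to `Good`.
record Col (V : Set) : Set where
  field
    col   : V → V → V → Bool
    col₁₂ : ∀ a b c → col b a c ≡ col a b c
    col₂₃ : ∀ a b c → col a c b ≡ col a b c
open Col public

IsMono : {V : Set} {t : ℕ} → List (Triple V) → Col V → Bool → (Fin t → V) → Set
IsMono es C c f = ∀ i j k → Distinct i j k →
  Edge es (f i) (f j) (f k) × col C (f i) (f j) (f k) ≡ c

Mono : {V : Set} (t : ℕ) → List (Triple V) → Col V → Bool → Set
Mono {V} t es C c = Σ (Fin t → V) (IsMono es C c)

Good : {V : Set} (t : ℕ) → List (Triple V) → Col V → Set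
Good t es C = ∀ c → ¬ Mono t es C c

Arrows : {V : Set} (t : ℕ) → List (Triple V) → Set
Arrows {V} t es = ∀ (C : Col V) → ∃ (Mono t es C)

map³ : {V W : Set} → (V → W) → Triple V → Triple W
map³ f (a , b , c) = f a , f b , f c

module _ {V : Set} where

  sw₁₃ : ∀ {es} {a b c : V} → Edge es a b c → Edge es c b a
  sw₁₃ = sw₁₂ ∘ sw₂₃ ∘ sw₁₂

  rot : ∀ {es} {a b c : V} → Edge es a b c → Edge es b c a
  rot = sw₂₃ ∘ sw₁₂

  Distinct-12 : ∀ {a b c : V} → Distinct a b c → Distinct b a c
  Distinct-12 (p , q , r) = p ∘ sym , r , q

  Distinct-23 : ∀ {a b c : V} → Distinct a b c → Distinct a c b
  Distinct-23 (p , q , r) = r , q ∘ sym , p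

  proper : ∀ {es : List (Triple V)} → (∀ {a b c} → (a , b , c) ∈ es → Distinct a b c) → Proper es
  proper h (edge e) = h e
  proper h (sw₁₂ e) = Distinct-12 (proper h e)
  proper h (sw₂₃ e) = Distinct-23 (proper h e)

  Edge-subst : ∀ {es} {a b c a' b' c' : V} → a ≡ a' → b ≡ b' → c ≡ c' → Edge es a b c → Edge es a' b' c'
  Edge-subst refl refl refl e = e

  Edge-mono : ∀ {es es'} {a b c : V} → (∀ {e} → e ∈ es → e ∈ es') → Edge es a b c → Edge es' a b c
  Edge-mono h (edge e) = edge (h e)
  Edge-mono h (sw₁₂ e) = sw₁₂ (Edge-mono h e)
  Edge-mono h (sw₂₃ e) = sw₂₃ (Edge-mono h e)

  Edge-bind : ∀ {es es'} {a b c : V} → (∀ {x y z} → (x , y , z) ∈ es → Edge es' x y z) →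
              Edge es a b c → Edge es' a b c
  Edge-bind h (edge e) = h e
  Edge-bind h (sw₁₂ e) = sw₁₂ (Edge-bind h e)
  Edge-bind h (sw₂₃ e) = sw₂₃ (Edge-bind h e)

  Edge-++⁻ : ∀ es {es'} {a b c : V} → Edge (es ++ es') a b c → Edge es a b c ⊎ Edge es' a b c
  Edge-++⁻ es (edge e) with ∈-++⁻ es e
  ... | inj₁ p = inj₁ (edge p)
  ... | inj₂ p = inj₂ (edge p)
  Edge-++⁻ es (sw₁₂ e) with Edge-++⁻ es e
  ... | inj₁ p = inj₁ (sw₁₂ p)
  ... | inj₂ p = inj₂ (sw₁₂ p)
  Edge-++⁻ es (sw₂₃ e) with Edge-++⁻ es e
  ... | inj₁ p = inj₁ (sw₂₃ p)
  ... | inj₂ p = inj₂ (sw₂₃ p)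

  Edge-∷⁻ : ∀ {e es} {a b c : V} → Edge (e ∷ es) a b c → Edge (e ∷ []) a b c ⊎ Edge es a b c
  Edge-∷⁻ {e} = Edge-++⁻ (e ∷ [])

  col-cong : ∀ (C : Col V) {a b c a' b' c'} → a ≡ a' → b ≡ b' → c ≡ c' → col C a b c ≡ col C a' b' c'
  col-cong C refl refl refl = refl

  col-edges : ∀ {es} {C D : Col V} → (∀ {a b c} → (a , b , c) ∈ es → col C a b c ≡ col D a b c) →
              ∀ {a b c} → Edge es a b c → col C a b c ≡ col D a b c
  col-edges h (edge e) = h e
  col-edges {C = C} {D} h (sw₁₂ {a} {b} {c} e) =
    trans (col₁₂ C a b c) (trans (col-edges {C = C} {D} h e) (sym (col₁₂ D a b c)))
  col-edges {C = C} {D} h (sw₂₃ {a} {b} {c} e) =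
    trans (col₂₃ C a b c) (trans (col-edges {C = C} {D} h e) (sym (col₂₃ D a b c)))

  col-const : ∀ {es} {C : Col V} {d} → (∀ {a b c} → (a , b , c) ∈ es → col C a b c ≡ d) →
              ∀ {a b c} → Edge es a b c → col C a b c ≡ d
  col-const {C = C} {d} h = col-edges {C = C} {D = record { col = λ _ _ _ → d ; col₁₂ = λ _ _ _ → refl ; col₂₃ = λ _ _ _ → refl }} h

  Mono-transfer : ∀ {t es es'} {C C' : Col V} {c} →
    (∀ {x y z} → Edge es x y z → Edge es' x y z × col C' x y z ≡ col C x y z) →
    Mono t es C c → Mono t es' C' c
  Mono-transfer h (f , m) = f , λ i j k d → let e , eq = m i j k d in proj₁ (h e) , trans (proj₂ (h e)) eq

module _ {V W : Set} where

  Edge-map⁺ : (f : V → W) → ∀ {es a b c} → Edge es a b c → Edge (map (map³ f) es) (f a) (f b) (f c)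
  Edge-map⁺ f (edge e) = edge (∈-map⁺ (map³ f) e)
  Edge-map⁺ f (sw₁₂ e) = sw₁₂ (Edge-map⁺ f e)
  Edge-map⁺ f (sw₂₃ e) = sw₂₃ (Edge-map⁺ f e)

  Edge-map⁻ : (f : V → W) → ∀ {es p q s} → Edge (map (map³ f) es) p q s →
              ∃[ a ] ∃[ b ] ∃[ c ] (Edge es a b c × p ≡ f a × q ≡ f b × s ≡ f c)
  Edge-map⁻ f (edge e) with ∈-map⁻ (map³ f) e
  ... | (a , b , c) , m , refl = a , b , c , edge m , refl , refl , refl
  Edge-map⁻ f (sw₁₂ e) with Edge-map⁻ f e
  ... | a , b , c , m , p , q , r = b , a , c , sw₁₂ m , q , p , r
  Edge-map⁻ f (sw₂₃ e) with Edge-map⁻ f e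
  ... | a , b , c , m , p , q , r = a , c , b , sw₂₃ m , p , r , q

  Edge-hom : ∀ (f : V → W) {es es'} → (∀ {a b c} → (a , b , c) ∈ es → Edge es' (f a) (f b) (f c)) →
             ∀ {a b c} → Edge es a b c → Edge es' (f a) (f b) (f c)
  Edge-hom f h (edge e) = h e
  Edge-hom f h (sw₁₂ e) = sw₁₂ (Edge-hom f h e)
  Edge-hom f h (sw₂₃ e) = sw₂₃ (Edge-hom f h e)

  pullback : (V → W) → Col W → Col V
  pullback f C .col a b c = col C (f a) (f b) (f c)
  pullback f C .col₁₂ a b c = col₁₂ C (f a) (f b) (f c)
  pullback f C .col₂₃ a b c = col₂₃ C (f a) (f b) (f c)

  Mono-image : ∀ {t es es' c} (f : V → W) (C : Col W) →
    (∀ {a b c} → Edge es a b c → Edge es' (f a) (f b) (f c)) →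
    Mono t es (pullback f C) c → Mono t es' C c
  Mono-image f C h (g , m) = f ∘ g , λ i j k d → let e , eq = m i j k d in h e , eq

-- Deciding edges, monochromatic cliques and arrowing

module _ {V : Set} (_≟_ : DecidableEquality V) where

  _≟³_ : DecidableEquality (Triple V)
  _≟³_ = ≡-dec _≟_ (≡-dec _≟_ _≟_)

  private
    -- Swaps give a triple unboundedly many derivations of `Edge`; the six orderings reduce it to a
    -- finite search.
    Six : List (Triple V) → V → V → V → Set
    Six es a b c = Any (λ e → Any (e ≡_)
      ((a , b , c) ∷ (a , c , b) ∷ (b , a , c) ∷ (b , c , a) ∷ (c , a , b) ∷ (c , b , a) ∷ [])) es

    six? : ∀ es a b c → Dec (Six es a b c)
    six? es a b c = any? (λ e → any? (e ≟³_) _) es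

    six-12 : ∀ {es a b c} → Six es a b c → Six es b a c
    six-12 = Any.map λ where
      (here p) → there (there (here p))
      (there (here p)) → there (there (there (here p)))
      (there (there (here p))) → here p
      (there (there (there (here p)))) → there (here p)
      (there (there (there (there (here p))))) → there (there (there (there (there (here p)))))
      (there (there (there (there (there (here p)))))) → there (there (there (there (here p))))

    six-23 : ∀ {es a b c} → Six es a b c → Six es a c b
    six-23 = Any.map λ where
      (here p) → there (here p)
      (there (here p)) → here p
      (there (there (here p))) → there (there (there (there (here p))))
      (there (there (there (here p)))) → there (there (there (there (there (here p)))))
      (there (there (there (there (here p))))) → there (there (here p))
      (there (there (there (there (there (here p)))))) → there (there (there (here p)))

    six⁺ : ∀ {es a b c} → Edge es a b c → Six es a b c
    six⁺ (edge e) = Any.map (here ∘ sym) e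
    six⁺ (sw₁₂ e) = six-12 (six⁺ e)
    six⁺ (sw₂₃ e) = six-23 (six⁺ e)

    six⁻ : ∀ {es a b c} → Six es a b c → Edge es a b c
    six⁻ (here (here refl)) = edge (here refl)
    six⁻ (here (there (here refl))) = sw₂₃ (edge (here refl))
    six⁻ (here (there (there (here refl)))) = sw₁₂ (edge (here refl))
    six⁻ (here (there (there (there (here refl))))) = sw₁₂ (sw₂₃ (edge (here refl)))
    six⁻ (here (there (there (there (there (here refl)))))) = sw₂₃ (sw₁₂ (edge (here refl)))
    six⁻ (here (there (there (there (there (there (here refl))))))) = sw₁₃ (edge (here refl))
    six⁻ (there m) = Edge-mono there (six⁻ m)

  abstract
    edge? : (es : List (Triple V)) (a b c : V) → Dec (Edge es a b c)
    edge? es a b c = map′ six⁻ six⁺ (six? es a b c)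

  private
    does-⇔ : ∀ {A B : Set} (a? : Dec A) (b? : Dec B) → (A → B) → (B → A) → does a? ≡ does b?
    does-⇔ (yes a) b? f g = sym (dec-true b? (f a))
    does-⇔ (no ¬a) b? f g = sym (dec-false b? (¬a ∘ g))

  -- Colourings presented by a list of red triples can be enumerated, and `fromRed-reds` shows that
  -- on the edges every colouring arises in this way.
  fromRed : List (Triple V) → Col V
  fromRed R .col a b c = does (edge? R a b c)
  fromRed R .col₁₂ a b c = does-⇔ (edge? R b a c) (edge? R a b c) sw₁₂ sw₁₂
  fromRed R .col₂₃ a b c = does-⇔ (edge? R a c b) (edge? R a b c) sw₂₃ sw₂₃

  isRed? : (C : Col V) (e : Triple V) → Dec (col C (proj₁ e) (proj₁ (proj₂ e)) (proj₂ (proj₂ e)) ≡ true)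
  isRed? C e = _ Bool.≟ true

  reds : Col V → List (Triple V) → List (Triple V)
  reds C = filter (isRed? C)

  reds⁻ : ∀ {C es a b c} → Edge (reds C es) a b c → Edge es a b c × col C a b c ≡ true
  reds⁻ {C} {es} e =
    Edge-mono (proj₁ ∘ ∈-filter⁻ (isRed? C)) e , col-const {C = C} (proj₂ ∘ ∈-filter⁻ (isRed? C) {xs = es}) e

  reds⁺ : ∀ {C es a b c} → Edge es a b c → col C a b c ≡ true → Edge (reds C es) a b c
  reds⁺ {C} (edge e) p = edge (∈-filter⁺ (isRed? C) e p)
  reds⁺ {C} (sw₁₂ {a} {b} {c} e) p = sw₁₂ (reds⁺ {C} e (trans (sym (col₁₂ C a b c)) p))
  reds⁺ {C} (sw₂₃ {a} {b} {c} e) p = sw₂₃ (reds⁺ {C} e (trans (sym (col₂₃ C a b c)) p))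

  fromRed-reds : ∀ C es {a b c} → Edge es a b c → col (fromRed (reds C es)) a b c ≡ col C a b c
  fromRed-reds C es {a} {b} {c} e with col C a b c in eq
  ... | true = dec-true (edge? (reds C es) a b c) (reds⁺ {C} {es} e eq)
  ... | false = dec-false (edge? (reds C es) a b c) λ r → case trans (sym eq) (proj₂ (reds⁻ {C} {es} r)) of λ ()

sublists : {A : Set} → List A → List (List A)
sublists [] = [] ∷ []
sublists (x ∷ xs) = sublists xs ++ map (x ∷_) (sublists xs)

filter-∈-sublists : ∀ {A : Set} {P : A → Set} (P? : ∀ x → Dec (P x)) xs → filter P? xs ∈ sublists xs
filter-∈-sublists P? [] = here refl
filter-∈-sublists P? (x ∷ xs) with P? x
... | yes _ = ∈-++⁺ʳ (sublists xs) (∈-map⁺ (x ∷_) (filter-∈-sublists P? xs))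
... | no _  = ∈-++⁺ˡ (filter-∈-sublists P? xs)

allVecs : {A : Set} → List A → (n : ℕ) → List (Vec A n)
allVecs xs zero    = [] ∷ []
allVecs xs (suc n) = concatMap (λ x → map (x ∷_) (allVecs xs n)) xs

∈-allVecs⁺ : ∀ {A : Set} {xs : List A} {n} (v : Vec A n) → (∀ i → lookup v i ∈ xs) → v ∈ allVecs xs n
∈-allVecs⁺ [] h = here refl
∈-allVecs⁺ {xs = xs} {suc n} (x ∷ v) h =
  ∈-concat⁺′ (∈-map⁺ (x ∷_) (∈-allVecs⁺ v (h ∘ suc))) (∈-map⁺ (λ y → map (y ∷_) (allVecs xs n)) (h zero))

∈-allVecs⁻ : ∀ {A : Set} {xs : List A} {n} {v : Vec A n} → v ∈ allVecs xs n → ∀ i → lookup v i ∈ xs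
∈-allVecs⁻ {xs = xs} {suc n} m i with ∈-concat⁻′ (map (λ y → map (y ∷_) (allVecs xs n)) xs) m
... | ys , m₁ , m₂ with ∈-map⁻ (λ y → map (y ∷_) (allVecs xs n)) m₂
... | x , x∈ , refl with ∈-map⁻ (x ∷_) m₁
... | w , w∈ , refl with i
... | zero  = x∈
... | suc j = ∈-allVecs⁻ w∈ j

vertices : {V : Set} → List (Triple V) → List V
vertices = concatMap (λ (a , b , c) → a ∷ b ∷ c ∷ [])

∈-vertices : ∀ {V : Set} {es} {a b c : V} → Edge es a b c → a ∈ vertices es × b ∈ vertices es × c ∈ vertices es
∈-vertices (edge e) =
  ∈-concat⁺′ (here refl) (∈-map⁺ _ e) , ∈-concat⁺′ (there (here refl)) (∈-map⁺ _ e) ,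
  ∈-concat⁺′ (there (there (here refl))) (∈-map⁺ _ e)
∈-vertices (sw₁₂ e) = let p , q , r = ∈-vertices e in q , p , r
∈-vertices (sw₂₃ e) = let p , q , r = ∈-vertices e in p , r , q

others : ∀ {k} (i : Fin (3 + k)) → ∃₂ λ j l → Distinct i j l
others zero          = suc zero , suc (suc zero) , (λ ()) , (λ ()) , (λ ())
others (suc zero)    = zero , suc (suc zero) , (λ ()) , (λ ()) , (λ ())
others (suc (suc i)) = zero , suc zero , (λ ()) , (λ ()) , (λ ())

module Decide {V : Set} (_≟_ : DecidableEquality V) where

  isMono? : ∀ {t} es C c (f : Fin t → V) → Dec (IsMono es C c f)
  isMono? es C c f = Fin.all? λ i → Fin.all? λ j → Fin.all? λ k →
    (¬? (i Fin.≟ j) ×-dec ¬? (j Fin.≟ k) ×-dec ¬? (i Fin.≟ k)) →-dec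
    (edge? _≟_ es (f i) (f j) (f k) ×-dec (col C (f i) (f j) (f k) Bool.≟ c))

  isMono-cong : ∀ {t es C c} {f g : Fin t → V} → (∀ i → f i ≡ g i) → IsMono es C c f → IsMono es C c g
  isMono-cong {es = es} {C} {c} eq m i j k d =
    Edge-subst (eq i) (eq j) (eq k) (proj₁ (m i j k d)) ,
    trans (col-cong C (sym (eq i)) (sym (eq j)) (sym (eq k))) (proj₂ (m i j k d))

  -- With at least three vertices in a clique each of them lies in an edge, so it suffices to search
  -- tuples over `vertices es`.
  mono? : ∀ {k} es C c → Dec (Mono (3 + k) es C c)
  mono? {k} es C c = map′ to from (any? (λ v → isMono? es C c (lookup v)) (allVecs (vertices es) (3 + k)))
    where
    to : Any (λ v → IsMono es C c (lookup v)) (allVecs (vertices es) (3 + k)) → Mono (3 + k) es C c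
    to m = let v , p = satisfied m in lookup v , p
    from : Mono (3 + k) es C c → Any (λ v → IsMono es C c (lookup v)) (allVecs (vertices es) (3 + k))
    from (f , m) = lose (∈-allVecs⁺ (tabulate f) inV) (isMono-cong {C = C} (sym ∘ lookup∘tabulate f) m)
      where
      inV : ∀ i → lookup (tabulate f) i ∈ vertices es
      inV i rewrite lookup∘tabulate f i with others i
      ... | j , l , d = proj₁ (∈-vertices (proj₁ (m i j l d)))

  abstract
    good-or-mono : ∀ k (es : List (Triple V)) (C : Col V) → Good (3 + k) es C ⊎ ∃ (Mono (3 + k) es C)
    good-or-mono k es C = decide (mono? {k} es C true) (mono? {k} es C false)
      where
      decide : Dec (Mono (3 + k) es C true) → Dec (Mono (3 + k) es C false) →
               Good (3 + k) es C ⊎ ∃ (Mono (3 + k) es C)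
      decide (yes m) _       = inj₂ (true , m)
      decide (no _)  (yes m) = inj₂ (false , m)
      decide (no p)  (no q)  = inj₁ λ { true → p ; false → q }

    good? : ∀ k (es : List (Triple V)) (C : Col V) → Dec (Good (3 + k) es C)
    good? k es C = [ yes , (λ (c , m) → no λ g → g c m) ]′ (good-or-mono k es C)

    good-sublist : ∀ k (es : List (Triple V)) (C : Col V) → Good (3 + k) es C →
                   Any (λ R → Good (3 + k) es (fromRed _≟_ R)) (sublists es)
    good-sublist k es C g = lose (filter-∈-sublists (isRed? _≟_ C) es) λ c m →
      g c (Mono-transfer {C = fromRed _≟_ (reds _≟_ C es)} {C} (λ e → e , sym (fromRed-reds _≟_ C es e)) m)

    -- Goodness depends only on the set of red edges, so testing the finitely many sublists of `es`
    -- settles all colourings.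
    arrows-or-good : ∀ k (es : List (Triple V)) → Arrows (3 + k) es ⊎ ∃ (Good {V} (3 + k) es)
    arrows-or-good k es = decide (any? (λ R → good? k es (fromRed _≟_ R)) (sublists es))
      where
      decide : Dec (Any (λ R → Good (3 + k) es (fromRed _≟_ R)) (sublists es)) →
               Arrows (3 + k) es ⊎ ∃ (Good {V} (3 + k) es)
      decide (yes a) = inj₂ (let R , g = satisfied a in fromRed _≟_ R , g)
      decide (no ¬a) = inj₁ λ C → [ (λ g → ⊥-elim (¬a (good-sublist k es C g))) , id ]′ (good-or-mono k es C)

-- Ramsey's theorem for triples

module _ {A : Set} where

  Homogeneous : ℕ → (List A → Bool) → List A → Bool → Set
  Homogeneous k c ys b = ∀ {zs} → zs ⊑ ys → length zs ≡ k → c zs ≡ b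

  -- The Erdős-Rado intermediate step: the colour of a sublist of length `suc k` is the tag of its
  -- first entry.
  EndHomogeneous : ℕ → (List A → Bool) → List (A × Bool) → Set
  EndHomogeneous k c [] = Unit.⊤
  EndHomogeneous k c ((y , b) ∷ ps) = Homogeneous k (c ∘ (y ∷_)) (map proj₁ ps) b × EndHomogeneous k c ps

  pick : Bool → List (A × Bool) → List A
  pick b [] = []
  pick b ((y , b') ∷ ps) with b' Bool.≟ b
  ... | yes _ = y ∷ pick b ps
  ... | no _  = pick b ps

  pick-⊑ : ∀ b ps → pick b ps ⊑ map proj₁ ps
  pick-⊑ b [] = []
  pick-⊑ b ((y , b') ∷ ps) with b' Bool.≟ b
  ... | yes _ = refl ∷ pick-⊑ b ps
  ... | no _  = y ∷ʳ pick-⊑ b ps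

  pick-length : ∀ ps → length (pick true ps) + length (pick false ps) ≡ length ps
  pick-length [] = refl
  pick-length ((y , true) ∷ ps) = cong suc (pick-length ps)
  pick-length ((y , false) ∷ ps) = trans (ℕ.+-suc _ _) (cong suc (pick-length ps))

  pick-homogeneous : ∀ {k c} b ps → EndHomogeneous k c ps → Homogeneous (suc k) c (pick b ps) b
  pick-homogeneous b [] _ [] ()
  pick-homogeneous b ((y , b') ∷ ps) (h , hs) zs⊑ len with b' Bool.≟ b
  ... | no _ = pick-homogeneous b ps hs zs⊑ len
  pick-homogeneous b ((y , b') ∷ ps) (h , hs) (.y ∷ʳ zs⊑) len | yes _ = pick-homogeneous b ps hs zs⊑ len
  pick-homogeneous b ((y , b') ∷ ps) (h , hs) (refl ∷ zs⊑) len | yes refl =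
    h (⊆-trans zs⊑ (pick-⊑ b ps)) (ℕ.suc-injective len)

  RamseyNumber : ℕ → ℕ → ℕ → Set
  RamseyNumber k m N = ∀ xs → N ≤ length xs → ∀ c →
    ∃[ ys ] ∃[ b ] (ys ⊑ xs × m ≤ length ys × Homogeneous k c ys b)

  mutual
    ramsey : ∀ k m → ∃ (RamseyNumber k m)
    ramsey zero m = m , λ xs le c → xs , c [] , ⊆-refl , le , λ { {[]} _ _ → refl }
    -- Of `m + m` tagged entries at least `m` share one of the two tags.
    ramsey (suc k) m with endHomogeneous k (m + m)
    ... | N , find = N , λ xs le c → let ps , ps⊑ , len , h = find xs le c in
      choose ps ps⊑ h (subst (m + m ≤_) (sym (pick-length ps)) len)
      where
      choose : ∀ {xs c} ps → map proj₁ ps ⊑ xs → EndHomogeneous k c ps →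
               m + m ≤ length (pick true ps) + length (pick false ps) →
               ∃[ ys ] ∃[ b ] (ys ⊑ xs × m ≤ length ys × Homogeneous (suc k) c ys b)
      choose ps ps⊑ h le with ℕ.≤-<-connex m (length (pick true ps))
      ... | inj₁ p = pick true ps , true , ⊆-trans (pick-⊑ true ps) ps⊑ , p , pick-homogeneous true ps h
      ... | inj₂ q = pick false ps , false , ⊆-trans (pick-⊑ false ps) ps⊑ ,
        ℕ.+-cancelˡ-≤ m _ _ (ℕ.≤-trans le (ℕ.+-monoˡ-≤ _ (ℕ.<⇒≤ q))) , pick-homogeneous false ps h

    -- Split off the first entry `x`, use Ramsey for `k` to make the colours of sublists starting
    -- with `x` constant, and continue inside what is left.
    endHomogeneous : ∀ k m → ∃[ N ] ∀ xs → N ≤ length xs → ∀ c →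
      ∃[ ps ] (map proj₁ ps ⊑ xs × m ≤ length ps × EndHomogeneous k c ps)
    endHomogeneous k zero = 0 , λ xs _ c → [] , minimum xs , z≤n , Unit.tt
    endHomogeneous k (suc m) with endHomogeneous k m
    ... | N , rest with ramsey k N
    ... | M , find = suc M , λ where
      (x ∷ xs) (s≤s le) c →
        let ys , b , ys⊑ , len , hom = find xs le (c ∘ (x ∷_))
            ps , ps⊑ , len' , h = rest ys len c
        in (x , b) ∷ ps , refl ∷ ⊆-trans ps⊑ ys⊑ , s≤s len' , (λ zs⊑ → hom (⊆-trans zs⊑ ps⊑)) , h

  lookup-⊑ : ∀ (ys : List A) i → List.lookup ys i ∷ [] ⊑ ys
  lookup-⊑ (y ∷ ys) zero    = refl ∷ minimum ys
  lookup-⊑ (y ∷ ys) (suc i) = y ∷ʳ lookup-⊑ ys i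

  lookup²-⊑ : ∀ (ys : List A) {i j} → i F.< j → List.lookup ys i ∷ List.lookup ys j ∷ [] ⊑ ys
  lookup²-⊑ (y ∷ ys) {zero}  {suc j} _       = refl ∷ lookup-⊑ ys j
  lookup²-⊑ (y ∷ ys) {suc i} {suc j} (s≤s p) = y ∷ʳ lookup²-⊑ ys p

  lookup³-⊑ : ∀ (ys : List A) {i j k} → i F.< j → j F.< k →
              List.lookup ys i ∷ List.lookup ys j ∷ List.lookup ys k ∷ [] ⊑ ys
  lookup³-⊑ (y ∷ ys) {zero}  {suc j} {suc k} _       (s≤s q) = refl ∷ lookup²-⊑ ys q
  lookup³-⊑ (y ∷ ys) {suc i} {suc j} {suc k} (s≤s p) (s≤s q) = y ∷ʳ lookup³-⊑ ys p q

AllPairs-⊑ : ∀ {A : Set} {R : A → A → Set} {xs ys} → xs ⊑ ys → AllPairs R ys → AllPairs R xs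
AllPairs-⊑ [] _ = []
AllPairs-⊑ (y ∷ʳ s) (_ ∷ rs) = AllPairs-⊑ s rs
AllPairs-⊑ (refl ∷ s) (r ∷ rs) = Sublist.All-resp-⊆ s r ∷ AllPairs-⊑ s rs

sort³ : ∀ {n} (P : Fin n → Fin n → Fin n → Set) →
  (∀ {i j k} → P i j k → P j i k) → (∀ {i j k} → P i j k → P i k j) →
  (∀ {i j k} → i F.< j → j F.< k → P i j k) → ∀ i j k → Distinct i j k → P i j k
sort³ P s₁₂ s₂₃ h i j k (i≢j , j≢k , i≢k) with Fin.<-cmp i j | Fin.<-cmp j k | Fin.<-cmp i k
... | tri≈ _ e _ | _ | _ = contradiction e i≢j
... | _ | tri≈ _ e _ | _ = contradiction e j≢k
... | _ | _ | tri≈ _ e _ = contradiction e i≢k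
... | tri< p _ _ | tri< q _ _ | _          = h p q
... | tri< p _ _ | tri> _ _ q | tri< r _ _ = s₂₃ (h r q)
... | tri< p _ _ | tri> _ _ q | tri> _ _ r = s₂₃ (s₁₂ (h r p))
... | tri> _ _ p | tri< q _ _ | tri< r _ _ = s₁₂ (h p r)
... | tri> _ _ p | tri< q _ _ | tri> _ _ r = s₁₂ (s₂₃ (h q r))
... | tri> _ _ p | tri> _ _ q | _          = s₁₂ (s₂₃ (s₁₂ (h q p)))

-- Increasing listings fix the role of each vertex in an edge, which lets the partite construction
-- tell the three parts over an edge apart.
Sorted : List (Triple ℕ) → Set
Sorted es = ∀ {a b c} → (a , b , c) ∈ es → a < b × b < c

increasing? : (e : Triple ℕ) → Dec (proj₁ e < proj₁ (proj₂ e) × proj₁ (proj₂ e) < proj₂ (proj₂ e))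
increasing? (a , b , c) = a ℕ.<? b ×-dec b ℕ.<? c

completeTriples : ℕ → List (Triple ℕ)
completeTriples N = filter increasing? (cartesianProduct (upTo N) (cartesianProduct (upTo N) (upTo N)))

ramsey-triples : ∀ t → ∃[ es ] (Sorted es × Arrows t es)
ramsey-triples t with ramsey {ℕ} 3 t
... | N , find = completeTriples N , (proj₂ ∘ ∈-filter⁻ increasing? {xs = all}) , λ C →
  let ys , b , ys⊑ , len , hom = find (upTo N) (ℕ.≤-reflexive (sym (List.length-upTo N))) (colour C)
  in b , clique C ys b ys⊑ len hom
  where
  all = cartesianProduct (upTo N) (cartesianProduct (upTo N) (upTo N))
  colour : Col ℕ → List ℕ → Bool
  colour C (x ∷ y ∷ z ∷ []) = col C x y z
  colour C _ = true
  increasing : ∀ {a b c} → a ∷ b ∷ c ∷ [] ⊑ upTo N → (a , b , c) ∈ completeTriples N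
  increasing {a} {b} {c} s with AllPairs-⊑ s (AllPairs.applyUpTo⁺₁ id N (λ p _ → p))
  ... | (p ∷ _) ∷ (q ∷ _) ∷ _ = ∈-filter⁺ increasing?
    (∈-cartesianProduct⁺ (to (here refl)) (∈-cartesianProduct⁺ (to (there (here refl))) (to (there (there (here refl)))))) (p , q)
    where
    to : ∀ {x} → x ∈ a ∷ b ∷ c ∷ [] → x ∈ upTo N
    to = Sublist.Any-resp-⊆ s
  clique : ∀ C ys b → ys ⊑ upTo N → t ≤ length ys → Homogeneous 3 (colour C) ys b → Mono t (completeTriples N) C b
  clique C ys b ys⊑ len hom = f , sort³ _
    (λ {i} {j} {k} (e , p) → sw₁₂ e , trans (col₁₂ C (f i) (f j) (f k)) p)
    (λ {i} {j} {k} (e , p) → sw₂₃ e , trans (col₂₃ C (f i) (f j) (f k)) p)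
    λ {i} {j} {k} p q →
      let s = lookup³-⊑ ys (inj p) (inj q) in edge (increasing (⊆-trans s ys⊑)) , hom s refl
    where
    f : Fin t → ℕ
    f i = List.lookup ys (inject≤ i len)
    inj : ∀ {i j : Fin t} → i F.< j → inject≤ i len F.< inject≤ j len
    inj {i} {j} = subst₂ _<_ (sym (Fin.toℕ-inject≤ i len)) (sym (Fin.toℕ-inject≤ j len))

-- The Hales–Jewett theorem

-- nothing marks an active coordinate.
Line : ℕ → ℕ → Set
Line k n = Vec (Maybe (Fin k)) n

Active : ∀ {k n} → Line k n → Set
Active l = ∃[ j ] lookup l j ≡ nothing

_at_ : ∀ {k n} → Line k n → Fin k → Vec (Fin k) n
l at i = Vec.map (fromMaybe i) l

MonoLine : ∀ {k n r} → (Vec (Fin k) n → Fin r) → Set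
MonoLine {k} {n} c = Σ (Line k n) λ l → Active l × (∀ i j → c (l at i) ≡ c (l at j))

fixed : ∀ {k n} → Vec (Fin k) n → Line k n
fixed = Vec.map just

fixed-at : ∀ {k n} (p : Vec (Fin k) n) i → fixed p at i ≡ p
fixed-at [] i = refl
fixed-at (x ∷ p) i = cong (x ∷_) (fixed-at p i)

++-at : ∀ {k m n} (l : Line k m) (l' : Line k n) i → (l Vec.++ l') at i ≡ (l at i) Vec.++ (l' at i)
++-at l l' i = Vec.map-++ (fromMaybe i) l l'

active-++ˡ : ∀ {k m n} (l : Line k m) (l' : Line k n) → Active l → Active (l Vec.++ l')
active-++ˡ l l' (j , eq) = j F.↑ˡ _ , trans (Vec.lookup-++ˡ l l' j) eq

active-++ʳ : ∀ {k m n} (l : Line k m) (l' : Line k n) → Active l' → Active (l Vec.++ l')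
active-++ʳ {m = m} l l' (j , eq) = m F.↑ʳ j , trans (Vec.lookup-++ʳ l l' j) eq

-- Makes room for `zero` as the new letter; the points at the other letters are the old points,
-- shifted.
raise : ∀ {k n} → Line k n → Line (suc k) n
raise = Vec.map (Maybe.map suc)

raise-at : ∀ {k n} (l : Line k n) i → raise l at suc i ≡ Vec.map suc (l at i)
raise-at [] i = refl
raise-at (just x ∷ l) i = cong (suc x ∷_) (raise-at l i)
raise-at (nothing ∷ l) i = cong (suc i ∷_) (raise-at l i)

active-raise : ∀ {k n} (l : Line k n) → Active l → Active (raise l)
active-raise l (j , eq) = j , trans (Vec.lookup-map j (Maybe.map suc) l) (cong (Maybe.map suc) eq)

words : ∀ k n → List (Vec (Fin k) n)
words k n = allVecs (allFin k) n

∈-words : ∀ {k n} (w : Vec (Fin k) n) → w ∈ words k n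
∈-words w = ∈-allVecs⁺ w (λ i → ∈-allFin (lookup w i))

-- Turns a whole colouring of a cube into one colour, so that Hales-Jewett can be applied to
-- colourings of a second block of coordinates.
encode : ∀ {k n r} → (Vec (Fin k) n → Fin r) → Fin (r ^ length (words k n))
encode {k} {n} f = funToFin (λ i → f (List.lookup (words k n) i))

encode-injective : ∀ {k n r} (f g : Vec (Fin k) n → Fin r) → encode f ≡ encode g → ∀ w → f w ≡ g w
encode-injective {k} {n} f g eq w = subst (λ v → f v ≡ g v) (sym (Any.lookup-index m)) at-index
  where
  m = ∈-words w
  at-index : f (List.lookup (words k n) (index m)) ≡ g (List.lookup (words k n) (index m))
  at-index = trans (sym (Fin.finToFun-funToFin (f ∘ List.lookup (words k n)) (index m)))
    (trans (cong (λ e → finToFun e (index m)) eq) (Fin.finToFun-funToFin (g ∘ List.lookup (words k n)) (index m)))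

-- Colour-focused lines: each is monochromatic away from the letter `zero`, their hues are pairwise
-- different, and they all meet at `zero`.
record Focused {k n r} (s : ℕ) (c : Vec (Fin (suc k)) n → Fin r) : Set where
  field
    focus     : Vec (Fin (suc k)) n
    line      : Fin s → Line (suc k) n
    hue       : Fin s → Fin r
    active    : ∀ m → Active (line m)
    line-hue  : ∀ m i → c (line m at suc i) ≡ hue m
    at-focus  : ∀ m → line m at zero ≡ focus
    hue-inj   : ∀ {m m'} → hue m ≡ hue m' → m ≡ m'

module _ {k r : ℕ} where

  mono-extend : ∀ {m n} {c : Vec (Fin k) (m + n) → Fin r} (u : Vec (Fin k) m) →
                MonoLine (λ v → c (u Vec.++ v)) → MonoLine c
  mono-extend {c = c} u (l , act , h) = fixed u Vec.++ l , active-++ʳ (fixed u) l act ,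
    λ i j → trans (cong c (eq i)) (trans (h i j) (sym (cong c (eq j))))
    where
    eq : ∀ i → (fixed u Vec.++ l) at i ≡ u Vec.++ (l at i)
    eq i = trans (++-at (fixed u) l i) (cong (Vec._++ _) (fixed-at u i))

module _ {k r : ℕ} where

  focus-mono : ∀ {n s} {c : Vec (Fin (suc k)) n → Fin r} (F : Focused s c) m →
               Focused.hue F m ≡ c (Focused.focus F) → MonoLine c
  focus-mono {c = c} F m eq = line m , active m , λ i j → trans (val i) (sym (val j))
    where
    open Focused F
    val : ∀ i → c (line m at i) ≡ hue m
    val zero    = trans (cong c (at-focus m)) (sym eq)
    val (suc i) = line-hue m i

  -- The old lines now move along `l` and themselves at once. The additional line moves along `l`
  -- only and keeps the second block at the old focus, so its hue is the colour of that focus.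
  focus-step : ∀ {m n s} (c : Vec (Fin (suc (suc k))) (m + n) → Fin r) (l : Line (suc k) m) → Active l →
    (∀ i j w → c (Vec.map suc (l at i) Vec.++ w) ≡ c (Vec.map suc (l at j) Vec.++ w)) →
    (F : Focused s (λ w → c (Vec.map suc (l at zero) Vec.++ w))) →
    (∀ a → Focused.hue F a ≢ c (Vec.map suc (l at zero) Vec.++ Focused.focus F)) →
    Focused (suc s) c
  focus-step {s = s} c l act stable F new = record
    { focus = (raise l at zero) Vec.++ focus
    ; line = line'
    ; hue = hue'
    ; active = λ { zero → active-++ˡ (raise l) (fixed focus) (active-raise l act)
                 ; (suc a) → active-++ˡ (raise l) (line a) (active-raise l act) }
    ; line-hue = λ { zero i → trans (cong c (trans (++-at (raise l) (fixed focus) (suc i))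
                       (cong₂ Vec._++_ (raise-at l i) (fixed-at focus (suc i))))) (stable i zero focus)
                   ; (suc a) i → trans (cong c (trans (++-at (raise l) (line a) (suc i))
                       (cong (Vec._++ _) (raise-at l i)))) (trans (stable i zero _) (line-hue a i)) }
    ; at-focus = λ { zero → trans (++-at (raise l) (fixed focus) zero) (cong ((raise l at zero) Vec.++_) (fixed-at focus zero))
                   ; (suc a) → trans (++-at (raise l) (line a) zero) (cong ((raise l at zero) Vec.++_) (at-focus a)) }
    ; hue-inj = λ { {zero} {zero} _ → refl
                  ; {zero} {suc a} e → contradiction (sym e) (new a)
                  ; {suc a} {zero} e → contradiction e (new a)
                  ; {suc a} {suc b} e → cong suc (hue-inj e) }
    }
    where
    open Focused F
    line' : Fin (suc s) → Line (suc (suc k)) _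
    line' zero    = raise l Vec.++ fixed focus
    line' (suc a) = raise l Vec.++ line a
    hue' : Fin (suc s) → Fin r
    hue' zero    = c (Vec.map suc (l at zero) Vec.++ focus)
    hue' (suc a) = hue a

HalesJewett : ℕ → ℕ → ℕ → Set
HalesJewett k r n = ∀ (c : Vec (Fin k) n → Fin r) → MonoLine c

focusing : ∀ {k} → (∀ r → ∃ (HalesJewett (suc k) r)) → ∀ r s →
           ∃[ n ] ∀ (c : Vec (Fin (suc (suc k))) n → Fin r) → Focused s c ⊎ MonoLine c
focusing hj r zero = 0 , λ c → inj₁ record
  { focus = [] ; line = λ () ; hue = λ () ; active = λ () ; line-hue = λ () ; at-focus = λ () ; hue-inj = λ { {()} } }
focusing {k} hj r (suc s) with focusing hj r s
-- One colour for each colouring of the second block: a monochromatic line in the first block is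
-- what `stable` asks for.
... | n , find with hj (r ^ length (words (suc (suc k)) n))
... | m , find' = m + n , step
  where
  step : ∀ c → Focused (suc s) c ⊎ MonoLine c
  step c with find' (λ u → encode (λ w → c (Vec.map suc u Vec.++ w)))
  ... | l , act , h with find (λ w → c (Vec.map suc (l at zero) Vec.++ w))
  ... | inj₂ mono = inj₂ (mono-extend {c = c} (Vec.map suc (l at zero)) mono)
  ... | inj₁ F with Fin.any? (λ a → Focused.hue F a Fin.≟ c (Vec.map suc (l at zero) Vec.++ Focused.focus F))
  ... | yes (a , eq) = inj₂ (mono-extend {c = c} (Vec.map suc (l at zero)) (focus-mono F a eq))
  ... | no new = inj₁ (focus-step c l act
          (λ i j → encode-injective _ _ (h i j)) F (λ a eq → new (a , eq)))

abstract
  hales-jewett : ∀ k r → ∃ (HalesJewett k r)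
  hales-jewett zero r = 1 , λ c → nothing ∷ [] , (zero , refl) , λ ()
  hales-jewett (suc zero) r = 1 , λ c → nothing ∷ [] , (zero , refl) , λ { zero zero → refl }
  -- `suc r` focused lines would need more hues than there are colours.
  hales-jewett (suc (suc k)) r with focusing (hales-jewett (suc k)) r (suc r)
  ... | n , find = n , λ c → [ (λ F → contradiction (Fin.injective⇒≤ (Focused.hue-inj F)) ℕ.1+n≰n) , id ]′ (find c)

-- Free amalgams

Edge-concatMap⁻ : ∀ {A V : Set} (f : A → List (Triple V)) xs {a b c} → Edge (concatMap f xs) a b c →
                  ∃[ x ] (x ∈ xs × Edge (f x) a b c)
Edge-concatMap⁻ f [] e with ∈-vertices e
... | () , _
Edge-concatMap⁻ f (x ∷ xs) e with Edge-++⁻ (f x) e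
... | inj₁ p = x , here refl , p
... | inj₂ p = let y , m , q = Edge-concatMap⁻ f xs p in y , there m , q

Edge-concatMap⁺ : ∀ {A V : Set} (f : A → List (Triple V)) {xs x a b c} → x ∈ xs → Edge (f x) a b c →
                  Edge (concatMap f xs) a b c
Edge-concatMap⁺ f m = Edge-mono (λ e → ∈-concat⁺′ e (∈-map⁺ f m))

third : ∀ {n} {i j : Fin (3 + n)} → i ≢ j → ∃ (Distinct i j)
third {i = i} {j} i≢j = l , i≢j , j≢l , Fin.punchInᵢ≢i i _ ∘ sym
  where
  j' = punchOut i≢j
  l = punchIn i (punchIn j' zero)
  j≢l : j ≢ l
  j≢l eq = Fin.punchInᵢ≢i j' zero (sym (Fin.punchIn-injective i j' _ (trans (Fin.punchIn-punchOut i≢j) eq)))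

GlueInjective : {U V K : Set} → List K → (K → V → Maybe U) → Set
GlueInjective ks γ = ∀ {k v v' u} → k ∈ ks → γ k v ≡ just u → γ k v' ≡ just u → v ≡ v'

-- Together: root and copy carry the same edges on the glued vertices, so that both remain induced
-- in the amalgam.
Coherent Induced : {U V K : Set} → List (Triple U) → (K → List (Triple V)) → List K → (K → V → Maybe U) → Set
Coherent R G ks γ = ∀ {k a b c p q s} → k ∈ ks → Edge (G k) a b c →
  γ k a ≡ just p → γ k b ≡ just q → γ k c ≡ just s → Edge R p q s
Induced R G ks γ = ∀ {k a b c p q s} → k ∈ ks → Edge R p q s →
  γ k a ≡ just p → γ k b ≡ just q → γ k c ≡ just s → Edge (G k) a b c

Agree : {U V K : Set} → (K → List (Triple V)) → List K → (K → V → Maybe U) → Col U → (K → Col V) → Set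
Agree G ks γ CU CV = ∀ {k a b c p q s} → k ∈ ks → Edge (G k) a b c →
  γ k a ≡ just p → γ k b ≡ just q → γ k c ≡ just s → col (CV k) a b c ≡ col CU p q s

-- Free amalgam of a root hypergraph R with a copy of G k for each k, where γ k says which vertices
-- of the copy are glued to the root.  Glued vertices leave isolated duplicates behind.
module Amalgam {U V K : Set} (R : List (Triple U)) (G : K → List (Triple V)) (ks : List K)
  (γ : K → V → Maybe U) where

  Vertex : Set
  Vertex = U ⊎ (K × V)

  place : K → V → Vertex
  place k v = Maybe.maybe′ inj₁ (inj₂ (k , v)) (γ k v)

  copy : K → List (Triple Vertex)
  copy k = map (map³ (place k)) (G k)

  amalgam : List (Triple Vertex)
  amalgam = map (map³ inj₁) R ++ concatMap copy ks

  place-just : ∀ {k v u} → γ k v ≡ just u → place k v ≡ inj₁ u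
  place-just eq rewrite eq = refl

  place-nothing : ∀ {k v} → γ k v ≡ nothing → place k v ≡ inj₂ (k , v)
  place-nothing eq rewrite eq = refl

  place⁻ : ∀ {k v} {x : Vertex} → place k v ≡ x →
           (∃[ u ] (γ k v ≡ just u × x ≡ inj₁ u)) ⊎ (γ k v ≡ nothing × x ≡ inj₂ (k , v))
  place⁻ {k} {v} eq with γ k v
  ... | just u  = inj₁ (u , refl , sym eq)
  ... | nothing = inj₂ (refl , sym eq)

  place-inj₁ : ∀ {k v u} → place k v ≡ inj₁ u → γ k v ≡ just u
  place-inj₁ eq with place⁻ eq
  ... | inj₁ (_ , p , refl) = p

  place-inj₂ : ∀ {k v k' v'} → inj₂ (k' , v') ≡ place k v → k ≡ k' × v ≡ v' × γ k v ≡ nothing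
  place-inj₂ eq with place⁻ (sym eq)
  ... | inj₂ (p , refl) = refl , refl , p

  place-≡ : ∀ {k k' v v'} → place k v ≡ place k' v' →
            (k ≡ k' × v ≡ v') ⊎ ∃[ u ] (γ k v ≡ just u × γ k' v' ≡ just u)
  place-≡ {k} {k'} {v} {v'} eq with place⁻ eq
  ... | inj₁ (u , p , q) = inj₂ (u , p , place-inj₁ q)
  ... | inj₂ (p , q) = let a , b , _ = place-inj₂ (sym q) in inj₁ (sym a , sym b)

  root-edge : ∀ {a b c} → Edge R a b c → Edge amalgam (inj₁ a) (inj₁ b) (inj₁ c)
  root-edge e = Edge-mono ∈-++⁺ˡ (Edge-map⁺ inj₁ e)

  copy-edge : ∀ {k a b c} → k ∈ ks → Edge (G k) a b c → Edge amalgam (place k a) (place k b) (place k c)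
  copy-edge {k} m e = Edge-mono (∈-++⁺ʳ (map (map³ inj₁) R)) (Edge-concatMap⁺ copy m (Edge-map⁺ (place k) e))

  amalgam⁻ : ∀ {x y z} → Edge amalgam x y z →
    (∃[ a ] ∃[ b ] ∃[ c ] (Edge R a b c × x ≡ inj₁ a × y ≡ inj₁ b × z ≡ inj₁ c)) ⊎
    (∃[ k ] (k ∈ ks × ∃[ a ] ∃[ b ] ∃[ c ] (Edge (G k) a b c × x ≡ place k a × y ≡ place k b × z ≡ place k c)))
  amalgam⁻ e with Edge-++⁻ (map (map³ inj₁) R) e
  ... | inj₁ p = inj₁ (Edge-map⁻ inj₁ p)
  ... | inj₂ p = let k , m , q = Edge-concatMap⁻ copy ks p in inj₂ (k , m , Edge-map⁻ (place k) q)

  linked : ∀ {k v y z} → Edge amalgam (inj₂ (k , v)) y z →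
           k ∈ ks × inj₂ (k , v) ≡ place k v × (∃[ b ] y ≡ place k b)
  linked e with amalgam⁻ e
  ... | inj₂ (k , m , a , b , c , g , p , q , r) with place-inj₂ p
  ... | refl , refl , n = m , p , b , q

  module Glue
    (γ-inj : GlueInjective ks γ)
    (coh : Coherent R G ks γ) (ind : Induced R G ks γ) where

    place-injective : ∀ {k v v'} → k ∈ ks → place k v ≡ place k v' → v ≡ v'
    place-injective m eq with place-≡ eq
    ... | inj₁ (_ , p) = p
    ... | inj₂ (u , p , q) = γ-inj m p q

    reflectRoot : ∀ {a b c} → Edge amalgam (inj₁ a) (inj₁ b) (inj₁ c) → Edge R a b c
    reflectRoot e with amalgam⁻ e
    ... | inj₁ (_ , _ , _ , r , refl , refl , refl) = r
    ... | inj₂ (k , m , _ , _ , _ , g , p , q , s) =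
      coh m g (place-inj₁ (sym p)) (place-inj₁ (sym q)) (place-inj₁ (sym s))

    -- An edge coming from a different copy has all three vertices glued; `coh` moves it to the root
    -- and `ind` from there into copy `k`.
    reflect : ∀ {k a b c} → k ∈ ks → Edge amalgam (place k a) (place k b) (place k c) → Edge (G k) a b c
    reflect {k} {a} {b} {c} m e with amalgam⁻ e
    ... | inj₁ (_ , _ , _ , r , p , q , s) = ind m r (place-inj₁ p) (place-inj₁ q) (place-inj₁ s)
    ... | inj₂ (k' , m' , a' , b' , c' , g , p , q , s) with place-≡ p | place-≡ q | place-≡ s
    ... | inj₁ (refl , _) | _ | _ =
      Edge-subst (place-injective m (sym p)) (place-injective m (sym q)) (place-injective m (sym s)) g
    ... | inj₂ _ | inj₁ (refl , _) | _ =
      Edge-subst (place-injective m (sym p)) (place-injective m (sym q)) (place-injective m (sym s)) g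
    ... | inj₂ _ | inj₂ _ | inj₁ (refl , _) =
      Edge-subst (place-injective m (sym p)) (place-injective m (sym q)) (place-injective m (sym s)) g
    ... | inj₂ (_ , p₁ , p₂) | inj₂ (_ , q₁ , q₂) | inj₂ (_ , s₁ , s₂) =
      ind m (coh m' g p₂ q₂ s₂) p₁ q₁ s₁

-- Colourings that agree on the glued edges amalgamate: the red edges form an amalgam themselves.
module Colouring {U V K : Set} (_≟U_ : DecidableEquality U) (_≟V_ : DecidableEquality V) (_≟K_ : DecidableEquality K)
  (R : List (Triple U)) (G : K → List (Triple V)) (ks : List K) (γ : K → V → Maybe U)
  (γ-inj : GlueInjective ks γ)
  (coh : Coherent R G ks γ) (ind : Induced R G ks γ)
  (CU : Col U) (CV : K → Col V)
  (agree : Agree G ks γ CU CV) where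

  open Amalgam R G ks γ
  open Glue γ-inj coh ind

  vertex≟ : DecidableEquality Vertex
  vertex≟ = Sum.≡-dec _≟U_ (≡-dec _≟K_ _≟V_)

  private
    RedR = reds _≟U_ CU R
    RedG : K → List (Triple V)
    RedG k = reds _≟V_ (CV k) (G k)
    module Red = Amalgam RedR RedG ks γ

    red-coh : Coherent RedR RedG ks γ
    red-coh {k} m e x y z = let g , eq = reds⁻ _≟V_ {CV k} {G k} e in
      reds⁺ _≟U_ {CU} (coh m g x y z) (trans (sym (agree m g x y z)) eq)

    red-ind : Induced RedR RedG ks γ
    red-ind {k} m e x y z = let r , eq = reds⁻ _≟U_ {CU} {R} e ; g = ind m r x y z in
      reds⁺ _≟V_ {CV k} g (trans (agree m g x y z) eq)

    module RedGlue = Red.Glue γ-inj red-coh red-ind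

  union : Col Vertex
  union = fromRed vertex≟ Red.amalgam

  union-root : ∀ {a b c} → Edge R a b c → col union (inj₁ a) (inj₁ b) (inj₁ c) ≡ col CU a b c
  union-root {a} {b} {c} e with col CU a b c in eq
  ... | true  = dec-true (edge? vertex≟ Red.amalgam _ _ _) (Red.root-edge (reds⁺ _≟U_ {CU} e eq))
  ... | false = dec-false (edge? vertex≟ Red.amalgam _ _ _) λ r →
    case trans (sym eq) (proj₂ (reds⁻ _≟U_ {CU} {R} (RedGlue.reflectRoot r))) of λ ()

  union-copy : ∀ {k a b c} → k ∈ ks → Edge (G k) a b c →
               col union (place k a) (place k b) (place k c) ≡ col (CV k) a b c
  union-copy {k} {a} {b} {c} m e with col (CV k) a b c in eq
  ... | true  = dec-true (edge? vertex≟ Red.amalgam _ _ _) (Red.copy-edge m (reds⁺ _≟V_ {CV k} e eq))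
  ... | false = dec-false (edge? vertex≟ Red.amalgam _ _ _) λ r →
    case trans (sym eq) (proj₂ (reds⁻ _≟V_ {CV k} {G k} (RedGlue.reflect m r))) of λ ()

  private
    isPrivate? : (x : Vertex) → Dec (∃[ y ] x ≡ inj₂ y)
    isPrivate? (inj₁ _) = no λ ()
    isPrivate? (inj₂ y) = yes (y , refl)

    root? : (x : Vertex) → ¬ (∃[ y ] x ≡ inj₂ y) → ∃[ u ] x ≡ inj₁ u
    root? (inj₁ u) _ = u , refl
    root? (inj₂ y) h = contradiction (y , refl) h

  -- Every vertex of a clique shares an edge with every other one, so a clique with a private vertex
  -- stays in that copy; without private vertices it lies in the root.
  union-good : ∀ {n} → Good (3 + n) R CU → (∀ k → Good (3 + n) (G k) (CV k)) → Good (3 + n) amalgam union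
  union-good {n} gU gV c (f , m) with Fin.any? (λ i → isPrivate? (f i))
  ... | no none = gU c ((λ i → proj₁ (g i)) , λ i j l d →
      let e , eq = m i j l d
          e' = reflectRoot (Edge-subst (proj₂ (g i)) (proj₂ (g j)) (proj₂ (g l)) e)
      in e' , trans (sym (union-root e')) (trans (col-cong union (sym (proj₂ (g i))) (sym (proj₂ (g j))) (sym (proj₂ (g l)))) eq))
    where
    g : ∀ i → ∃[ u ] f i ≡ inj₁ u
    g i = root? (f i) (λ p → none (i , p))
  ... | yes (i₀ , (k , v) , eq₀) = gV k c ((λ i → proj₁ (g i)) , λ i j l d →
      let e , eq = m i j l d
          e' = reflect k∈ (Edge-subst (proj₂ (g i)) (proj₂ (g j)) (proj₂ (g l)) e)
      in e' , trans (sym (union-copy k∈ e')) (trans (col-cong union (sym (proj₂ (g i))) (sym (proj₂ (g j))) (sym (proj₂ (g l)))) eq))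
    where
    at₀ : ∀ {j l} → Distinct i₀ j l → k ∈ ks × inj₂ (k , v) ≡ place k v × (∃[ b ] f j ≡ place k b)
    at₀ d = linked (Edge-subst eq₀ refl refl (proj₁ (m i₀ _ _ d)))
    o = proj₂ (proj₂ (others i₀))
    k∈ : k ∈ ks
    k∈ = proj₁ (at₀ o)
    g : ∀ j → ∃[ b ] f j ≡ place k b
    g j with i₀ Fin.≟ j
    ... | yes refl = v , trans eq₀ (proj₁ (proj₂ (at₀ o)))
    ... | no i₀≢j  = proj₂ (proj₂ (at₀ (proj₂ (third i₀≢j))))

-- The partite construction

fourth : ∀ {n} {i j k : Fin (4 + n)} → Distinct i j k → ∃[ w ] (w ≢ i × w ≢ j × w ≢ k)
fourth {i = i} {j} {k} (i≢j , j≢k , i≢k) =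
  punchIn i w , Fin.punchInᵢ≢i i w , w≢ i≢j (proj₂ (proj₂ d)) , w≢ i≢k (proj₁ (proj₂ d))
  where
  t = third {i = punchOut i≢j} {punchOut i≢k} (j≢k ∘ Fin.punchOut-injective i≢j i≢k)
  w = proj₁ t
  d = proj₂ t
  w≢ : ∀ {m} (i≢m : i ≢ m) → punchOut i≢m ≢ w → punchIn i w ≢ m
  w≢ i≢m ne eq = ne (Fin.punchIn-injective i _ _ (trans (Fin.punchIn-punchOut i≢m) (sym eq)))

∈-copies⁻ : ∀ {A B C : Set} (f : A → B → C) xs ys {c} → c ∈ concatMap (λ x → map (f x) ys) xs →
            ∃[ x ] (x ∈ xs × ∃[ y ] (y ∈ ys × c ≡ f x y))
∈-copies⁻ f xs ys m with ∈-concat⁻′ (map (λ x → map (f x) ys) xs) m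
... | _ , r , c with ∈-map⁻ (λ x → map (f x) ys) c
... | x , x∈ , refl = x , x∈ , ∈-map⁻ (f x) r

Near : ∀ {V : Set} {t} → List (Triple V) → (Fin t → V) → Fin t → Fin t → Fin t → Set
Near es f i j k = ∀ a b c → Distinct a b c → ¬ Edge ((i , j , k) ∷ []) a b c → Edge es (f a) (f b) (f c)

∈-perm : ∀ {A : Set} {i j k a b c : A} → Edge ((i , j , k) ∷ []) a b c →
         ∀ {m} → m ≢ i → m ≢ j → m ≢ k → m ≢ a × m ≢ b × m ≢ c
∈-perm (edge (here refl)) p q r = p , q , r
∈-perm (sw₁₂ e) p q r = let x , y , z = ∈-perm e p q r in y , x , z
∈-perm (sw₂₃ e) p q r = let x , y , z = ∈-perm e p q r in x , z , y

-- Four vertices suffice: all triples through a vertex `w` other than those at `i`, `j`, `k` are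
-- present, and they cover every pair.
near-link : ∀ {V : Set} {n} {es : List (Triple V)} {f : Fin (4 + n) → V} {i j k} → Distinct i j k → Near es f i j k →
            ∀ {m m'} → m ≢ m' → ∃[ l ] Edge es (f m) (f m') (f l)
near-link {es = es} {f} {i} {j} {k} d near {m} {m'} m≢m' with fourth d
... | w , w≢i , w≢j , w≢k = go (w Fin.≟ m) (w Fin.≟ m')
  where
  near-w : ∀ {m} → w ≢ m → ∃[ l ] Edge es (f w) (f m) (f l)
  near-w {m} w≢m = let l , d' = third w≢m in
    l , near w m l d' (λ e → proj₁ (∈-perm e w≢i w≢j w≢k) refl)
  go : Dec (w ≡ m) → Dec (w ≡ m') → ∃[ l ] Edge es (f m) (f m') (f l)
  go (yes refl) _ = near-w m≢m'
  go (no _) (yes refl) = let l , e = near-w (λ eq → m≢m' (sym eq)) in l , sw₁₂ e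
  go (no p) (no q) = w , near m m' w (m≢m' , (λ eq → q (sym eq)) , (λ eq → p (sym eq)))
    λ e → proj₂ (proj₂ (∈-perm e w≢i w≢j w≢k)) refl

-- x y z is a missing edge, and every near-clique on it will pass through a or a' (see Caught).
record Design (V : Set) : Set where
  constructor design
  field x y z a a' : V

mapD : ∀ {V W : Set} → (V → W) → Design V → Design W
mapD f (design x y z a a') = design (f x) (f y) (f z) (f a) (f a')

Caught : ∀ {V : Set} (n : ℕ) → List (Triple V) → Design V → Set
Caught {V} n es (design x y z a a') = ∀ (f : Fin (4 + n) → V) {i j k} → Distinct i j k →
  f i ≡ x → f j ≡ y → f k ≡ z → Near es f i j k → (∃[ q ] f q ≡ a) ⊎ (∃[ q ] f q ≡ a')

s₁ s₂ s₃ : {V : Set} → Triple V → V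
s₁ (a , _ , _) = a
s₂ (_ , b , _) = b
s₃ (_ , _ , c) = c

module Spelling {V : Set} {ℓ : ℕ} (letter : Fin ℓ → Triple V) where

  spread : ∀ {m} → (Triple V → V) → V → Line ℓ m → Vec V m
  spread s v = Vec.map (Maybe.maybe′ (λ i → s (letter i)) v)

  spell : ∀ {m} → (Triple V → V) → Vec (Fin ℓ) m → Vec V m
  spell s = Vec.map (λ i → s (letter i))

  -- Hence the edge that is letter `i` in the copy of `L` becomes the root edge of the word
  -- `L at i`.
  spread-at : ∀ {m} s {v i} (L : Line ℓ m) → s (letter i) ≡ v → spread s v L ≡ spell s (L at i)
  spread-at s [] eq = refl
  spread-at s (just j ∷ L) eq = cong (s (letter j) ∷_) (spread-at s L eq)
  spread-at s (nothing ∷ L) eq = cong₂ _∷_ (sym eq) (spread-at s L eq)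

  lookup-spread : ∀ {m} s v (L : Line ℓ m) j → lookup L j ≡ nothing → lookup (spread s v L) j ≡ v
  lookup-spread s v L j eq = trans (Vec.lookup-map j (Maybe.maybe′ (λ i → s (letter i)) v) L)
    (cong (Maybe.maybe′ (λ i → s (letter i)) v) eq)

  lookup-spell : ∀ {m} s (w : Vec (Fin ℓ) m) j → lookup (spell s w) j ≡ s (letter (lookup w j))
  lookup-spell s w j = Vec.lookup-map j (λ i → s (letter i)) w

  word : ∀ {m} → Vec (Fin ℓ) m → Triple (Vec V m)
  word w = spell s₁ w , spell s₂ w , spell s₃ w

-- The edges over (x , y , z) are the letters; the copies of the picture are indexed by combinatorial
-- lines over this alphabet, and a vertex over x, y or z is glued to the word it traces.
module Product {V : Set} (es : List (Triple V)) (π : V → ℕ)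
  (ordered : ∀ {a b c} → (a , b , c) ∈ es → π a < π b × π b < π c)
  {x y z : ℕ} (x<y : x < y) (y<z : y < z) {ℓ : ℕ} (letter : Fin ℓ → Triple V)
  (letter-∈ : ∀ i → letter i ∈ es) (letter-over : ∀ i → map³ π (letter i) ≡ (x , y , z))
  (find : ∀ {e} → e ∈ es → map³ π e ≡ (x , y , z) → ∃[ i ] letter i ≡ e)
  {dim : ℕ} (j₀ : Fin dim) where

  open Spelling letter

  part : ℕ → Maybe (Triple V → V)
  part m with m ℕ.≟ x | m ℕ.≟ y | m ℕ.≟ z
  ... | yes _ | _     | _     = just s₁
  ... | no _  | yes _ | _     = just s₂
  ... | no _  | no _  | yes _ = just s₃
  ... | no _  | no _  | no _  = nothing

  data Part : ℕ → (Triple V → V) → Set where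
    part₁ : Part x s₁
    part₂ : Part y s₂
    part₃ : Part z s₃

  part⁻ : ∀ {m s} → part m ≡ just s → Part m s
  part⁻ {m} eq with m ℕ.≟ x | m ℕ.≟ y | m ℕ.≟ z
  part⁻ refl | yes refl | _ | _ = part₁
  part⁻ refl | no _ | yes refl | _ = part₂
  part⁻ refl | no _ | no _ | yes refl = part₃

  part-increasing : ∀ {m m' m'' s s' s''} → Part m s → Part m' s' → Part m'' s'' → m < m' → m' < m'' →
                    (m , m' , m'') ≡ (x , y , z) × s ≡ s₁ × s' ≡ s₂ × s'' ≡ s₃
  part-increasing part₁ part₂ part₃ _ _ = refl , refl , refl , refl
  part-increasing _ part₁ part₁ _ q = contradiction q (ℕ.<-irrefl refl)
  part-increasing _ part₂ part₂ _ q = contradiction q (ℕ.<-irrefl refl)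
  part-increasing _ part₃ part₃ _ q = contradiction q (ℕ.<-irrefl refl)
  part-increasing part₁ part₁ _ p _ = contradiction p (ℕ.<-irrefl refl)
  part-increasing part₂ part₂ _ p _ = contradiction p (ℕ.<-irrefl refl)
  part-increasing part₃ part₃ _ p _ = contradiction p (ℕ.<-irrefl refl)
  part-increasing part₂ part₁ _ p _ = contradiction p (ℕ.<-asym x<y)
  part-increasing part₃ part₁ _ p _ = contradiction p (ℕ.<-asym (ℕ.<-trans x<y y<z))
  part-increasing part₃ part₂ _ p _ = contradiction p (ℕ.<-asym y<z)
  part-increasing part₁ part₂ part₁ _ q = contradiction q (ℕ.<-asym x<y)
  part-increasing part₁ part₃ part₁ _ q = contradiction q (ℕ.<-asym (ℕ.<-trans x<y y<z))
  part-increasing part₁ part₃ part₂ _ q = contradiction q (ℕ.<-asym y<z)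
  part-increasing part₂ part₃ part₁ _ q = contradiction q (ℕ.<-asym (ℕ.<-trans x<y y<z))
  part-increasing part₂ part₃ part₂ _ q = contradiction q (ℕ.<-asym y<z)

  part-x : part x ≡ just s₁
  part-x with x ℕ.≟ x
  ... | yes _ = refl
  ... | no ne = contradiction refl ne

  part-y : part y ≡ just s₂
  part-y with y ℕ.≟ x | y ℕ.≟ y
  ... | yes eq | _ = contradiction (sym eq) (ℕ.<⇒≢ x<y)
  ... | no _ | yes _ = refl
  ... | no _ | no ne = contradiction refl ne

  part-z : part z ≡ just s₃
  part-z with z ℕ.≟ x | z ℕ.≟ y | z ℕ.≟ z
  ... | yes eq | _ | _ = contradiction (sym eq) (ℕ.<⇒≢ (ℕ.<-trans x<y y<z))
  ... | no _ | yes eq | _ = contradiction (sym eq) (ℕ.<⇒≢ y<z)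
  ... | no _ | no _ | yes _ = refl
  ... | no _ | no _ | no ne = contradiction refl ne

  π-letter : ∀ {m s} → Part m s → ∀ i → π (s (letter i)) ≡ m
  π-letter part₁ i = cong s₁ (letter-over i)
  π-letter part₂ i = cong s₂ (letter-over i)
  π-letter part₃ i = cong s₃ (letter-over i)

  γ : Line ℓ dim → V → Maybe (Vec V dim)
  γ L v = Maybe.map (λ s → spread s v L) (part (π v))

  γ⁻ : ∀ L {v p} → γ L v ≡ just p → ∃[ s ] (Part (π v) s × p ≡ spread s v L)
  γ⁻ L {v} eq with part (π v) in eq'
  γ⁻ L refl | just s = s , part⁻ eq' , refl

  γ-lookup : ∀ L {v p j} → γ L v ≡ just p → lookup L j ≡ nothing → lookup p j ≡ v
  γ-lookup L {v} g act with γ⁻ L g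
  ... | s , _ , refl = lookup-spread s v L _ act

  active? : (L : Line ℓ dim) → Dec (Active L)
  active? L = Fin.any? (λ j → Maybe.≡-dec Fin._≟_ (lookup L j) nothing)

  symbols : List (Maybe (Fin ℓ))
  symbols = nothing ∷ map just (allFin ℓ)

  ∈-symbols : ∀ m → m ∈ symbols
  ∈-symbols nothing  = here refl
  ∈-symbols (just i) = there (∈-map⁺ just (∈-allFin i))

  abstract
    lines : List (Line ℓ dim)
    lines = filter active? (allVecs symbols dim)

    ∈-lines⁺ : ∀ {L} → Active L → L ∈ lines
    ∈-lines⁺ {L} = ∈-filter⁺ active? (∈-allVecs⁺ L (λ i → ∈-symbols (lookup L i)))

    ∈-lines⁻ : ∀ {L} → L ∈ lines → Active L
    ∈-lines⁻ = proj₂ ∘ ∈-filter⁻ active? {xs = allVecs symbols dim}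

    root : List (Triple (Vec V dim))
    root = map word (words ℓ dim)

    ∈-root⁺ : ∀ w → word w ∈ root
    ∈-root⁺ w = ∈-map⁺ word (∈-words w)

    ∈-root⁻ : ∀ {e} → e ∈ root → ∃[ w ] e ≡ word w
    ∈-root⁻ m = let w , _ , eq = ∈-map⁻ word m in w , eq

  -- An active coordinate of the traced word records the vertex itself.
  γ-inj : GlueInjective lines γ
  γ-inj {L} m g g' = let _ , act = ∈-lines⁻ m in trans (sym (γ-lookup L g act)) (γ-lookup L g' act)

  lies-over : ∀ {a b c s s' s''} → (a , b , c) ∈ es → Part (π a) s → Part (π b) s' → Part (π c) s'' →
              (∃[ i ] letter i ≡ (a , b , c)) × s ≡ s₁ × s' ≡ s₂ × s'' ≡ s₃
  lies-over e p q r with ordered e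
  ... | lt , lt' with part-increasing p q r lt lt'
  ... | eq , sel = find e eq , sel

  coh : Coherent root (λ _ → es) lines γ
  coh {L} m (edge e) ga gb gc with γ⁻ L ga | γ⁻ L gb | γ⁻ L gc
  ... | _ , pa , refl | _ , pb , refl | _ , pc , refl with lies-over e pa pb pc
  ... | (i , eq) , refl , refl , refl =
    Edge-subst (sym (spread-at s₁ L (cong s₁ eq))) (sym (spread-at s₂ L (cong s₂ eq)))
      (sym (spread-at s₃ L (cong s₃ eq))) (edge (∈-root⁺ (L at i)))
  coh m (sw₁₂ e) ga gb gc = sw₁₂ (coh m e gb ga gc)
  coh m (sw₂₃ e) ga gb gc = sw₂₃ (coh m e ga gc gb)

  -- Read at an active coordinate of `L`, a root edge returns a letter, and letters are edges of the
  -- picture.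
  ind : Induced root (λ _ → es) lines γ
  ind {L} m (edge e) ga gb gc with ∈-root⁻ e | ∈-lines⁻ m
  ... | w , refl | j , act =
    Edge-subst (back s₁ ga) (back s₂ gb) (back s₃ gc) (edge (letter-∈ (lookup w j)))
    where
    back : ∀ s {v} → γ L v ≡ just (spell s w) → s (letter (lookup w j)) ≡ v
    back s g = trans (sym (lookup-spell s w j)) (γ-lookup L g act)
  ind m (sw₁₂ e) ga gb gc = sw₁₂ (ind m e gb ga gc)
  ind m (sw₂₃ e) ga gb gc = sw₂₃ (ind m e ga gc gb)

  open Amalgam root (λ _ → es) lines γ

  -- All coordinates of a glued word lie over the same base vertex, so any single coordinate can
  -- define the projection.
  π' : Vertex → ℕ
  π' (inj₁ u)       = π (lookup u j₀)
  π' (inj₂ (_ , v)) = π v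

  π-spread : ∀ {v s} → Part (π v) s → ∀ L → π (lookup (spread s v L) j₀) ≡ π v
  π-spread {v} {s} p L rewrite Vec.lookup-map j₀ (Maybe.maybe′ (λ i → s (letter i)) v) L with lookup L j₀
  ... | nothing = refl
  ... | just i  = π-letter p i

  π-place : ∀ L v → π' (place L v) ≡ π v
  π-place L v with γ L v in eq
  ... | nothing = refl
  ... | just p with γ⁻ L eq
  ... | s , q , refl = π-spread q L

  π-amalgam : ∀ {e} → e ∈ amalgam → map³ π' e ≡ (x , y , z) ⊎ ∃[ e' ] (e' ∈ es × map³ π' e ≡ map³ π e')
  π-amalgam e with ∈-++⁻ (map (map³ inj₁) root) e
  ... | inj₁ r with ∈-map⁻ (map³ inj₁) r
  ... | _ , r' , refl with ∈-root⁻ r'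
  ... | w , refl = inj₁ (cong₂ _,_ (over part₁) (cong₂ _,_ (over part₂) (over part₃)))
    where
    over : ∀ {m s} → Part m s → π (lookup (spell s w) j₀) ≡ m
    over {s = s} p = trans (cong π (lookup-spell s w j₀)) (π-letter p (lookup w j₀))
  π-amalgam e | inj₂ r with ∈-copies⁻ (λ L → map³ (place L)) lines es r
  ... | L , _ , (a , b , c) , g , refl =
    inj₂ ((a , b , c) , g , cong₂ _,_ (π-place L a) (cong₂ _,_ (π-place L b) (π-place L c)))

  copy-∈ : ∀ {L e} → L ∈ lines → e ∈ es → map³ (place L) e ∈ amalgam
  copy-∈ m e = ∈-++⁺ʳ (map (map³ inj₁) root) (∈-concat⁺′ (∈-map⁺ _ e) (∈-map⁺ copy m))

  -- Three glued vertices over increasing base vertices must lie over `x`, `y`, `z` in this order.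
  -- So a missing edge always keeps a private vertex, as `caught-copy` requires.
  unglued : ∀ {x₀ y₀ z₀} → x₀ < y₀ → y₀ < z₀ → (x , y , z) ≢ (x₀ , y₀ , z₀) →
            ∀ L {v v' v''} → π v ≡ x₀ → π v' ≡ y₀ → π v'' ≡ z₀ →
            γ L v ≡ nothing ⊎ γ L v' ≡ nothing ⊎ γ L v'' ≡ nothing
  unglued lt lt' f≢e L {v} {v'} {v''} refl refl refl with γ L v in g | γ L v' in g' | γ L v'' in g''
  ... | nothing | _ | _ = inj₁ refl
  ... | just _ | nothing | _ = inj₂ (inj₁ refl)
  ... | just _ | just _ | nothing = inj₂ (inj₂ refl)
  ... | just _ | just _ | just _ =
    let _ , a , _ = γ⁻ L g ; _ , b , _ = γ⁻ L g' ; _ , c , _ = γ⁻ L g''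
    in contradiction (sym (proj₁ (part-increasing a b c lt lt'))) f≢e

  wordColour : Col Vertex → Vec (Fin ℓ) dim → Bool
  wordColour C w = col C (inj₁ (spell s₁ w)) (inj₁ (spell s₂ w)) (inj₁ (spell s₃ w))

  place-letter : ∀ {m s i} L → part m ≡ just s → π (s (letter i)) ≡ m →
                 place L (s (letter i)) ≡ inj₁ (spell s (L at i))
  place-letter {s = s} {i} L p refl = trans
    (place-just (cong (Maybe.map (λ s' → spread s' (s (letter i)) L)) p)) (cong inj₁ (spread-at s L refl))

  colour-letter : ∀ C L i → col C (place L (s₁ (letter i))) (place L (s₂ (letter i))) (place L (s₃ (letter i))) ≡
                  wordColour C (L at i)
  colour-letter C L i = col-cong C (place-letter L part-x (π-letter part₁ i))
    (place-letter L part-y (π-letter part₂ i)) (place-letter L part-z (π-letter part₃ i))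

-- A designed triple with an unglued vertex lives in a single copy, and so does every near-clique on it.
module Trap (n : ℕ) {U V K : Set} (R : List (Triple U)) (es : List (Triple V)) (ks : List K) (γ : K → V → Maybe U)
  (γ-inj : GlueInjective ks γ)
  (coh : Coherent R (λ _ → es) ks γ) (ind : Induced R (λ _ → es) ks γ) where

  open Amalgam R (λ _ → es) ks γ
  open Glue γ-inj coh ind

  module _ {L} (L∈ : L ∈ ks) (f : Fin (4 + n) → Vertex) {i j k} (d : Distinct i j k)
    (near : Near amalgam f i j k) where

    trapped : ∀ p {v} → f p ≡ inj₂ (L , v) → inj₂ (L , v) ≡ place L v → ∀ m → ∃[ b ] f m ≡ place L b
    trapped p {v} fp pl m with p Fin.≟ m
    ... | yes refl = v , trans fp pl
    ... | no p≢m = proj₂ (proj₂ (linked (Edge-subst fp refl refl (proj₂ (near-link d near p≢m)))))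

    pull : (∀ m → ∃[ b ] f m ≡ place L b) → ∀ {d} → Caught n es d →
           f i ≡ place L (Design.x d) → f j ≡ place L (Design.y d) → f k ≡ place L (Design.z d) →
           (∃[ q ] f q ≡ place L (Design.a d)) ⊎ (∃[ q ] f q ≡ place L (Design.a' d))
    pull g c fi fj fk = Sum.map (λ (q , eq) → q , trans (proj₂ (g q)) (cong (place L) eq))
                                (λ (q , eq) → q , trans (proj₂ (g q)) (cong (place L) eq))
      (c (proj₁ ∘ g) d (at fi) (at fj) (at fk) λ a b c d' ne →
        reflect L∈ (Edge-subst (proj₂ (g a)) (proj₂ (g b)) (proj₂ (g c)) (near a b c d' ne)))
      where
      at : ∀ {m v} → f m ≡ place L v → proj₁ (g m) ≡ v
      at {m} eq = place-injective L∈ (trans (sym (proj₂ (g m))) eq)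

  caught-copy : ∀ {L d} → L ∈ ks →
    γ L (Design.x d) ≡ nothing ⊎ γ L (Design.y d) ≡ nothing ⊎ γ L (Design.z d) ≡ nothing →
    Caught n es d → Caught n amalgam (mapD (place L) d)
  caught-copy L∈ u c f {i} {j} {k} d fi fj fk near = pull L∈ f d near (located u) c fi fj fk
    where
    located : _ → ∀ m → ∃[ b ] f m ≡ place _ b
    located (inj₁ u) = trapped L∈ f d near i (trans fi (place-nothing u)) (sym (place-nothing u))
    located (inj₂ (inj₁ u)) = trapped L∈ f d near j (trans fj (place-nothing u)) (sym (place-nothing u))
    located (inj₂ (inj₂ u)) = trapped L∈ f d near k (trans fk (place-nothing u)) (sym (place-nothing u))

-- Iterating the partite step over the base edges

module Partite (n : ℕ) (base : List (Triple ℕ)) (sorted : Sorted base)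
  (x₀ y₀ z₀ : ℕ) (x₀<y₀ : x₀ < y₀) (y₀<z₀ : y₀ < z₀) (e∉base : ¬ (x₀ , y₀ , z₀) ∈ base) where

  off : ℕ → Set
  off m = m ≢ x₀ × m ≢ y₀ × m ≢ z₀

  record Valid {V : Set} (π : V → ℕ) (d : Design V) : Set where
    open Design d
    field
      πx : π x ≡ x₀
      πy : π y ≡ y₀
      πz : π z ≡ z₀
      πa : off (π a)
      πa' : off (π a')
      a≢a' : a ≢ a'

  module _ {V₀ : Set} (es₀ : List (Triple V₀)) (D₀ : List (Design V₀)) (π₀ : V₀ → ℕ) where

    -- The gain is `ι-const`: a copy of the initial picture in which `C` depends only on the
    -- projection, for edges over `fs`. Each step adds one base edge to `fs`.
    record Embedding {V : Set} (es : List (Triple V)) (D : List (Design V)) (π : V → ℕ)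
      (fs : List (Triple ℕ)) (C : Col V) : Set where
      field
        ι       : V₀ → V
        ι-edge  : ∀ {e} → e ∈ es₀ → map³ ι e ∈ es
        ι-D     : ∀ {d} → d ∈ D₀ → mapD ι d ∈ D
        ι-π     : ∀ v → π (ι v) ≡ π₀ v
        ι-const : ∀ {f a b c a' b' c'} → f ∈ fs →
          (a , b , c) ∈ es₀ → map³ π₀ (a , b , c) ≡ f → (a' , b' , c') ∈ es₀ → map³ π₀ (a' , b' , c') ≡ f →
          col C (ι a) (ι b) (ι c) ≡ col C (ι a') (ι b') (ι c')

    record Picture (fs : List (Triple ℕ)) : Set₁ where
      field
        {V}    : Set
        _≟_    : DecidableEquality V
        es     : List (Triple V)
        D      : List (Design V)
        π      : V → ℕ
        hom    : ∀ {e} → e ∈ es → map³ π e ∈ base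
        valid  : ∀ {d} → d ∈ D → Valid π d
        caught : ∀ {d} → d ∈ D → Caught n es d
        embed  : ∀ C → Embedding es D π fs C

    module Step {fs : List (Triple ℕ)} (P : Picture fs) (x y z : ℕ) (f∈base : (x , y , z) ∈ base)
      (f≢e : (x , y , z) ≢ (x₀ , y₀ , z₀)) where
      open Picture P

      over? : (e : Triple V) → Dec (map³ π e ≡ (x , y , z))
      over? e = _≟³_ ℕ._≟_ (map³ π e) (x , y , z)

      abstract
        letters : List (Triple V)
        letters = filter over? es

        letters⁻ : ∀ {e} → e ∈ letters → e ∈ es × map³ π e ≡ (x , y , z)
        letters⁻ = ∈-filter⁻ over? {xs = es}

        letters⁺ : ∀ {e} → e ∈ es → map³ π e ≡ (x , y , z) → ∃[ i ] List.lookup letters i ≡ e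
        letters⁺ m eq = let l = ∈-filter⁺ over? m eq in index l , sym (Any.lookup-index l)

      ℓ : ℕ
      ℓ = length letters

      dim : ℕ
      dim = proj₁ (hales-jewett ℓ 2)

      hj : HalesJewett ℓ 2 dim
      hj = proj₂ (hales-jewett ℓ 2)

      -- The dimension is positive because the line found for a constant colouring has an active
      -- coordinate.
      j₀ : Fin dim
      j₀ = proj₁ (proj₁ (proj₂ (hj (λ _ → zero))))

      open Product es π (λ m → sorted (hom m)) (proj₁ (sorted f∈base)) (proj₂ (sorted f∈base))
        (List.lookup letters) (λ i → proj₁ (letters⁻ (∈-lookup i))) (λ i → proj₂ (letters⁻ (∈-lookup i)))
        letters⁺ j₀
      open Amalgam root (λ _ → es) lines γ
      open Glue γ-inj coh ind
      open Trap n root es lines γ γ-inj coh ind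

      D' : List (Design Vertex)
      D' = concatMap (λ L → map (mapD (place L)) D) lines

      D'⁺ : ∀ {L d} → L ∈ lines → d ∈ D → mapD (place L) d ∈ D'
      D'⁺ m d = ∈-concat⁺′ (∈-map⁺ _ d) (∈-map⁺ (λ L → map (mapD (place L)) D) m)

      D'⁻ : ∀ {d} → d ∈ D' → ∃[ L ] (L ∈ lines × ∃[ d' ] (d' ∈ D × d ≡ mapD (place L) d'))
      D'⁻ = ∈-copies⁻ (λ L → mapD (place L)) lines D

      hom' : ∀ {e} → e ∈ amalgam → map³ π' e ∈ base
      hom' m with π-amalgam m
      ... | inj₁ eq = subst (_∈ base) (sym eq) f∈base
      ... | inj₂ (e' , m' , eq) = subst (_∈ base) (sym eq) (hom m')

      valid' : ∀ {d} → d ∈ D' → Valid π' d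
      valid' d with D'⁻ d
      ... | L , m , d' , k , refl = record
        { πx = trans (π-place L _) πx ; πy = trans (π-place L _) πy ; πz = trans (π-place L _) πz
        ; πa = subst off (sym (π-place L _)) πa ; πa' = subst off (sym (π-place L _)) πa'
        ; a≢a' = λ eq → a≢a' (place-injective m eq) }
        where open Valid (valid k)

      caught' : ∀ {d} → d ∈ D' → Caught n amalgam d
      caught' dm with D'⁻ dm
      ... | L , m , d' , k , refl = caught-copy m (unglued x₀<y₀ y₀<z₀ f≢e L πx πy πz) (caught k)
        where open Valid (valid k)

      toFin : Bool → Fin 2
      toFin false = zero
      toFin true  = suc zero

      toFin-injective : ∀ {b b'} → toFin b ≡ toFin b' → b ≡ b'
      toFin-injective {false} {false} _ = refl
      toFin-injective {true}  {true}  _ = refl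

      -- Edges over `(x , y , z)` in the copy of `L` are glued to points of `L`, which have one
      -- colour by Hales-Jewett; the edges over `fs` are handled by the embedding into the smaller
      -- picture, placed in that copy.
      module Find (C : Col Vertex) where
        line : MonoLine (λ w → toFin (wordColour C w))
        line = hj (λ w → toFin (wordColour C w))

        L : Line ℓ dim
        L = proj₁ line

        L∈ : L ∈ lines
        L∈ = ∈-lines⁺ (proj₁ (proj₂ line))

        open Embedding (embed (pullback (place L) C))

        over : ∀ e → map³ π₀ e ≡ (x , y , z) → map³ π (map³ ι e) ≡ (x , y , z)
        over (u , v , w) eq = trans (cong₂ _,_ (ι-π u) (cong₂ _,_ (ι-π v) (ι-π w))) eq

        colourOf : Triple V₀ → Bool
        colourOf (a , b , c) = col C (place L (ι a)) (place L (ι b)) (place L (ι c))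

        colour-over : ∀ {e} → e ∈ es₀ → map³ π₀ e ≡ (x , y , z) → ∃[ i ] colourOf e ≡ wordColour C (L at i)
        colour-over {e} m eq with letters⁺ (ι-edge m) (over e eq)
        ... | i , eq' = i , trans (col-cong C (cong (place L ∘ s₁) (sym eq')) (cong (place L ∘ s₂) (sym eq'))
          (cong (place L ∘ s₃) (sym eq'))) (colour-letter C L i)

        const : ∀ {f a b c a' b' c'} → f ∈ (x , y , z) ∷ fs →
          (a , b , c) ∈ es₀ → map³ π₀ (a , b , c) ≡ f → (a' , b' , c') ∈ es₀ → map³ π₀ (a' , b' , c') ≡ f →
          colourOf (a , b , c) ≡ colourOf (a' , b' , c')
        const (there f∈) e p e' p' = ι-const f∈ e p e' p'
        const (here refl) e p e' p' = let i , q = colour-over e p ; j , q' = colour-over e' p' in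
          trans q (trans (toFin-injective (proj₂ (proj₂ line) i j)) (sym q'))

        embedding : Embedding amalgam D' π' ((x , y , z) ∷ fs) C
        embedding = record
          { ι = λ v → place L (ι v)
          ; ι-edge = λ m → copy-∈ L∈ (ι-edge m)
          ; ι-D = λ m → D'⁺ L∈ (ι-D m)
          ; ι-π = λ v → trans (π-place L (ι v)) (ι-π v)
          ; ι-const = const
          }

      picture : Picture ((x , y , z) ∷ fs)
      picture = record
        { _≟_ = Sum.≡-dec (Vec.≡-dec _≟_) (≡-dec (Vec.≡-dec (Maybe.≡-dec Fin._≟_)) _≟_)
        ; es = amalgam ; D = D' ; π = π' ; hom = hom' ; valid = valid' ; caught = caught' ; embed = Find.embedding }

    pictures : Picture [] → ∀ fs → (∀ {f} → f ∈ fs → f ∈ base) → Picture fs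
    pictures P [] _ = P
    pictures P ((x , y , z) ∷ fs) h =
      Step.picture (pictures P fs (λ m → h (there m))) x y z (h (here refl)) (λ { refl → e∉base (h (here refl)) })

-- Signal senders

Edge-[]⁻ : ∀ {V : Set} {a b c : V} → ¬ Edge [] a b c
Edge-[]⁻ e with ∈-vertices e
... | () , _

Clique : {V : Set} {t : ℕ} → List (Triple V) → (Fin t → V) → Set
Clique es f = ∀ i j k → Distinct i j k → Edge es (f i) (f j) (f k)

clique-injective : ∀ {V n} {es : List (Triple V)} {f : Fin (3 + n) → V} → Proper es → Clique es f → Injective _≡_ _≡_ f
clique-injective {f = f} pr cl {i} {j} eq with i Fin.≟ j
... | yes p = p
... | no i≢j = contradiction eq (proj₁ (pr (cl i j _ (proj₂ (third i≢j)))))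

Edge-map-inj : ∀ {V W : Set} (f : V → W) → Injective _≡_ _≡_ f → ∀ {es a b c} →
  Edge (map (map³ f) es) (f a) (f b) (f c) → Edge es a b c
Edge-map-inj f inj e with Edge-map⁻ f e
... | _ , _ , _ , m , p , q , r = Edge-subst (inj (sym p)) (inj (sym q)) (inj (sym r)) m

Edge-single : ∀ {V : Set} {t} (f : Fin t → V) {x y z p q s} → Edge ((x , y , z) ∷ []) p q s →
  ∀ {i j k} → Distinct i j k → f i ≡ p → f j ≡ q → f k ≡ s →
  ∃[ i' ] ∃[ j' ] ∃[ k' ] (Distinct i' j' k' × f i' ≡ x × f j' ≡ y × f k' ≡ z)
Edge-single f (edge (here refl)) d p q r = _ , _ , _ , d , p , q , r
Edge-single f (sw₁₂ e) d p q r = Edge-single f e (Distinct-12 d) q p r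
Edge-single f (sw₂₃ e) d p q r = Edge-single f e (Distinct-23 d) p r q

module _ {V : Set} (_≟_ : DecidableEquality V) where

  recolour : Triple V → Bool → Col V → Col V
  recolour e d C = record
    { col = λ a b c → pick-colour (col (fromRed _≟_ (e ∷ [])) a b c) (col C a b c)
    ; col₁₂ = λ a b c → cong₂ pick-colour (col₁₂ (fromRed _≟_ (e ∷ [])) a b c) (col₁₂ C a b c)
    ; col₂₃ = λ a b c → cong₂ pick-colour (col₂₃ (fromRed _≟_ (e ∷ [])) a b c) (col₂₃ C a b c) }
    where
    pick-colour : Bool → Bool → Bool
    pick-colour b c = if b then d else c

  recolour-on : ∀ {e} d C {a b c} → Edge (e ∷ []) a b c → col (recolour e d C) a b c ≡ d
  recolour-on {e} d C {a} {b} {c} m rewrite dec-true (edge? _≟_ (e ∷ []) a b c) m = refl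

  recolour-off : ∀ {e} d C {a b c} → ¬ Edge (e ∷ []) a b c → col (recolour e d C) a b c ≡ col C a b c
  recolour-off {e} d C {a} {b} {c} m rewrite dec-false (edge? _≟_ (e ∷ []) a b c) m = refl

  record Blocked (t : ℕ) (e : Triple V) (es : List (Triple V)) (C : Col V) (c : Bool) : Set where
    field
      f        : Fin t → V
      {i j k}  : Fin t
      distinct : Distinct i j k
      fi       : f i ≡ s₁ e
      fj       : f j ≡ s₂ e
      fk       : f k ≡ s₃ e
      clique   : Clique (e ∷ es) f
      near     : ∀ a b d → Distinct a b d → ¬ Edge ((i , j , k) ∷ []) a b d →
                 Edge es (f a) (f b) (f d) × col C (f a) (f b) (f d) ≡ c

  abstract
    -- Give `e` the colour `c`: the monochromatic clique that appears must use `e`, and therefore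
    -- has colour `c`.
    blocked : ∀ {n e es C} → Proper (e ∷ es) → Arrows (3 + n) (e ∷ es) → Good (3 + n) es C → ∀ c → Blocked (3 + n) e es C c
    blocked {n} {e} {es} {C} pr arr good c with arr (recolour e c C)
    ... | c' , f , m with Fin.any? (λ i → Fin.any? λ j → Fin.any? λ k →
          (¬? (i Fin.≟ j) ×-dec ¬? (j Fin.≟ k) ×-dec ¬? (i Fin.≟ k)) ×-dec edge? _≟_ (e ∷ []) (f i) (f j) (f k))
    ... | no none = ⊥-elim (good c' (f , λ i j k d →
        let ne = λ e' → none (i , j , k , d , e') in
        [ (λ e' → ⊥-elim (ne e')) , id ]′ (Edge-∷⁻ (proj₁ (m i j k d))) ,
        trans (sym (recolour-off c C ne)) (proj₂ (m i j k d))))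
    ... | yes (i₀ , j₀ , k₀ , d₀ , e₀) with Edge-single f e₀ d₀ refl refl refl
    ... | i , j , k , d , refl , refl , refl = record
      { f = f ; distinct = d ; fi = refl ; fj = refl ; fk = refl ; clique = cl
      ; near = λ a b d' dd ne → let ne' = λ e' → ne (Edge-map-inj f (clique-injective pr cl) e') in
          [ (λ e' → ⊥-elim (ne' e')) , id ]′ (Edge-∷⁻ (cl a b d' dd)) ,
          trans (sym (recolour-off c C ne')) (trans (proj₂ (m a b d' dd)) c'≡c) }
      where
      cl : Clique (e ∷ es) f
      cl a b d' dd = proj₁ (m a b d' dd)
      c'≡c : c' ≡ c
      c'≡c = trans (sym (proj₂ (m i j k d))) (recolour-on c C (edge (here refl)))

    -- Strip the edges of `es` one by one; as `Γ` alone has a good colouring, arrowing is lost at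
    -- some edge.
    critical : ∀ {n} es Γ → Arrows (3 + n) (es ++ Γ) → ∃ (Good {V} (3 + n) Γ) →
      ∃[ e ] ∃[ rest ] ((∀ {x} → x ∈ e ∷ rest → x ∈ es) × Arrows (3 + n) (e ∷ rest ++ Γ) × ∃ (Good {V} (3 + n) (rest ++ Γ)))
    critical [] Γ arr (C , g) = let c , m = arr C in ⊥-elim (g c m)
    critical {n} (e ∷ es) Γ arr g with Decide.arrows-or-good _≟_ n (es ++ Γ)
    ... | inj₂ good = e , es , id , arr , good
    ... | inj₁ arr' with critical es Γ arr' g
    ... | e' , rest , sub , p , q = e' , rest , there ∘ sub , p , q

-- The forced edges come from two near-cliques on the missing edge `x y z` and still share the
-- vertex `x`. The good colouring `C` keeps `forced` from being vacuous.
record Sender (n : ℕ) : Set₁ where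
  field
    {V}      : Set
    _≟_      : DecidableEquality V
    es       : List (Triple V)
    isProper : Proper es
    C        : Col V
    good     : Good (4 + n) es C
    x y z a a' : V
    xy : x ≢ y
    xz : x ≢ z
    xa : x ≢ a
    xa' : x ≢ a'
    yz : y ≢ z
    ya : y ≢ a
    ya' : y ≢ a'
    za : z ≢ a
    za' : z ≢ a'
    aa' : a ≢ a'
    edge₀    : Edge es x y a
    edge₁    : Edge es x z a'
    forced   : ∀ C → Good (4 + n) es C → col C x y a ≢ col C x z a'

Edge-hom⁺ : ∀ {V W : Set} (f : V → W) {es es'} → (∀ {e} → e ∈ es → map³ f e ∈ es') →
                  ∀ {a b c} → Edge es a b c → Edge es' (f a) (f b) (f c)
Edge-hom⁺ f h = Edge-hom f (λ m → edge (h m))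

sorted-proper : ∀ {es} → Sorted es → Proper es
sorted-proper s = proper λ m → let p , q = s m in ℕ.<⇒≢ p , ℕ.<⇒≢ q , ℕ.<⇒≢ (ℕ.<-trans p q)

-- The initial picture: a copy of the whole base, and for all h , h' a base fragment supported on the
-- entries of h together with one supported on those of h', sharing only the three vertices of e.
module Initial (n : ℕ) (base : List (Triple ℕ)) (sorted : Sorted base)
  (x₀ y₀ z₀ : ℕ) (x₀<y₀ : x₀ < y₀) (y₀<z₀ : y₀ < z₀) (e∉base : ¬ (x₀ , y₀ , z₀) ∈ base) where

  open Partite n base sorted x₀ y₀ z₀ x₀<y₀ y₀<z₀ e∉base

  t : ℕ
  t = 4 + n

  Pair : Set
  Pair = Vec ℕ t × Vec ℕ t

  V₀ : Set
  V₀ = Maybe Pair × Bool × ℕ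

  π₀ : V₀ → ℕ
  π₀ (_ , _ , v) = v

  off? : ∀ v → Dec (off v)
  off? v = ¬? (v ℕ.≟ x₀) ×-dec ¬? (v ℕ.≟ y₀) ×-dec ¬? (v ℕ.≟ z₀)

  side : Bool → Pair → Vec ℕ t
  side true  = proj₁
  side false = proj₂

  whole : ℕ → V₀
  whole v = nothing , false , v

  -- Forgets the side at the vertices of the missing edge, where the two fragments of a pair are
  -- joined.
  norm : Bool → ℕ → Bool
  norm s v = if does (off? v) then s else false

  norm-off : ∀ s {v} → off v → norm s v ≡ s
  norm-off s {v} o rewrite dec-true (off? v) o = refl

  norm-on : ∀ s {v} → ¬ off v → norm s v ≡ false
  norm-on s {v} o rewrite dec-false (off? v) o = refl

  lift : Pair → Bool → ℕ → V₀
  lift h s v = just h , norm s v , v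

  entry : Pair → Bool → Fin t → V₀
  entry h s q = lift h s (lookup (side s h) q)

  _∈ᵛ_ : ℕ → Vec ℕ t → Set
  v ∈ᵛ h = ∃[ q ] lookup h q ≡ v

  within? : (h : Vec ℕ t) (e : Triple ℕ) → Dec (s₁ e ∈ᵛ h × s₂ e ∈ᵛ h × s₃ e ∈ᵛ h)
  within? h (a , b , c) = in? a ×-dec in? b ×-dec in? c
    where
    in? : ∀ v → Dec (v ∈ᵛ h)
    in? v = Fin.any? (λ q → lookup h q ℕ.≟ v)

  abstract
    restrict : Vec ℕ t → List (Triple ℕ)
    restrict h = filter (within? h) base

    restrict⁻ : ∀ {h e} → e ∈ restrict h → e ∈ base × s₁ e ∈ᵛ h × s₂ e ∈ᵛ h × s₃ e ∈ᵛ h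
    restrict⁻ {h} = ∈-filter⁻ (within? h) {xs = base}

    restrict⁺ : ∀ {h e} → e ∈ base → s₁ e ∈ᵛ h × s₂ e ∈ᵛ h × s₃ e ∈ᵛ h → e ∈ restrict h
    restrict⁺ {h} = ∈-filter⁺ (within? h)

    pairs : List Pair
    pairs = cartesianProduct (allVecs (vertices base) t) (allVecs (vertices base) t)

    ∈-pairs : ∀ {h h'} → (∀ i → lookup h i ∈ vertices base) → (∀ i → lookup h' i ∈ vertices base) → (h , h') ∈ pairs
    ∈-pairs p q = ∈-cartesianProduct⁺ (∈-allVecs⁺ _ p) (∈-allVecs⁺ _ q)

  restrict-edge⁺ : ∀ {h a b c} → Edge base a b c → a ∈ᵛ h → b ∈ᵛ h → c ∈ᵛ h → Edge (restrict h) a b c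
  restrict-edge⁺ (edge m) p q r = edge (restrict⁺ m (p , q , r))
  restrict-edge⁺ (sw₁₂ e) p q r = sw₁₂ (restrict-edge⁺ e q p r)
  restrict-edge⁺ (sw₂₃ e) p q r = sw₂₃ (restrict-edge⁺ e p r q)

  restrict-edge⁻ : ∀ {h a b c} → Edge (restrict h) a b c → a ∈ᵛ h × b ∈ᵛ h × c ∈ᵛ h
  restrict-edge⁻ (edge m) = proj₂ (restrict⁻ m)
  restrict-edge⁻ (sw₁₂ e) = let p , q , r = restrict-edge⁻ e in q , p , r
  restrict-edge⁻ (sw₂₃ e) = let p , q , r = restrict-edge⁻ e in p , r , q

  fragment : Pair × Bool → List (Triple V₀)
  fragment (h , s) = map (map³ (lift h s)) (restrict (side s h))

  sides : List (Pair × Bool)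
  sides = cartesianProduct pairs (true ∷ false ∷ [])

  ∈-sides : ∀ {h} s → h ∈ pairs → (h , s) ∈ sides
  ∈-sides true  m = ∈-cartesianProduct⁺ m (here refl)
  ∈-sides false m = ∈-cartesianProduct⁺ m (there (here refl))

  es₀ : List (Triple V₀)
  es₀ = map (map³ whole) base ++ concatMap fragment sides

  whole-∈ : ∀ {e} → e ∈ base → map³ whole e ∈ es₀
  whole-∈ m = ∈-++⁺ˡ (∈-map⁺ (map³ whole) m)

  lift-∈ : ∀ {h s e} → h ∈ pairs → e ∈ restrict (side s h) → map³ (lift h s) e ∈ es₀
  lift-∈ {h} {s} m i = ∈-++⁺ʳ (map (map³ whole) base)
    (∈-concat⁺′ (∈-map⁺ (map³ (lift h s)) i) (∈-map⁺ fragment (∈-sides s m)))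

  hom₀ : ∀ {e} → e ∈ es₀ → map³ π₀ e ∈ base
  hom₀ m with ∈-++⁻ (map (map³ whole) base) m
  ... | inj₁ p with ∈-map⁻ (map³ whole) p
  ... | _ , q , refl = q
  hom₀ m | inj₂ p with ∈-concat⁻′ (map fragment sides) p
  ... | _ , q , r with ∈-map⁻ fragment r
  ... | (h , s) , _ , refl with ∈-map⁻ (map³ (lift h s)) q
  ... | _ , i , refl = proj₁ (restrict⁻ i)

  same-side : ∀ {h s v p q} → off v → Edge es₀ (just h , s , v) p q →
              v ∈ᵛ side s h × (∃[ b ] (b ∈ᵛ side s h × p ≡ lift h s b))
  same-side {h} {s} {v} {p} {q} o e with Edge-++⁻ (map (map³ whole) base) e
  ... | inj₁ w with Edge-map⁻ whole w
  ... | _ , _ , _ , _ , () , _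
  same-side {h} {s} {v} {p} {q} o e | inj₂ w with Edge-concatMap⁻ fragment sides w
  ... | (h' , s') , _ , u with Edge-map⁻ (lift h' s') u
  ... | a , b , c , m , refl , refl , refl rewrite norm-off s' o =
    let va , vb , _ = restrict-edge⁻ m in va , b , vb , refl

  Choice : Set
  Choice = Pair × Fin t × Fin t

  OffE : Choice → Set
  OffE (h , q , q') = off (lookup (side true h) q) × off (lookup (side false h) q')

  offE? : (c : Choice) → Dec (OffE c)
  offE? (h , q , q') = off? _ ×-dec off? _

  mk : Choice → Design V₀
  mk (h , q , q') = design (lift h true x₀) (lift h true y₀) (lift h true z₀)
    (entry h true q) (entry h false q')

  choices : List Choice
  choices = cartesianProduct pairs (cartesianProduct (allFin t) (allFin t))

  abstract
    D₀ : List (Design V₀)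
    D₀ = map mk (filter offE? choices)

    D₀⁻ : ∀ {d} → d ∈ D₀ → ∃[ c ] (OffE c × d ≡ mk c)
    D₀⁻ m with ∈-map⁻ mk m
    ... | c , m' , eq = c , proj₂ (∈-filter⁻ offE? {xs = choices} m') , eq

    D₀⁺ : ∀ {h q q'} → h ∈ pairs → OffE (h , q , q') → mk (h , q , q') ∈ D₀
    D₀⁺ {h} {q} {q'} m o = ∈-map⁺ mk (∈-filter⁺ offE? (∈-cartesianProduct⁺ m (∈-cartesianProduct⁺ (∈-allFin q) (∈-allFin q'))) o)

  valid₀ : ∀ {d} → d ∈ D₀ → Valid π₀ d
  valid₀ m with D₀⁻ m
  ... | (h , q , q') , (o , o') , refl = record
    { πx = refl ; πy = refl ; πz = refl ; πa = o ; πa' = o'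
    ; a≢a' = λ eq → case trans (sym (norm-off true o)) (trans (cong (proj₁ ∘ proj₂) eq) (norm-off false o')) of λ () }

  module _ (f : Fin t → V₀) {i j k} (d : Distinct i j k) {h : Pair}
    (fi : f i ≡ lift h true x₀) (fj : f j ≡ lift h true y₀) (fk : f k ≡ lift h true z₀) (near : Near es₀ f i j k) where

    private
      w = proj₁ (fourth d)
      w≢i = proj₁ (proj₂ (fourth d))
      w≢j = proj₁ (proj₂ (proj₂ (fourth d)))
      w≢k = proj₂ (proj₂ (proj₂ (fourth d)))

      link : ∀ {m m'} → m ≢ m' → ∃[ l ] Edge es₀ (f m) (f m') (f l)
      link = near-link d near

      π-distinct : ∀ {m m'} → m ≢ m' → π₀ (f m) ≢ π₀ (f m')
      π-distinct ne = proj₁ (sorted-proper sorted (Edge-hom⁺ π₀ hom₀ (proj₂ (link ne))))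

      f-injective : ∀ {m m'} → f m ≡ f m' → m ≡ m'
      f-injective {m} {m'} eq with m Fin.≟ m'
      ... | yes p = p
      ... | no ne = contradiction (cong π₀ eq) (π-distinct ne)

      off-w : off (π₀ (f w))
      off-w = (λ eq → π-distinct w≢i (trans eq (sym (cong π₀ fi)))) ,
              (λ eq → π-distinct w≢j (trans eq (sym (cong π₀ fj)))) ,
              (λ eq → π-distinct w≢k (trans eq (sym (cong π₀ fk))))

      home : proj₁ (f w) ≡ just h
      home with Edge-++⁻ (map (map³ whole) base) (proj₂ (link w≢i))
      ... | inj₁ u with Edge-map⁻ whole u
      ... | _ , _ , _ , _ , _ , eq , _ = case trans (sym (cong proj₁ fi)) (cong proj₁ eq) of λ ()
      home | inj₂ u with Edge-concatMap⁻ fragment sides u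
      ... | (h' , s') , _ , v with Edge-map⁻ (lift h' s') v
      ... | _ , _ , _ , _ , eq , eq' , _ = trans (cong proj₁ eq) (trans (sym (cong proj₁ eq')) (cong proj₁ fi))

      s : Bool
      s = proj₁ (proj₂ (f w))

      fw : f w ≡ (just h , s , π₀ (f w))
      fw = cong (_, proj₂ (f w)) home

      on-side : ∀ m → ∃[ q ] f m ≡ entry h s q
      on-side m with w Fin.≟ m
      ... | yes refl = let q , eq = proj₁ (same-side off-w (Edge-subst fw refl refl (proj₂ (link w≢i))))
        in q , trans fw (cong (just h ,_) (cong₂ _,_ (sym (trans (cong (norm s) eq) (norm-off s off-w))) (sym eq)))
      ... | no w≢m = let _ , b , (q , eq) , eq' = same-side off-w (Edge-subst fw refl refl (proj₂ (link w≢m)))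
        in q , trans eq' (cong (lift h s) (sym eq))

      σ : Fin t → Fin t
      σ m = proj₁ (on-side m)

      σ-injective : Injective _≡_ _≡_ σ
      σ-injective {m} {m'} eq = f-injective (trans (proj₂ (on-side m))
        (trans (cong (λ q → entry h s q) eq) (sym (proj₂ (on-side m')))))

      σ-surjective : ∀ q → ∃[ m ] σ m ≡ q
      σ-surjective q with Fin.any? (λ m → σ m Fin.≟ q)
      ... | yes p = p
      ... | no none = contradiction
        (Fin.injective⇒≤ {f = λ m → punchOut {i = q} {j = σ m} (λ eq → none (m , sym eq))}
          (λ {x} {y} eq → σ-injective (Fin.punchOut-injective (λ p → none (x , sym p)) (λ p → none (y , sym p)) eq))) ℕ.1+n≰n

      hits : ∀ q → ∃[ m ] f m ≡ entry h s q
      hits q = let m , eq = σ-surjective q in m , trans (proj₂ (on-side m)) (cong (λ q → entry h s q) eq)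

    -- The vertex `w` off the missing edge lies in one fragment and draws the whole near-clique into
    -- it. The entries of that side of `h` are at most `t` vertices, so the near-clique uses all of
    -- them, the marked one included.
    near-side : ∀ q q' → (∃[ m ] f m ≡ entry h true q) ⊎
                         (∃[ m ] f m ≡ entry h false q')
    near-side q q' = split s hits
      where
      split : ∀ s → (∀ q → ∃[ m ] f m ≡ entry h s q) →
              (∃[ m ] f m ≡ entry h true q) ⊎ (∃[ m ] f m ≡ entry h false q')
      split true  hit = inj₁ (hit q)
      split false hit = inj₂ (hit q')

  caught₀ : ∀ {d} → d ∈ D₀ → Caught n es₀ d
  caught₀ m with D₀⁻ m
  ... | (h , q , q') , _ , refl = λ f d fi fj fk near → near-side f d fi fj fk near q q'

  initial : Picture es₀ D₀ π₀ []
  initial = record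
    { _≟_ = ≡-dec (Maybe.≡-dec (≡-dec (Vec.≡-dec ℕ._≟_) (Vec.≡-dec ℕ._≟_))) (≡-dec Bool._≟_ ℕ._≟_)
    ; es = es₀ ; D = D₀ ; π = π₀ ; hom = hom₀ ; valid = valid₀ ; caught = caught₀
    ; embed = λ C → record
      { ι = id ; ι-edge = id ; ι-D = λ { {design _ _ _ _ _} m → m } ; ι-π = λ _ → refl ; ι-const = λ () } }

  abstract
    final : Picture es₀ D₀ π₀ base
    final = pictures es₀ D₀ π₀ initial base id

-- An edge cannot have both colours, so the red and the blue near-clique are caught at different
-- edges.
two-colours : ∀ {A B : Set} {u v : Bool} → (A × u ≡ true) ⊎ (B × v ≡ true) → (A × u ≡ false) ⊎ (B × v ≡ false) →
         A × B × u ≢ v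
two-colours (inj₁ (_ , p)) (inj₁ (_ , q)) = case trans (sym p) q of λ ()
two-colours (inj₂ (_ , p)) (inj₂ (_ , q)) = case trans (sym p) q of λ ()
two-colours (inj₁ (e , p)) (inj₂ (e' , q)) = e , e' , λ eq → case trans (sym p) (trans eq q) of λ ()
two-colours (inj₂ (e' , p)) (inj₁ (e , q)) = e , e' , λ eq → case trans (sym q) (trans eq p) of λ ()

module NearSender (n : ℕ) (base : List (Triple ℕ)) (sorted : Sorted base)
  (x₀ y₀ z₀ : ℕ) (x₀<y₀ : x₀ < y₀) (y₀<z₀ : y₀ < z₀)
  (arrows : Arrows (4 + n) ((x₀ , y₀ , z₀) ∷ base)) (CB : Col ℕ) (goodB : Good (4 + n) base CB) where

  e₀ : Triple ℕ
  e₀ = x₀ , y₀ , z₀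

  abstract
    e∉base : ¬ e₀ ∈ base
    e∉base m = let c , mono = arrows CB in
      goodB c (Mono-image id CB (Edge-mono λ { (here refl) → m ; (there m') → m' }) mono)

  sorted₀ : Sorted (e₀ ∷ base)
  sorted₀ (here refl) = x₀<y₀ , y₀<z₀
  sorted₀ (there m)   = sorted m

  open Partite n base sorted x₀ y₀ z₀ x₀<y₀ y₀<z₀ e∉base
  open Initial n base sorted x₀ y₀ z₀ x₀<y₀ y₀<z₀ e∉base
  open Picture final renaming (es to Γ)

  triple : Design V → Triple V
  triple d = Design.x d , Design.y d , Design.z d

  T : List (Triple V)
  T = map triple D

  goodΓ : Good t Γ (pullback π CB)
  goodΓ c m = goodB c (Mono-image π CB (Edge-hom⁺ π hom) m)

  module _ (C : Col V) (good : Good t Γ C) where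
    open Embedding (embed C)

    χ : Col ℕ
    χ = pullback (ι ∘ whole) C

    χ-good : Good t base χ
    χ-good c m = good c (Mono-image (ι ∘ whole) C (Edge-hom⁺ (ι ∘ whole) (λ e → ι-edge (whole-∈ e))) m)

    B : ∀ c → Blocked ℕ._≟_ t e₀ base χ c
    B = blocked ℕ._≟_ (sorted-proper sorted₀) arrows χ-good

    fᴮ : Bool → Fin t → ℕ
    fᴮ c = Blocked.f (B c)

    fᴮ-vertex : ∀ c i → fᴮ c i ∈ vertices base
    fᴮ-vertex c m = let open Blocked (B c) ; _ , _ , m≢l , _ = others m in
      proj₁ (∈-vertices (proj₂ (near-link {f = f} distinct (λ a b d p q → proj₁ (near a b d p q)) m≢l)))

    -- The red and the blue near-clique that the colouring of the whole copy happens to have; they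
    -- select the missing edge to look at.
    h : Pair
    h = tabulate (fᴮ true) , tabulate (fᴮ false)

    side-h : ∀ c i → lookup (side c h) i ≡ fᴮ c i
    side-h true  = Vec.lookup∘tabulate (fᴮ true)
    side-h false = Vec.lookup∘tabulate (fᴮ false)

    h∈ : h ∈ pairs
    h∈ = ∈-pairs (λ i → subst (_∈ vertices base) (sym (side-h true i)) (fᴮ-vertex true i))
                 (λ i → subst (_∈ vertices base) (sym (side-h false i)) (fᴮ-vertex false i))

    q : Bool → Fin t
    q c = proj₁ (fourth (Blocked.distinct (B c)))

    q-off : ∀ c → off (lookup (side c h) (q c))
    q-off c = subst off (sym (side-h c (q c))) (away w≢i fi , away w≢j fj , away w≢k fk)
      where
      open Blocked (B c)
      w≢i = proj₁ (proj₂ (fourth distinct))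
      w≢j = proj₁ (proj₂ (proj₂ (fourth distinct)))
      w≢k = proj₂ (proj₂ (proj₂ (fourth distinct)))
      away : ∀ {m v} → q c ≢ m → f m ≡ v → f (q c) ≢ v
      away ne eq eq' = ne (clique-injective (sorted-proper sorted₀) clique (trans eq' (sym eq)))

    d₀ : Design V₀
    d₀ = mk (h , q true , q false)

    τ∈T : triple (mapD ι d₀) ∈ T
    τ∈T = ∈-map⁺ triple (ι-D (D₀⁺ {q = q true} {q false} h∈ (q-off true , q-off false)))

    c* : Bool
    c* = col C (ι (lift h true x₀)) (ι (lift h true y₀)) (ι (lift h true z₀))

    lift-e : ∀ c {v} → ¬ off v → lift h c v ≡ lift h true v
    lift-e c o = cong (λ s → just h , s , _) (trans (norm-on c o) (sym (norm-on true o)))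

    F : Fin t → V
    F m = ι (lift h c* (fᴮ c* m))

    fragment-edge : ∀ c {a b d} → Edge (restrict (side c h)) a b d → Edge Γ (ι (lift h c a)) (ι (lift h c b)) (ι (lift h c d))
    fragment-edge c = Edge-hom⁺ (ι ∘ lift h c) (λ m → ι-edge (lift-∈ {s = c} h∈ m))

    fragment-colour : ∀ c {a b d} → Edge (restrict (side c h)) a b d →
      col C (ι (lift h c a)) (ι (lift h c b)) (ι (lift h c d)) ≡ col χ a b d
    fragment-colour c = col-edges {C = pullback (ι ∘ lift h c) C} {D = χ} λ m →
      ι-const (proj₁ (restrict⁻ m)) (lift-∈ {s = c} h∈ m) refl (whole-∈ (proj₁ (restrict⁻ m))) refl

    -- Whatever colour `c*` the selected missing edge has, the fragment on side `c*` repeats the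
    -- colours of the whole copy by `ι-const`, so it holds the near-clique of that colour and the
    -- edge completes it.
    completed : Mono t (T ++ Γ) C c*
    completed = F , λ a b d dist → go a b d dist (edge? Fin._≟_ ((i , j , k) ∷ []) a b d)
      where
      open Blocked (B c*)
      F-i : ∀ {m v} → f m ≡ v → ¬ off v → F m ≡ ι (lift h true v)
      F-i refl o = cong ι (lift-e c* o)
      τ-edge : ∀ {a b d} → Edge ((i , j , k) ∷ []) a b d → Edge (triple (mapD ι d₀) ∷ []) (F a) (F b) (F d)
      τ-edge = Edge-hom F λ { (here refl) → edge (here (cong₂ _,_ (F-i fi λ o → proj₁ o refl)
        (cong₂ _,_ (F-i fj λ o → proj₁ (proj₂ o) refl) (F-i fk λ o → proj₂ (proj₂ o) refl)))) }
      in-side : ∀ m → f m ∈ᵛ side c* h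
      in-side m = m , side-h c* m
      go : ∀ a b d → Distinct a b d → Dec (Edge ((i , j , k) ∷ []) a b d) →
           Edge (T ++ Γ) (F a) (F b) (F d) × col C (F a) (F b) (F d) ≡ c*
      go a b d dist (yes e) = Edge-mono (λ { (here refl) → ∈-++⁺ˡ τ∈T }) (τ-edge e) ,
        col-const {C = C} (λ { (here refl) → refl }) (τ-edge e)
      go a b d dist (no ne) = let e , eq = near a b d dist ne
                                  e' = restrict-edge⁺ e (in-side a) (in-side b) (in-side d)
        in Edge-mono (∈-++⁺ʳ T) (fragment-edge c* e') , trans (fragment-colour c* e') eq

  arrowsΓ : Arrows t (T ++ Γ)
  arrowsΓ C = [ (λ good → c* C good , completed C good) , from-Γ ]′ (Decide.good-or-mono _≟_ (suc n) Γ C)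
    where
    from-Γ : ∃ (Mono t Γ C) → ∃ (Mono t (T ++ Γ) C)
    from-Γ (c , m) = c , Mono-image id C (Edge-mono (∈-++⁺ʳ T)) m

  module Extract (d : Design V) (d∈ : d ∈ D) (rest : List (Triple V)) (rest⊆ : ∀ {e} → e ∈ rest → e ∈ T)
    (arr : Arrows t (triple d ∷ rest ++ Γ)) where
    open Design d
    open Valid (valid d∈)

    G : List (Triple V)
    G = rest ++ Γ

    π-T : ∀ {e} → e ∈ T → map³ π e ≡ e₀
    π-T m with ∈-map⁻ triple m
    ... | d' , m' , refl = let v = valid m' in cong₂ _,_ (Valid.πx v) (cong₂ _,_ (Valid.πy v) (Valid.πz v))

    π-hom : ∀ {e} → e ∈ triple d ∷ G → map³ π e ∈ e₀ ∷ base
    π-hom (here refl) = here (cong₂ _,_ πx (cong₂ _,_ πy πz))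
    π-hom (there m) with ∈-++⁻ rest m
    ... | inj₁ m' = here (π-T (rest⊆ m'))
    ... | inj₂ m' = there (hom m')

    G-proper : Proper (triple d ∷ G)
    G-proper = proper λ m → let p , q , r = sorted-proper sorted₀ (edge (π-hom m)) in
      p ∘ cong π , q ∘ cong π , r ∘ cong π

    module _ (C : Col V) (good : Good t G C) where

      -- The near-clique obstructing colour `c` uses no triple of `rest`: those all project to `e₀`,
      -- and the projection is injective on a clique. Hence it lies in `Γ`, where `caught` applies.
      catch : ∀ c → (Edge G x y a × col C x y a ≡ c) ⊎ (Edge G x z a' × col C x z a' ≡ c)
      catch c with blocked _≟_ {C = C} G-proper arr good c
      ... | record { f = f ; i = i ; j = j ; k = k ; distinct = dist ; fi = refl ; fj = refl ; fk = refl ; clique = cl ; near = near } =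
        [ (λ (m , eq) → inj₁ (subst (λ v → Edge G x y v × col C x y v ≡ c) eq
              (near i j m (proj₁ dist , ≢m πy eq (proj₁ (proj₂ πa)) , ≢m πx eq (proj₁ πa))
                (λ e → proj₂ (proj₂ (perm e πa eq)) refl)))) ,
          (λ (m , eq) → inj₂ (subst (λ v → Edge G x z v × col C x z v ≡ c) eq
              (near i k m (proj₂ (proj₂ dist) , ≢m πz eq (proj₂ (proj₂ πa')) , ≢m πx eq (proj₁ πa'))
                (λ e → proj₂ (proj₂ (perm e πa' eq)) refl)))) ]′
        (caught d∈ f dist refl refl refl nearΓ)
        where
        ≢m : ∀ {i m v w} → π (f i) ≡ w → f m ≡ v → π v ≢ w → i ≢ m
        ≢m p q ne refl = ne (trans (cong π (sym q)) p)
        perm : ∀ {m v b b' b''} → Edge ((i , j , k) ∷ []) b b' b'' → off (π v) → f m ≡ v → m ≢ b × m ≢ b' × m ≢ b''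
        perm e (p , q , r) eq = ∈-perm e (λ eq' → ≢m πx eq p (sym eq')) (λ eq' → ≢m πy eq q (sym eq'))
          (λ eq' → ≢m πz eq r (sym eq'))
        πf-injective : Injective _≡_ _≡_ (π ∘ f)
        πf-injective = clique-injective {f = π ∘ f} (sorted-proper sorted₀)
          (λ a b c d → Edge-hom⁺ π π-hom (cl a b c d))
        nearΓ : Near Γ f i j k
        nearΓ a b d' dd ne with Edge-++⁻ rest (proj₁ (near a b d' dd ne))
        ... | inj₂ e = e
        ... | inj₁ e = ⊥-elim (ne (Edge-map-inj (π ∘ f) πf-injective
          (Edge-hom⁺ π (λ m → here (trans (π-T (rest⊆ m)) (sym (cong₂ _,_ πx (cong₂ _,_ πy πz))))) e)))

      negation : Edge G x y a × Edge G x z a' × col C x y a ≢ col C x z a'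
      negation = two-colours (catch true) (catch false)

    toSender : (C : Col V) → Good t G C → Sender n
    toSender C good = record
      { _≟_ = _≟_ ; es = G ; isProper = λ e → G-proper (Edge-mono there e) ; C = C ; good = good
      ; x = x ; y = y ; z = z ; a = a ; a' = a'
      ; xy = proj₁ τ ; xz = proj₂ (proj₂ τ) ; xa = ≢ πx (proj₁ πa) ; xa' = ≢ πx (proj₁ πa')
      ; yz = proj₁ (proj₂ τ) ; ya = ≢ πy (proj₁ (proj₂ πa)) ; ya' = ≢ πy (proj₁ (proj₂ πa'))
      ; za = ≢ πz (proj₂ (proj₂ πa)) ; za' = ≢ πz (proj₂ (proj₂ πa')) ; aa' = a≢a'
      ; edge₀ = proj₁ (negation C good) ; edge₁ = proj₁ (proj₂ (negation C good))
      ; forced = λ C' g → proj₂ (proj₂ (negation C' g)) }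
      where
      τ : Distinct x y z
      τ = G-proper (edge (here refl))
      ≢ : ∀ {v w m} → π v ≡ m → π w ≢ m → v ≢ w
      ≢ p ne refl = ne p

  extract : ∀ e rest → (∀ {x} → x ∈ e ∷ rest → x ∈ T) → Arrows t (e ∷ rest ++ Γ) →
            ∀ C → Good t (rest ++ Γ) C → ∃[ d ] (d ∈ D × e ≡ triple d) → Sender n
  extract _ rest sub arr C good (d , d∈ , refl) = Extract.toSender d d∈ rest (λ m → sub (there m)) arr C good

  sender : Sender n
  sender = let e , rest , sub , arr , C , good = critical _≟_ T Γ arrowsΓ (pullback π CB , goodΓ)
    in extract e rest sub arr C good (∈-map⁻ triple (sub (here refl)))

good-[] : ∀ {V : Set} {n} (C : Col V) → Good (3 + n) [] C
good-[] C c (f , m) = Edge-[]⁻ (proj₁ (m zero (suc zero) (suc (suc zero)) ((λ ()) , (λ ()) , (λ ()))))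

abstract
  -- Ramsey's theorem supplies a list that arrows, and stripping it with `critical` supplies the
  -- base together with its missing edge.
  near-sender : ∀ n → Sender n
  near-sender n =
    let es , sorted , arr = ramsey-triples (4 + n)
        (x₀ , y₀ , z₀) , rest , sub , arr' , C , good =
          critical ℕ._≟_ {suc n} es [] (subst (Arrows (4 + n)) (sym (++-identityʳ es)) arr)
            (fromRed ℕ._≟_ [] , good-[] (fromRed ℕ._≟_ []))
        x<y , y<z = sorted (sub (here refl))
    in NearSender.sender n rest (λ m → sorted (sub (there m))) x₀ y₀ z₀ x<y y<z
      (subst (λ es → Arrows (4 + n) ((x₀ , y₀ , z₀) ∷ es)) (++-identityʳ rest) arr') C
      (subst (λ es → Good (4 + n) es C) (++-identityʳ rest) good)

-- Senders with disjoint forced edges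

negate : {V : Set} → Col V → Col V
negate C = record
  { col = λ a b c → not (col C a b c) ; col₁₂ = λ a b c → cong not (col₁₂ C a b c) ; col₂₃ = λ a b c → cong not (col₂₃ C a b c) }

negate-good : ∀ {V : Set} {t es} (C : Col V) → Good t es C → Good t es (negate C)
negate-good C g c (f , m) = g (not c) (f , λ i j k d →
  proj₁ (m i j k d) , trans (sym (Bool.not-involutive _)) (cong not (proj₂ (m i j k d))))

-- Parity: an odd number of flips is a flip, which is why senders are chained in threes and not in
-- twos.
≢-trans₃ : ∀ {a b c d : Bool} → a ≢ b → b ≢ c → c ≢ d → a ≢ d
≢-trans₃ {a} {b} {c} p q r refl = q (trans (Bool.¬-not (p ∘ sym)) (sym (Bool.¬-not r)))

colour³ : {V : Set} → Col V → Triple V → Bool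
colour³ C (a , b , c) = col C a b c

Edge³ : {V : Set} → List (Triple V) → Triple V → Set
Edge³ es (a , b , c) = Edge es a b c

list³ : {V : Set} → Triple V → List V
list³ (a , b , c) = a ∷ b ∷ c ∷ []

Unique : {V : Set} → List V → Set
Unique = AllPairs _≢_

three-of : ∀ {X : Set} {T : Triple X} {a b c} → a ∈ list³ T → b ∈ list³ T → c ∈ list³ T → Distinct a b c → Edge (T ∷ []) a b c
three-of (here refl) (there (here refl)) (there (there (here refl))) _ = edge (here refl)
three-of (here refl) (there (there (here refl))) (there (here refl)) _ = sw₂₃ (edge (here refl))
three-of (there (here refl)) (here refl) (there (there (here refl))) _ = sw₁₂ (edge (here refl))
three-of (there (here refl)) (there (there (here refl))) (here refl) _ = rot (edge (here refl))
three-of (there (there (here refl))) (here refl) (there (here refl)) _ = rot (rot (edge (here refl)))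
three-of (there (there (here refl))) (there (here refl)) (here refl) _ = sw₁₃ (edge (here refl))
three-of (here refl) (here refl) _ (p , _) = contradiction refl p
three-of (there (here refl)) (there (here refl)) _ (p , _) = contradiction refl p
three-of (there (there (here refl))) (there (there (here refl))) _ (p , _) = contradiction refl p
three-of _ (here refl) (here refl) (_ , p , _) = contradiction refl p
three-of _ (there (here refl)) (there (here refl)) (_ , p , _) = contradiction refl p
three-of _ (there (there (here refl))) (there (there (here refl))) (_ , p , _) = contradiction refl p
three-of (here refl) _ (here refl) (_ , _ , p) = contradiction refl p
three-of (there (here refl)) _ (there (here refl)) (_ , _ , p) = contradiction refl p
three-of (there (there (here refl))) _ (there (there (here refl))) (_ , _ , p) = contradiction refl p

Edge-one : ∀ {X : Set} {es : List (Triple X)} {T} → Edge³ es T → ∀ {a b c} → Edge (T ∷ []) a b c → Edge es a b c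
Edge-one e = Edge-bind λ { (here refl) → e }

∈-one : ∀ {X : Set} {T : Triple X} {a b c} → Edge (T ∷ []) a b c → a ∈ list³ T × b ∈ list³ T × c ∈ list³ T
∈-one (edge (here refl)) = here refl , there (here refl) , there (there (here refl))
∈-one (sw₁₂ e) = let p , q , r = ∈-one e in q , p , r
∈-one (sw₂₃ e) = let p , q , r = ∈-one e in p , r , q

Unique-∈ : ∀ {X Y : Set} {f : X → Y} {xs : List X} → Unique (map f xs) → ∀ {a b} → a ∈ xs → b ∈ xs → f a ≡ f b → a ≡ b
Unique-∈ _ (here refl) (here refl) _ = refl
Unique-∈ {f = f} (p ∷ _) (here refl) (there m) eq = contradiction eq (All.lookup p (∈-map⁺ f m))
Unique-∈ {f = f} (p ∷ _) (there m) (here refl) eq = contradiction (sym eq) (All.lookup p (∈-map⁺ f m))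
Unique-∈ (_ ∷ u) (there m) (there m') eq = Unique-∈ u m m' eq

module _ {V U : Set} (_≟_ : DecidableEquality V) where

  glue : List (V × U) → V → Maybe U
  glue [] v = nothing
  glue ((v' , u) ∷ ps) v with v ≟ v'
  ... | yes _ = just u
  ... | no _  = glue ps v

  glue⁻ : ∀ {ps v u} → glue ps v ≡ just u → (v , u) ∈ ps
  glue⁻ {(v' , u) ∷ ps} {v} eq with v ≟ v'
  glue⁻ refl | yes refl = here refl
  ... | no _ = there (glue⁻ eq)

  glue⁺ : ∀ {ps v u} → Unique (map proj₁ ps) → (v , u) ∈ ps → glue ps v ≡ just u
  glue⁺ {(v' , u) ∷ ps} {v} _ (here refl) with v ≟ v
  ... | yes _ = refl
  ... | no ne = contradiction refl ne
  glue⁺ {(v' , u') ∷ ps} {v} (p ∷ un) (there m) with v ≟ v'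
  ... | yes refl = contradiction refl (All.lookup p (∈-map⁺ proj₁ m))
  ... | no _ = glue⁺ un m

  glue-nothing : ∀ {ps v} → ¬ v ∈ map proj₁ ps → glue ps v ≡ nothing
  glue-nothing {[]} _ = refl
  glue-nothing {(v' , u) ∷ ps} {v} h with v ≟ v'
  ... | yes refl = contradiction (here refl) h
  ... | no _ = glue-nothing (h ∘ there)

  glue-injective : ∀ {ps} → Unique (map proj₂ ps) → ∀ {v v' u} → glue ps v ≡ just u → glue ps v' ≡ just u → v ≡ v'
  glue-injective un p q = cong proj₁ (Unique-∈ un (glue⁻ p) (glue⁻ q) refl)

zip³ : {V U : Set} → Triple V → Triple U → Triple (V × U)
zip³ (a , b , c) (p , q , r) = (a , p) , (b , q) , (c , r)

-- Used to verify `Coherent` and `Induced` when a sender is glued along both edges: the six vertices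
-- carry no further edge.
Independent : {V : Set} → List (Triple V) → Triple V → Triple V → Set
Independent es A B = ∀ {p q s} → Edge es p q s →
  p ∈ list³ A ++ list³ B → q ∈ list³ A ++ list³ B → s ∈ list³ A ++ list³ B → Edge (A ∷ []) p q s ⊎ Edge (B ∷ []) p q s

record FarSender (n : ℕ) : Set₁ where
  field
    {V}      : Set
    _≟_      : DecidableEquality V
    es       : List (Triple V)
    isProper : Proper es
    C        : Col V
    good     : Good (4 + n) es C
    A B      : Triple V
    unique   : Unique (list³ A ++ list³ B)
    edgeA    : Edge³ es A
    edgeB    : Edge³ es B
    indep    : Independent es A B
    forced   : ∀ C → Good (4 + n) es C → colour³ C A ≢ colour³ C B

amalgam-proper : ∀ {U V K : Set} (R : List (Triple U)) (G : K → List (Triple V)) ks (γ : K → V → Maybe U) →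
  GlueInjective ks γ →
  Proper R → (∀ k → Proper (G k)) → Proper (Amalgam.amalgam R G ks γ)
amalgam-proper R G ks γ γ-inj pR pG e with Amalgam.amalgam⁻ R G ks γ e
... | inj₁ (_ , _ , _ , r , refl , refl , refl) = let p , q , s = pR r in
  (λ { refl → p refl }) , (λ { refl → q refl }) , (λ { refl → s refl })
... | inj₂ (k , m , _ , _ , _ , g , refl , refl , refl) = let p , q , s = pG k g in p ∘ inj , q ∘ inj , s ∘ inj
  where
  inj : ∀ {v v'} → Amalgam.place R G ks γ k v ≡ Amalgam.place R G ks γ k v' → v ≡ v'
  inj eq with Amalgam.place-≡ R G ks γ eq
  ... | inj₁ (_ , p) = p
  ... | inj₂ (u , p , q) = γ-inj m p q

-- Three near senders in a row: the outer ones are glued to the two forced edges of the middle one, so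
-- that their free forced edges become disjoint.
module Chain {n : ℕ} (S : Sender n) where
  open Sender S

  K : Set
  K = Bool

  inner : K → Triple V
  inner false = x , y , a
  inner true  = x , z , a'

  -- The first two entries are chosen so that `x`, common to both forced edges of an outer copy, is
  -- glued to `y` or `z` of the middle one. Gluing it to `x` would make both free edges meet there.
  outer : K → Triple V
  outer false = z , x , a'
  outer true  = y , x , a

  socket : K → Triple V
  socket false = x , y , a
  socket true  = x , z , a'

  ps : K → List (V × V)
  ps k = list³ (zip³ (outer k) (socket k))

  γ : K → V → Maybe V
  γ k = glue _≟_ (ps k)

  outer-unique : ∀ k → Unique (map proj₁ (ps k))
  outer-unique false = (xz ∘ sym ∷ za' ∷ []) ∷ (xa' ∷ []) ∷ [] ∷ []
  outer-unique true  = (xy ∘ sym ∷ ya ∷ []) ∷ (xa ∷ []) ∷ [] ∷ []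

  socket-unique : ∀ k → Unique (map proj₂ (ps k))
  socket-unique false = (xy ∷ xa ∷ []) ∷ (ya ∷ []) ∷ [] ∷ []
  socket-unique true  = (xz ∷ xa' ∷ []) ∷ (za' ∷ []) ∷ [] ∷ []

  outer-edge : ∀ k → Edge³ es (outer k)
  outer-edge false = sw₁₂ edge₁
  outer-edge true  = sw₁₂ edge₀

  socket-edge : ∀ k → Edge³ es (socket k)
  socket-edge false = edge₀
  socket-edge true  = edge₁

  ks : List K
  ks = false ∷ true ∷ []

  k∈ks : ∀ k → k ∈ ks
  k∈ks false = here refl
  k∈ks true  = there (here refl)

  γ-inj : GlueInjective ks γ
  γ-inj {k} _ = glue-injective _≟_ (socket-unique k)

  matched : ∀ k {a b c p q s} → γ k a ≡ just p → γ k b ≡ just q → γ k c ≡ just s →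
            Distinct (a , p) (b , q) (c , s) → Edge (zip³ (outer k) (socket k) ∷ []) (a , p) (b , q) (c , s)
  matched k ga gb gc d = three-of (glue⁻ _≟_ ga) (glue⁻ _≟_ gb) (glue⁻ _≟_ gc) d

  coh : Coherent es (λ _ → es) ks γ
  coh {k} _ e ga gb gc = let p , q , s = isProper e in
    Edge-one (socket-edge k) (Edge-map⁺ proj₂ (matched k ga gb gc (p ∘ cong proj₁ , q ∘ cong proj₁ , s ∘ cong proj₁)))

  ind : Induced es (λ _ → es) ks γ
  ind {k} _ e ga gb gc = let p , q , s = isProper e in
    Edge-one (outer-edge k) (Edge-map⁺ proj₁ (matched k ga gb gc (p ∘ cong proj₂ , q ∘ cong proj₂ , s ∘ cong proj₂)))

  -- Each outer copy lays one forced edge over the other, and these differ under `C`; negating the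
  -- outer colouring makes them match.
  negated : ∀ k → colour³ (negate C) (outer k) ≡ colour³ C (socket k)
  negated false = trans (cong not (col₁₂ C x z a')) (sym (Bool.¬-not (forced C good)))
  negated true  = trans (cong not (col₁₂ C x y a)) (sym (Bool.¬-not (forced C good ∘ sym)))

  agree : Agree (λ _ → es) ks γ C (λ _ → negate C)
  agree {k} _ e ga gb gc = let p , q , s = isProper e in
    col-edges {C = pullback proj₁ (negate C)} {D = pullback proj₂ C} (λ { (here refl) → negated k })
      (matched k ga gb gc (p ∘ cong proj₁ , q ∘ cong proj₁ , s ∘ cong proj₁))

  open Amalgam es (λ _ → es) ks γ
  open Glue γ-inj coh ind
  open Colouring _≟_ _≟_ Bool._≟_ es (λ _ → es) ks γ γ-inj coh ind C (λ _ → negate C) agree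

  free : K → Triple Vertex
  free k = map³ (place k) (inner k)

  at-socket : ∀ k {v u} → (v , u) ∈ ps k → place k v ≡ inj₁ u
  at-socket k m = place-just (glue⁺ _≟_ (outer-unique k) m)

  private-at : ∀ k {v} → All (v ≢_) (list³ (outer k)) → place k v ≡ inj₂ (k , v)
  private-at k h = place-nothing (glue-nothing _≟_ λ m → All.lookup h m refl)

  A B : Triple Vertex
  A = inj₁ y , inj₂ (false , y) , inj₂ (false , a)
  B = inj₁ z , inj₂ (true , z) , inj₂ (true , a')

  free-false : free false ≡ A
  free-false = cong₂ _,_ (at-socket false (there (here refl))) (cong₂ _,_
    (private-at false (yz ∷ xy ∘ sym ∷ ya' ∷ [])) (private-at false (za ∘ sym ∷ xa ∘ sym ∷ aa' ∷ [])))

  free-true : free true ≡ B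
  free-true = cong₂ _,_ (at-socket true (there (here refl))) (cong₂ _,_
    (private-at true (yz ∘ sym ∷ xz ∘ sym ∷ za ∷ [])) (private-at true (ya' ∘ sym ∷ xa' ∘ sym ∷ aa' ∘ sym ∷ [])))

  own : ∀ k {v T} → free k ≡ T → place k v ∈ list³ T → v ∈ list³ (inner k)
  own k refl (here eq) = here (place-injective (k∈ks k) eq)
  own k refl (there (here eq)) = there (here (place-injective (k∈ks k) eq))
  own k refl (there (there (here eq))) = there (there (here (place-injective (k∈ks k) eq)))

  foreign-false : ∀ {v} → ¬ place false v ∈ list³ B
  foreign-false {v} (here eq) with glue⁻ _≟_ {ps false} {v} (place-inj₁ eq)
  ... | here refl = xz refl
  ... | there (here refl) = yz refl
  ... | there (there (here refl)) = za refl
  foreign-false (there (here eq)) = case place-inj₂ (sym eq) of λ { (() , _) }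
  foreign-false (there (there (here eq))) = case place-inj₂ (sym eq) of λ { (() , _) }

  foreign-true : ∀ {v} → ¬ place true v ∈ list³ A
  foreign-true {v} (here eq) with glue⁻ _≟_ {ps true} {v} (place-inj₁ eq)
  ... | here refl = xy refl
  ... | there (here refl) = yz refl
  ... | there (there (here refl)) = ya' refl
  foreign-true (there (here eq)) = case place-inj₂ (sym eq) of λ { (() , _) }
  foreign-true (there (there (here eq))) = case place-inj₂ (sym eq) of λ { (() , _) }

  place∈ : ∀ k {v} → place k v ∈ list³ A ++ list³ B → v ∈ list³ (inner k)
  place∈ false m = [ own false free-false , ⊥-elim ∘ foreign-false ]′ (∈-++⁻ (list³ A) m)
  place∈ true  m = [ ⊥-elim ∘ foreign-true , own true free-true ]′ (∈-++⁻ (list³ A) m)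

  root∈ : ∀ {u} → inj₁ u ∈ list³ A ++ list³ B → u ∈ y ∷ z ∷ []
  root∈ (here refl) = here refl
  root∈ (there (there (there (here refl)))) = there (here refl)
  root∈ (there (there (there (there (there (there ()))))))

  no-three : ∀ {p q s} → p ∈ y ∷ z ∷ [] → q ∈ y ∷ z ∷ [] → s ∈ y ∷ z ∷ [] → ¬ Distinct p q s
  no-three (here refl) (here refl) _ (d , _) = d refl
  no-three (there (here refl)) (there (here refl)) _ (d , _) = d refl
  no-three _ (here refl) (here refl) (_ , d , _) = d refl
  no-three _ (there (here refl)) (there (here refl)) (_ , d , _) = d refl
  no-three (here refl) _ (here refl) (_ , _ , d) = d refl
  no-three (there (here refl)) _ (there (here refl)) (_ , _ , d) = d refl

  reach : ∀ k {a b c} → Edge es a b c →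
          place k a ∈ list³ A ++ list³ B → place k b ∈ list³ A ++ list³ B → place k c ∈ list³ A ++ list³ B →
          Edge (free k ∷ []) (place k a) (place k b) (place k c)
  reach k e ma mb mc = Edge-map⁺ (place k) (three-of (place∈ k ma) (place∈ k mb) (place∈ k mc) (isProper e))

  -- The middle copy meets the six vertices only in `y` and `z`, too few for an edge; an outer copy
  -- meets them only in its own free edge.
  indep : Independent amalgam A B
  indep e mp mq ms with amalgam⁻ e
  ... | inj₁ (_ , _ , _ , r , refl , refl , refl) = contradiction (isProper r) (no-three (root∈ mp) (root∈ mq) (root∈ ms))
  ... | inj₂ (false , _ , a , b , c , g , refl , refl , refl) =
    inj₁ (subst (λ T → Edge (T ∷ []) (place false a) (place false b) (place false c)) free-false (reach false g mp mq ms))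
  ... | inj₂ (true , _ , a , b , c , g , refl , refl , refl) =
    inj₂ (subst (λ T → Edge (T ∷ []) (place true a) (place true b) (place true c)) free-true (reach true g mp mq ms))

  forced-apart : ∀ C → Good (4 + n) amalgam C → colour³ C A ≢ colour³ C B
  forced-apart C g = subst (λ T → colour³ C T ≢ colour³ C B) free-false
    (subst (λ T → colour³ C (free false) ≢ colour³ C T) free-true
      (≢-trans₃ (λ eq → forced (pullback (place false) C) (copy-good false) (trans eq socket-false))
                (forced (pullback inj₁ C) (λ c m → g c (Mono-image inj₁ C root-edge m)))
                (λ eq → forced (pullback (place true) C) (copy-good true) (trans (sym socket-true) eq))))
    where
    copy-good : ∀ k → Good (4 + n) es (pullback (place k) C)
    copy-good k c m = g c (Mono-image (place k) C (copy-edge (k∈ks k)) m)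
    socket-false : col C (inj₁ x) (inj₁ y) (inj₁ a) ≡ col C (place false x) (place false z) (place false a')
    socket-false = trans (sym (col₁₂ C _ _ _)) (col-cong C (sym (at-socket false (there (here refl))))
      (sym (at-socket false (here refl))) (sym (at-socket false (there (there (here refl))))))
    socket-true : col C (inj₁ x) (inj₁ z) (inj₁ a') ≡ col C (place true x) (place true y) (place true a)
    socket-true = trans (sym (col₁₂ C _ _ _)) (col-cong C (sym (at-socket true (there (here refl))))
      (sym (at-socket true (here refl))) (sym (at-socket true (there (there (here refl))))))

  far : FarSender n
  far = record
    { _≟_ = vertex≟
    ; es = amalgam ; isProper = amalgam-proper es (λ _ → es) ks γ γ-inj isProper (λ _ → isProper)
    ; C = union ; good = union-good good (λ _ → negate-good C good) ; A = A ; B = B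
    ; unique = ((λ ()) ∷ (λ ()) ∷ (λ { refl → yz refl }) ∷ (λ ()) ∷ (λ ()) ∷ [])
             ∷ ((λ { refl → ya refl }) ∷ (λ ()) ∷ (λ ()) ∷ (λ ()) ∷ [])
             ∷ ((λ ()) ∷ (λ ()) ∷ (λ ()) ∷ []) ∷ ((λ ()) ∷ (λ ()) ∷ []) ∷ ((λ { refl → za' refl }) ∷ []) ∷ [] ∷ []
    ; edgeA = subst (Edge³ amalgam) free-false (copy-edge (k∈ks false) edge₀)
    ; edgeB = subst (Edge³ amalgam) free-true (copy-edge (k∈ks true) edge₁)
    ; indep = indep ; forced = forced-apart }

abstract
  far-sender : ∀ n → FarSender n
  far-sender n = Chain.far (near-sender n)

Edge-recover : ∀ {X Y : Set} (f : X → Y) {xs : List X} → Unique (map f xs) → ∀ {T} → (∀ {w} → w ∈ list³ T → w ∈ xs) →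
  ∀ {a b c} → a ∈ xs → b ∈ xs → c ∈ xs → Edge (map³ f T ∷ []) (f a) (f b) (f c) → Edge (T ∷ []) a b c
Edge-recover f un {T} sub ma mb mc e with Edge-map⁻ f {es = T ∷ []} e
... | a' , b' , c' , e' , p , q , r = let na , nb , nc = ∈-one e' in
  Edge-subst (Unique-∈ un (sub na) ma (sym p)) (Unique-∈ un (sub nb) mb (sym q)) (Unique-∈ un (sub nc) mc (sym r)) e'

-- Attaching senders to pairs of edges of a root hypergraph

record Tie {U : Set} (R : List (Triple U)) (CU : Col U) (P Q : Triple U) : Set where
  field
    unique : Unique (list³ P ++ list³ Q)
    edgeP  : Edge³ R P
    edgeQ  : Edge³ R Q
    differ : colour³ CU P ≢ colour³ CU Q
    indep  : Independent R P Q

module Assembly {n : ℕ} (F : FarSender n) {U : Set} (_≟U_ : DecidableEquality U) (R : List (Triple U))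
  (R-proper : Proper R) (CU : Col U) (goodU : Good (4 + n) R CU) (ks : List (Triple U × Triple U))
  (ties : ∀ {P Q} → (P , Q) ∈ ks → Tie R CU P Q) where

  open FarSender F

  K : Set
  K = Triple U × Triple U

  zA zB : K → Triple (V × U)
  zA (P , _) = zip³ A P
  zB (_ , Q) = zip³ B Q

  ps : K → List (V × U)
  ps k = list³ (zA k) ++ list³ (zB k)

  γ : K → V → Maybe U
  γ k = glue _≟_ (ps k)

  γ-inj : GlueInjective ks γ
  γ-inj m = glue-injective _≟_ (Tie.unique (ties m))

  Joint : K → V × U → V × U → V × U → Set
  Joint k α β δ = Edge (zA k ∷ []) α β δ ⊎ Edge (zB k ∷ []) α β δ

  joint-V : ∀ k {a b c p q s} → Edge es a b c → γ k a ≡ just p → γ k b ≡ just q → γ k c ≡ just s →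
            Joint k (a , p) (b , q) (c , s)
  joint-V k e ga gb gc = Sum.map (Edge-recover proj₁ unique ∈-++⁺ˡ ma mb mc)
                                 (Edge-recover proj₁ unique (∈-++⁺ʳ (list³ (zA k))) ma mb mc)
    (indep e (∈-map⁺ proj₁ ma) (∈-map⁺ proj₁ mb) (∈-map⁺ proj₁ mc))
    where
    ma = glue⁻ _≟_ ga
    mb = glue⁻ _≟_ gb
    mc = glue⁻ _≟_ gc

  joint-U : ∀ {k a b c p q s} → k ∈ ks → Edge R p q s → γ k a ≡ just p → γ k b ≡ just q → γ k c ≡ just s →
            Joint k (a , p) (b , q) (c , s)
  joint-U {k} m e ga gb gc = Sum.map (Edge-recover proj₂ (Tie.unique (ties m)) ∈-++⁺ˡ ma mb mc)
                                     (Edge-recover proj₂ (Tie.unique (ties m)) (∈-++⁺ʳ (list³ (zA k))) ma mb mc)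
    (Tie.indep (ties m) e (∈-map⁺ proj₂ ma) (∈-map⁺ proj₂ mb) (∈-map⁺ proj₂ mc))
    where
    ma = glue⁻ _≟_ ga
    mb = glue⁻ _≟_ gb
    mc = glue⁻ _≟_ gc

  coh : Coherent R (λ _ → es) ks γ
  coh {k} m e ga gb gc = [ Edge-one (Tie.edgeP (ties m)) ∘ Edge-map⁺ proj₂ , Edge-one (Tie.edgeQ (ties m)) ∘ Edge-map⁺ proj₂ ]′
    (joint-V k e ga gb gc)

  ind : Induced R (λ _ → es) ks γ
  ind {k} m e ga gb gc = [ Edge-one edgeA ∘ Edge-map⁺ proj₁ , Edge-one edgeB ∘ Edge-map⁺ proj₁ ]′ (joint-U m e ga gb gc)

  matches? : (P : Triple U) → Dec (colour³ C A ≡ colour³ CU P)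
  matches? P = colour³ C A Bool.≟ colour³ CU P

  -- Choosing `C` or its negation to match `CU` on `P` makes `Q` match as well, since the two edges
  -- differ on both sides.
  CV : K → Col V
  CV (P , _) with matches? P
  ... | yes _ = C
  ... | no _  = negate C

  CV-good : ∀ k → Good (4 + n) es (CV k)
  CV-good (P , _) with matches? P
  ... | yes _ = good
  ... | no _  = negate-good C good

  CV-agrees : ∀ {P Q} → (P , Q) ∈ ks → colour³ (CV (P , Q)) A ≡ colour³ CU P × colour³ (CV (P , Q)) B ≡ colour³ CU Q
  CV-agrees {P} {Q} m with matches? P
  ... | yes eq = eq , trans (Bool.¬-not (forced C good ∘ sym))
    (trans (cong not eq) (sym (Bool.¬-not (Tie.differ (ties m) ∘ sym))))
  ... | no ne = sym (Bool.¬-not (ne ∘ sym)) ,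
    trans (sym (Bool.¬-not (forced C good))) (trans (Bool.¬-not ne) (sym (Bool.¬-not (Tie.differ (ties m) ∘ sym))))

  agree : Agree (λ _ → es) ks γ CU CV
  agree {k} m e ga gb gc = [
    col-edges {C = pullback proj₁ (CV k)} {D = pullback proj₂ CU} (λ { (here refl) → proj₁ (CV-agrees m) }) ,
    col-edges {C = pullback proj₁ (CV k)} {D = pullback proj₂ CU} (λ { (here refl) → proj₂ (CV-agrees m) }) ]′
    (joint-V k e ga gb gc)

  open Amalgam R (λ _ → es) ks γ public
  open Glue γ-inj coh ind public
  open Colouring _≟U_ _≟_ (≡-dec (≡-dec _≟U_ (≡-dec _≟U_ _≟U_)) (≡-dec _≟U_ (≡-dec _≟U_ _≟U_)))
    R (λ _ → es) ks γ γ-inj coh ind CU CV agree public using (vertex≟; union; union-good)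

  glued : ∀ k {x w} → inj₁ w ≡ place k x → w ∈ list³ (proj₁ k) ++ list³ (proj₂ k)
  glued k {x} eq = ∈-map⁺ proj₂ (glue⁻ _≟_ {ps k} {x} (place-inj₁ (sym eq)))

  assembled : List (Triple Vertex)
  assembled = amalgam

  assembled-good : Good (4 + n) assembled union
  assembled-good = union-good goodU CV-good

  assembled-proper : Proper assembled
  assembled-proper = amalgam-proper R (λ _ → es) ks γ γ-inj R-proper (λ _ → isProper)

  tied-apart : ∀ D → Good (4 + n) assembled D → ∀ {P Q} → (P , Q) ∈ ks →
               colour³ D (map³ inj₁ P) ≢ colour³ D (map³ inj₁ Q)
  tied-apart D g {P} {Q} m eq = forced (pullback (place k) D)
    (λ c mono → g c (Mono-image (place k) D (copy-edge m) mono)) (trans (at A (λ w → ∈-++⁺ˡ w) ) (trans eq (sym (at B (∈-++⁺ʳ (list³ (zA k)))))))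
    where
    k = P , Q
    placed : ∀ {v u} → (v , u) ∈ ps k → place k v ≡ inj₁ u
    placed w = place-just (glue⁺ _≟_ unique w)
    at : ∀ T {T'} → (∀ {w} → w ∈ list³ (zip³ T T') → w ∈ ps k) → colour³ (pullback (place k) D) T ≡ colour³ D (map³ inj₁ T')
    at T h = col-cong D (placed (h (here refl))) (placed (h (there (here refl)))) (placed (h (there (there (here refl)))))

-- The extremal hypergraph

distinct? : ∀ {X : Set} → DecidableEquality X → (a b c : X) → Dec (Distinct a b c)
distinct? _≟_ a b c = ¬? (a ≟ b) ×-dec ¬? (b ≟ c) ×-dec ¬? (a ≟ c)

Edge-elim : ∀ {V : Set} (Q : V → V → V → Set) → (∀ {a b c} → Q a b c → Q b a c) → (∀ {a b c} → Q a b c → Q a c b) →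
  ∀ {es} → (∀ {a b c} → (a , b , c) ∈ es → Q a b c) → ∀ {a b c} → Edge es a b c → Q a b c
Edge-elim Q s₁₂ s₂₃ h (edge m) = h m
Edge-elim Q s₁₂ s₂₃ h (sw₁₂ e) = s₁₂ (Edge-elim Q s₁₂ s₂₃ h e)
Edge-elim Q s₁₂ s₂₃ h (sw₂₃ e) = s₂₃ (Edge-elim Q s₁₂ s₂₃ h e)

module Pattern (n : ℕ) where

  r t : ℕ
  r = 2 + n
  t = 4 + n

  -- pole true and pole false are u and v, the cells are their common link, and the stars are two
  -- reference edges.  Edges within a row are to be red, edges across distinct rows blue.
  Cell : Set
  Cell = Fin r × Fin r

  _≟C_ : DecidableEquality Cell
  _≟C_ = ≡-dec Fin._≟_ Fin._≟_

  row : Cell → Fin r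
  row = proj₁

  U : Set
  U = Bool ⊎ (Cell ⊎ (Bool × Fin 3))

  pattern pole b = inj₁ b
  pattern cell c = inj₂ (inj₁ c)
  pattern star b i = inj₂ (inj₂ (b , i))

  _≟U_ : DecidableEquality U
  _≟U_ = Sum.≡-dec Bool._≟_ (Sum.≡-dec _≟C_ (≡-dec Bool._≟_ Fin._≟_))

  -- Triples with exactly two cells in a row are no edges; this is what keeps `R` free of cliques on
  -- `t` vertices.
  Aligned : Cell → Cell → Cell → Set
  Aligned c c' c'' = (row c ≡ row c' × row c' ≡ row c'') ⊎ Distinct (row c) (row c') (row c'')

  starT : Bool → Triple U
  starT b = star b zero , star b (suc zero) , star b (suc (suc zero))

  data Main : U → U → U → Set where
    cone : ∀ {b c c'} → c ≢ c' → Main (pole b) (cell c) (cell c')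
    body : ∀ {c c' c''} → Distinct c c' c'' → Aligned c c' c'' → Main (cell c) (cell c') (cell c'')

  private
    bools : List Bool
    bools = true ∷ false ∷ []

    ∈-bools : ∀ b → b ∈ bools
    ∈-bools true  = here refl
    ∈-bools false = there (here refl)

    cells : List Cell
    cells = cartesianProduct (allFin r) (allFin r)

    ∈-cells : ∀ c → c ∈ cells
    ∈-cells (i , j) = ∈-cartesianProduct⁺ (∈-allFin i) (∈-allFin j)

    coneT : Bool × Cell × Cell → Triple U
    coneT (b , c , c') = pole b , cell c , cell c'

    cone? : (x : Bool × Cell × Cell) → Dec (proj₁ (proj₂ x) ≢ proj₂ (proj₂ x))
    cone? (_ , c , c') = ¬? (c ≟C c')

    bodyT : Triple Cell → Triple U
    bodyT (c , c' , c'') = cell c , cell c' , cell c''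

    body? : (x : Triple Cell) → Dec (Distinct (s₁ x) (s₂ x) (s₃ x) × Aligned (s₁ x) (s₂ x) (s₃ x))
    body? (c , c' , c'') = distinct? _≟C_ c c' c'' ×-dec
      ((row c Fin.≟ row c' ×-dec row c' Fin.≟ row c'') ⊎-dec distinct? Fin._≟_ (row c) (row c') (row c''))

    allCones = cartesianProduct bools (cartesianProduct cells cells)
    allBodies = cartesianProduct cells (cartesianProduct cells cells)

  abstract
    main : List (Triple U)
    main = map coneT (filter cone? allCones) ++ map bodyT (filter body? allBodies)

    main⁻ : ∀ {a b c} → (a , b , c) ∈ main → Main a b c
    main⁻ m with ∈-++⁻ (map coneT (filter cone? allCones)) m
    ... | inj₁ p with ∈-map⁻ coneT p
    ... | _ , q , refl = cone (proj₂ (∈-filter⁻ cone? {xs = allCones} q))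
    main⁻ m | inj₂ p with ∈-map⁻ bodyT p
    ... | _ , q , refl = let d , al = proj₂ (∈-filter⁻ body? {xs = allBodies} q) in body d al

    main⁺ : ∀ {a b c} → Main a b c → (a , b , c) ∈ main
    main⁺ (cone {b} {c} {c'} ne) = ∈-++⁺ˡ (∈-map⁺ coneT (∈-filter⁺ cone?
      (∈-cartesianProduct⁺ (∈-bools b) (∈-cartesianProduct⁺ (∈-cells c) (∈-cells c'))) ne))
    main⁺ (body {c} {c'} {c''} d al) = ∈-++⁺ʳ (map coneT (filter cone? allCones)) (∈-map⁺ bodyT (∈-filter⁺ body?
      (∈-cartesianProduct⁺ (∈-cells c) (∈-cartesianProduct⁺ (∈-cells c') (∈-cells c''))) (d , al)))

  R : List (Triple U)
  R = starT true ∷ starT false ∷ main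

  starT∈ : ∀ b → starT b ∈ R
  starT∈ true  = here refl
  starT∈ false = there (here refl)

  data Root : U → U → U → Set where
    ofStar : ∀ b → Root (star b zero) (star b (suc zero)) (star b (suc (suc zero)))
    ofMain : ∀ {a b c} → Main a b c → Root a b c

  R⁻ : ∀ {a b c} → (a , b , c) ∈ R → Root a b c
  R⁻ (here refl) = ofStar true
  R⁻ (there (here refl)) = ofStar false
  R⁻ (there (there m)) = ofMain (main⁻ m)

  R-proper : Proper R
  R-proper = proper λ m → go (R⁻ m)
    where
    go : ∀ {a b c} → Root a b c → Distinct a b c
    go (ofStar b) = (λ ()) , (λ ()) , (λ ())
    go (ofMain (cone ne)) = (λ ()) , (λ { refl → ne refl }) , (λ ())
    go (ofMain (body (p , q , s) _)) = (λ { refl → p refl }) , (λ { refl → q refl }) , (λ { refl → s refl })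

  IsPole NotStar : U → Set
  IsPole a = ∃[ b ] a ≡ pole b
  NotStar a = ∀ {b i} → a ≢ star b i

  Stars : Bool → U → Set
  Stars b a = ∃[ i ] a ≡ star b i

  stars : ∀ {a b c} → Edge R a b c → (∃[ β ] (Stars β a × Stars β b × Stars β c)) ⊎ (NotStar a × NotStar b × NotStar c)
  stars = Edge-elim (λ a b c → (∃[ β ] (Stars β a × Stars β b × Stars β c)) ⊎ (NotStar a × NotStar b × NotStar c))
    (Sum.map (λ (β , p , q , s) → β , q , p , s) (λ (p , q , s) → (λ {b} {i} → q {b} {i}) , (λ {b} {i} → p {b} {i}) , (λ {b} {i} → s {b} {i})))
    (Sum.map (λ (β , p , q , s) → β , p , s , q) (λ (p , q , s) → (λ {b} {i} → p {b} {i}) , (λ {b} {i} → s {b} {i}) , (λ {b} {i} → q {b} {i})))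
    (λ m → go (R⁻ m))
    where
    go : ∀ {a b c} → Root a b c → (∃[ β ] (Stars β a × Stars β b × Stars β c)) ⊎ (NotStar a × NotStar b × NotStar c)
    go (ofStar b) = inj₁ (b , (_ , refl) , (_ , refl) , (_ , refl))
    go (ofMain (cone _)) = inj₂ ((λ ()) , (λ ()) , (λ ()))
    go (ofMain (body _ _)) = inj₂ ((λ ()) , (λ ()) , (λ ()))

  one-pole : ∀ {a b c} → Edge R a b c → ¬ (IsPole a × IsPole b) × ¬ (IsPole b × IsPole c) × ¬ (IsPole a × IsPole c)
  one-pole = Edge-elim (λ a b c → ¬ (IsPole a × IsPole b) × ¬ (IsPole b × IsPole c) × ¬ (IsPole a × IsPole c))
    (λ (p , q , s) → (λ (x , y) → p (y , x)) , s , q) (λ (p , q , s) → s , (λ (x , y) → q (y , x)) , p) (λ m → go (R⁻ m))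
    where
    go : ∀ {a b c} → Root a b c → ¬ (IsPole a × IsPole b) × ¬ (IsPole b × IsPole c) × ¬ (IsPole a × IsPole c)
    go (ofStar b) = (λ { ((_ , ()) , _) }) , (λ { ((_ , ()) , _) }) , (λ { ((_ , ()) , _) })
    go (ofMain (cone _)) = (λ { (_ , (_ , ())) }) , (λ { ((_ , ()) , _) }) , (λ { (_ , (_ , ())) })
    go (ofMain (body _ _)) = (λ { ((_ , ()) , _) }) , (λ { ((_ , ()) , _) }) , (λ { ((_ , ()) , _) })

  aligned : ∀ {a b c} → Edge R a b c → ∀ {x y z} → a ≡ cell x → b ≡ cell y → c ≡ cell z → Aligned x y z
  aligned = Edge-elim (λ a b c → ∀ {x y z} → a ≡ cell x → b ≡ cell y → c ≡ cell z → Aligned x y z)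
    (λ h p q s → Sum.map (λ (e , e') → sym e , trans e e') Distinct-12 (h q p s))
    (λ h p q s → Sum.map (λ (e , e') → trans e e' , sym e') Distinct-23 (h p s q)) (λ m → go (R⁻ m))
    where
    go : ∀ {a b c} → Root a b c → ∀ {x y z} → a ≡ cell x → b ≡ cell y → c ≡ cell z → Aligned x y z
    go (ofMain (body _ al)) refl refl refl = al

  -- r + 1 cells, any three of which lie in one row or in three rows, would all lie in one row or in
  -- distinct rows, and a clique on r + 2 vertices has at most one pole.
  module _ (g : Fin (1 + r) → Cell) (g-inj : Injective _≡_ _≡_ g)
    (al : ∀ i j k → Distinct i j k → Aligned (g i) (g j) (g k)) where

    one-row : ∀ {l l'} → l ≢ l' → row (g l) ≡ row (g l') → ∀ m → row (g m) ≡ row (g l)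
    one-row {l} {l'} l≢l' eq m with l Fin.≟ m | l' Fin.≟ m
    ... | yes refl | _ = refl
    ... | no _ | yes refl = sym eq
    ... | no p | no q with al l l' m (l≢l' , q , p)
    ... | inj₁ (e , e') = sym (trans e e')
    ... | inj₂ (ne , _) = contradiction eq ne

    too-many-cells : ⊥
    too-many-cells with row (g zero) Fin.≟ row (g (suc zero))
    ... | yes eq = ℕ.1+n≰n (Fin.injective⇒≤ {f = proj₂ ∘ g} λ {l} {l'} e →
      g-inj (cong₂ _,_ (trans (one-row (λ ()) eq l) (sym (one-row (λ ()) eq l'))) e))
    ... | no ne = ℕ.1+n≰n (Fin.injective⇒≤ {f = row ∘ g} λ {l} {l'} e → inj l l' e)
      where
      inj : ∀ l l' → row (g l) ≡ row (g l') → l ≡ l'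
      inj l l' e with l Fin.≟ l'
      ... | yes p = p
      ... | no p = contradiction (trans (one-row p e zero) (sym (one-row p e (suc zero)))) ne

  no-clique : ∀ (f : Fin t → U) → ¬ Clique R f
  no-clique f cl = by-star (Fin.any? λ i → star? (f i))
    where
    f-inj : Injective _≡_ _≡_ f
    f-inj = clique-injective R-proper cl
    star? : (a : U) → Dec (∃[ b ] Stars b a)
    star? (pole _) = no λ { (_ , _ , ()) }
    star? (cell _) = no λ { (_ , _ , ()) }
    star? (star b i) = yes (b , i , refl)
    pole? : (a : U) → Dec (IsPole a)
    pole? (pole b) = yes (b , refl)
    pole? (cell _) = no λ { (_ , ()) }
    pole? (star _ _) = no λ { (_ , ()) }
    by-cells : ∀ p → (∀ m → ∃[ c ] f (punchIn p m) ≡ cell c) → ⊥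
    by-cells p h = too-many-cells (proj₁ ∘ h)
      (λ {i} {j} eq → Fin.punchIn-injective p i j (f-inj (trans (proj₂ (h i)) (trans (cong cell eq) (sym (proj₂ (h j)))))))
      (λ i j k (x , y , z) → aligned (cl (punchIn p i) (punchIn p j) (punchIn p k)
        ((x ∘ Fin.punchIn-injective p i j) , (y ∘ Fin.punchIn-injective p j k) , (z ∘ Fin.punchIn-injective p i k)))
        (proj₂ (h i)) (proj₂ (h j)) (proj₂ (h k)))
    classify : ∀ a → ¬ (∃[ b ] Stars b a) → ¬ IsPole a → ∃[ c ] a ≡ cell c
    classify (pole b) _ np = contradiction (b , refl) np
    classify (cell c) _ _ = c , refl
    classify (star b i) ns _ = contradiction (b , i , refl) ns
    by-star : Dec (∃[ i ] ∃[ b ] Stars b (f i)) → ⊥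
    -- A clique with a star vertex stays within the three vertices of that star, fewer than `t`.
    by-star (yes (i , b , j , eq)) = ℕ.<⇒≱ (s≤s (s≤s (s≤s (s≤s z≤n)))) (Fin.injective⇒≤ {f = proj₁ ∘ all} λ {l} {l'} e →
        f-inj (trans (proj₂ (all l)) (trans (cong (star b) e) (sym (proj₂ (all l'))))))
      where
      all : ∀ m → Stars b (f m)
      all m with i Fin.≟ m
      ... | yes refl = j , eq
      ... | no i≢m with stars (cl i m _ (proj₂ (third i≢m)))
      ... | inj₁ (_ , (_ , e) , s , _) with trans (sym eq) e
      ... | refl = s
      all m | no i≢m | inj₂ (ns , _) = contradiction eq ns
    by-star (no none) = by-pole (Fin.any? λ i → pole? (f i))
      where
      by-pole : Dec (∃[ i ] IsPole (f i)) → ⊥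
      by-pole (no np) = by-cells zero λ m → classify _ (λ s → none (_ , s)) (λ q → np (_ , q))
      by-pole (yes (p , q)) = by-cells p λ m → classify _ (λ s → none (_ , s))
        λ q' → proj₁ (one-pole (cl p (punchIn p m) _ (proj₂ (third (Fin.punchInᵢ≢i p m ∘ sym))))) (q , q')

  R-good : ∀ C → Good t R C
  R-good C c (f , m) = no-clique f λ i j k d → proj₁ (m i j k d)

  -- An edge is red when all its pairs agree. Poles are neutral, so a cone takes its colour from its
  -- two cells.
  same : U → U → Bool
  same (cell c) (cell c') = does (row c Fin.≟ row c')
  same (star b _) (star b' _) = b ∧ b'
  same _ _ = true

  same-sym : ∀ a b → same a b ≡ same b a
  same-sym (cell c) (cell c') with row c Fin.≟ row c'
  ... | yes eq = sym (dec-true (row c' Fin.≟ row c) (sym eq))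
  ... | no ne = sym (dec-false (row c' Fin.≟ row c) (ne ∘ sym))
  same-sym (star b _) (star b' _) = Bool.∧-comm b b'
  same-sym (pole _) (pole _) = refl
  same-sym (pole _) (cell _) = refl
  same-sym (pole _) (star _ _) = refl
  same-sym (cell _) (pole _) = refl
  same-sym (cell _) (star _ _) = refl
  same-sym (star _ _) (pole _) = refl
  same-sym (star _ _) (cell _) = refl

  CU : Col U
  CU = record
    { col = λ a b c → same a b ∧ (same b c ∧ same a c)
    ; col₁₂ = λ a b c → cong₂ _∧_ (same-sym b a) (Bool.∧-comm (same a c) (same b c))
    ; col₂₃ = λ a b c → trans (cong (λ x → same a c ∧ (x ∧ same a b)) (same-sym c b))
        (trans (Bool.∧-comm (same a c) _) (trans (cong (_∧ same a c) (Bool.∧-comm (same b c) (same a b)))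
          (Bool.∧-assoc (same a b) (same b c) (same a c)))) }

  starT-colour : ∀ b → colour³ CU (starT b) ≡ b
  starT-colour true  = refl
  starT-colour false = refl

  cone-colour : ∀ {b c c'} → col CU (pole b) (cell c) (cell c') ≡ does (row c Fin.≟ row c')
  cone-colour = Bool.∧-identityʳ _

  body-row : ∀ {c c' c''} → row c ≡ row c' → row c' ≡ row c'' → col CU (cell c) (cell c') (cell c'') ≡ true
  body-row {c} {c'} {c''} p q rewrite dec-true (row c Fin.≟ row c') p | dec-true (row c' Fin.≟ row c'') q
    | dec-true (row c Fin.≟ row c'') (trans p q) = refl

  body-transversal : ∀ {c c' c''} → row c ≢ row c' → col CU (cell c) (cell c') (cell c'') ≡ false
  body-transversal {c} {c'} p rewrite dec-false (row c Fin.≟ row c') p = refl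

  -- Forced to differ from the star of the opposite colour, an edge has its colour fixed relative to
  -- the stars.
  tie : Triple U → Triple U × Triple U
  tie e = e , starT (not (colour³ CU e))

  ks : List (Triple U × Triple U)
  ks = (starT true , starT false) ∷ map tie main

  star-∈ : ∀ b i → star b i ∈ list³ (starT b)
  star-∈ b zero = here refl
  star-∈ b (suc zero) = there (here refl)
  star-∈ b (suc (suc zero)) = there (there (here refl))

  ∈-star : ∀ {a b} → a ∈ list³ (starT b) → Stars b a
  ∈-star (here refl) = _ , refl
  ∈-star (there (here refl)) = _ , refl
  ∈-star (there (there (here refl))) = _ , refl

  main-notStar : ∀ {a b c} → Main a b c → ∀ {x} → x ∈ list³ (a , b , c) → NotStar x
  main-notStar (cone _) (here refl) ()
  main-notStar (cone _) (there (here refl)) ()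
  main-notStar (cone _) (there (there (here refl))) ()
  main-notStar (body _ _) (here refl) ()
  main-notStar (body _ _) (there (here refl)) ()
  main-notStar (body _ _) (there (there (here refl))) ()

  ties : ∀ {P Q} → (P , Q) ∈ ks → Tie R CU P Q
  ties (here refl) = record
    { unique = ((λ ()) ∷ (λ ()) ∷ (λ ()) ∷ (λ ()) ∷ (λ ()) ∷ []) ∷ ((λ ()) ∷ (λ ()) ∷ (λ ()) ∷ (λ ()) ∷ [])
        ∷ ((λ ()) ∷ (λ ()) ∷ (λ ()) ∷ []) ∷ ((λ ()) ∷ (λ ()) ∷ []) ∷ ((λ ()) ∷ []) ∷ [] ∷ []
    ; edgeP = edge (starT∈ true) ; edgeQ = edge (starT∈ false) ; differ = λ () ; indep = indep }
    where
    both : ∀ {x} → x ∈ list³ (starT true) ++ list³ (starT false) → ∃[ b ] Stars b x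
    both m with ∈-++⁻ (list³ (starT true)) m
    ... | inj₁ p = true , ∈-star p
    ... | inj₂ p = false , ∈-star p
    pick-star : ∀ b {p q s} → Edge (starT b ∷ []) p q s → Edge (starT true ∷ []) p q s ⊎ Edge (starT false ∷ []) p q s
    pick-star true  = inj₁
    pick-star false = inj₂
    indep : Independent R (starT true) (starT false)
    indep e mp _ _ with stars e
    ... | inj₁ (β , (i , refl) , (j , refl) , (k , refl)) =
      pick-star β (three-of (star-∈ β i) (star-∈ β j) (star-∈ β k) (R-proper e))
    ... | inj₂ (ns , _) with both mp
    ... | _ , _ , eq = contradiction eq ns
  ties (there m) with ∈-map⁻ tie m
  ... | e@(a , b , c) , e∈ , refl = record
    { unique = (proj₁ d ∷ proj₂ (proj₂ d) ∷ ns (here refl) ∷ ns (here refl) ∷ ns (here refl) ∷ [])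
        ∷ (proj₁ (proj₂ d) ∷ ns (there (here refl)) ∷ ns (there (here refl)) ∷ ns (there (here refl)) ∷ [])
        ∷ (ns (there (there (here refl))) ∷ ns (there (there (here refl))) ∷ ns (there (there (here refl))) ∷ [])
        ∷ ((λ ()) ∷ (λ ()) ∷ []) ∷ ((λ ()) ∷ []) ∷ [] ∷ []
    ; edgeP = edge (there (there e∈)) ; edgeQ = edge (starT∈ β)
    ; differ = λ eq → Bool.not-¬ (sym (trans eq (starT-colour β))) refl
    ; indep = indep }
    where
    β = not (colour³ CU e)
    ns : ∀ {x} → x ∈ list³ e → NotStar x
    ns = main-notStar (main⁻ e∈)
    d : Distinct a b c
    d = R-proper (edge (there (there e∈)))
    in-P : ∀ {x} → x ∈ list³ e ++ list³ (starT β) → NotStar x → x ∈ list³ e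
    in-P m n with ∈-++⁻ (list³ e) m
    ... | inj₁ p = p
    ... | inj₂ p = contradiction (proj₂ (∈-star p)) n
    in-Q : ∀ {β' i} → star β' i ∈ list³ e ++ list³ (starT β) → star β' i ∈ list³ (starT β)
    in-Q m with ∈-++⁻ (list³ e) m
    ... | inj₁ p = contradiction refl (ns p)
    ... | inj₂ p = p
    indep : Independent R e (starT β)
    indep ed mp mq ms with stars ed
    ... | inj₁ (_ , (_ , refl) , (_ , refl) , (_ , refl)) = inj₂ (three-of (in-Q mp) (in-Q mq) (in-Q ms) (R-proper ed))
    ... | inj₂ (np , nq , ns') = inj₁ (three-of (in-P mp np) (in-P mq nq) (in-P ms ns') (R-proper ed))

  spoke : Cell → Triple U
  spoke c = pole true , pole false , cell c

  abstract
    spokes : List (Triple U)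
    spokes = map spoke cells

    spokes⁺ : ∀ c → spoke c ∈ spokes
    spokes⁺ c = ∈-map⁺ spoke (∈-cells c)

    spokes⁻ : ∀ {e} → e ∈ spokes → ∃[ c ] e ≡ spoke c
    spokes⁻ m = let c , _ , eq = ∈-map⁻ spoke m in c , eq

  -- No sender touches both poles. Hence only spokes pass through both, and no private vertex is
  -- adjacent to both.
  poles-of-tie : ∀ {P Q} → (P , Q) ∈ ks → ∀ {b b'} → b ≢ b' →
                 pole b ∈ list³ P ++ list³ Q → ¬ pole b' ∈ list³ P ++ list³ Q
  poles-of-tie {P} {Q} m {b} {b'} b≢b' p q = poles m (left m p) (left m q)
    where
    left : ∀ {P Q b} → (P , Q) ∈ ks → pole b ∈ list³ P ++ list³ Q → pole b ∈ list³ P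
    left {P} m p with ∈-++⁻ (list³ P) p
    ... | inj₁ p' = p'
    left (here refl) p | inj₂ p' with ∈-star p'
    ... | _ , ()
    left (there m) p | inj₂ p' with ∈-map⁻ tie m
    ... | _ , _ , refl with ∈-star p'
    ... | _ , ()
    in-main : ∀ {x y z} → Main x y z → pole b ∈ list³ (x , y , z) → ¬ pole b' ∈ list³ (x , y , z)
    in-main (cone _) (here refl) (here refl) = b≢b' refl
    in-main (cone _) (here refl) (there (there (there ())))
    in-main (cone _) (there (there (there ())))
    in-main (body _ _) (there (there (there ())))
    poles : (P , Q) ∈ ks → pole b ∈ list³ P → ¬ pole b' ∈ list³ P
    poles (here refl) p q with ∈-star p
    ... | _ , ()
    poles (there m) p q with ∈-map⁻ tie m
    ... | _ , e∈ , refl = in-main (main⁻ e∈) p q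

  isU : U → Bool
  isU (pole b) = b
  isU _ = false

  isU⁻ : ∀ {a} → isU a ≡ true → a ≡ pole true
  isU⁻ {pole true} _ = refl

  CP : Col U
  CP = record
    { col = λ a b c → isU a ∨ (isU b ∨ isU c)
    ; col₁₂ = λ a b c → trans (sym (Bool.∨-assoc (isU b) (isU a) (isU c)))
        (trans (cong (_∨ isU c) (Bool.∨-comm (isU b) (isU a))) (Bool.∨-assoc (isU a) (isU b) (isU c)))
    ; col₂₃ = λ a b c → cong (isU a ∨_) (Bool.∨-comm (isU c) (isU b)) }

  spoke-proper : Proper spokes
  spoke-proper = proper λ m → case spokes⁻ m of λ { (_ , refl) → (λ ()) , (λ ()) , (λ ()) }

  spoked-proper : Proper (R ++ spokes)
  spoked-proper e = [ R-proper , spoke-proper ]′ (Edge-++⁻ R e)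

  spoke-colour : ∀ {a b c} → Edge spokes a b c → col CP a b c ≡ true
  spoke-colour = col-const {C = CP} λ m → case spokes⁻ m of λ { (_ , refl) → refl }

  -- A blue clique contains no spoke and would lie in `R`, against `no-clique`. Red triples all
  -- contain `pole true`, but a clique on at least four vertices has three others.
  spoked-good : Good t (R ++ spokes) CP
  spoked-good false (f , m) = no-clique f λ i j k d → let e , eq = m i j k d in
    [ id , (λ s → case trans (sym (spoke-colour s)) eq of λ ()) ]′ (Edge-++⁻ R e)
  spoked-good true (f , m) = from (Fin.any? λ p → isU (f p) Bool.≟ true)
    where
    f-inj : Injective _≡_ _≡_ f
    f-inj = clique-injective spoked-proper (λ i j k d → proj₁ (m i j k d))
    avoiding : ∀ {i j k} → Distinct i j k → ¬ (isU (f i) ≡ false × isU (f j) ≡ false × isU (f k) ≡ false)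
    avoiding d (p , q , s) = case trans (sym (proj₂ (m _ _ _ d))) (cong₂ _∨_ p (cong₂ _∨_ q s)) of λ ()
    from : Dec (∃[ p ] isU (f p) ≡ true) → ⊥
    from (no none) = avoiding {zero} {suc zero} {suc (suc zero)} ((λ ()) , (λ ()) , (λ ())) (off , off , off)
      where
      off : ∀ {i} → isU (f i) ≡ false
      off {i} = Bool.¬-not (λ eq → none (i , eq))
    from (yes (p , eq)) = avoiding {punchIn p zero} {punchIn p (suc zero)} {punchIn p (suc (suc zero))}
      ((λ e → case Fin.punchIn-injective p _ _ e of λ ()) , (λ e → case Fin.punchIn-injective p _ _ e of λ ()) ,
       (λ e → case Fin.punchIn-injective p _ _ e of λ ())) (off zero , off (suc zero) , off (suc (suc zero)))
      where
      off : ∀ i → isU (f (punchIn p i)) ≡ false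
      off i = Bool.¬-not (λ eq' → Fin.punchInᵢ≢i p i (f-inj (trans (isU⁻ eq') (sym (isU⁻ eq)))))

Edge-pick : ∀ {V : Set} {es : List (Triple V)} {a b c} → Edge es a b c → ∃[ e ] (e ∈ es × Edge (e ∷ []) a b c)
Edge-pick (edge m) = _ , m , edge (here refl)
Edge-pick (sw₁₂ e) = let x , m , p = Edge-pick e in x , m , sw₁₂ p
Edge-pick (sw₂₃ e) = let x , m , p = Edge-pick e in x , m , sw₂₃ p

-- C₀ shows that the edges through u and v are needed, C₁ that so are vertices not adjacent to both;
-- the latter yields a pair of codegree 0.
record Example (n : ℕ) : Set₁ where
  field
    {V}       : Set
    _≟_       : DecidableEquality V
    H         : List (Triple V)
    isProper  : Proper H
    arrows    : Arrows (4 + n) H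
    u v       : V
    u≢v       : u ≢ v
    link      : Fin (2 + n) × Fin (2 + n) → V
    in-link   : ∀ {x} → Edge H u v x → ∃[ c ] x ≡ link c
    C₀        : Col V
    apart     : ∀ c (f : Fin (4 + n) → V) → (∀ i j → f i ≡ u → f j ≢ v) → ¬ IsMono H C₀ c f
    Common    : V → Set
    common    : ∀ {x y z} → Edge H u x y → Edge H v x z → Common x
    u-common  : Common u
    v-common  : Common v
    C₁        : Col V
    spanned   : ∀ c (f : Fin (4 + n) → V) → (∀ i → Common (f i)) → ¬ IsMono H C₁ c f

module Construction (n : ℕ) where
  open Pattern n
  open Assembly (far-sender n) _≟U_ R R-proper CU (R-good CU) ks ties

  H : List (Triple Vertex)
  H = assembled ++ map (map³ inj₁) spokes

  u v : Vertex
  u = inj₁ (pole true)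
  v = inj₁ (pole false)

  spoke-edge : ∀ c → Edge H (inj₁ (pole true)) (inj₁ (pole false)) (inj₁ (cell c))
  spoke-edge c = Edge-mono (∈-++⁺ʳ assembled) (edge (∈-map⁺ (map³ inj₁) (spokes⁺ c)))

  H⁻ : ∀ {a b c} → Edge H a b c → Edge assembled a b c ⊎ Edge (map (map³ inj₁) spokes) a b c
  H⁻ = Edge-++⁻ assembled

  H-proper : Proper H
  H-proper e with H⁻ e
  ... | inj₁ p = assembled-proper p
  ... | inj₂ p with Edge-map⁻ inj₁ p
  ... | _ , _ , _ , s , refl , refl , refl = let x , y , z = spoke-proper s in
    x ∘ Sum.inj₁-injective , y ∘ Sum.inj₁-injective , z ∘ Sum.inj₁-injective

  no-uv : ∀ {x} → ¬ Edge assembled u v x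
  no-uv e with amalgam⁻ e
  ... | inj₁ (_ , _ , _ , r , refl , refl , _) = proj₁ (one-pole r) ((_ , refl) , (_ , refl))
  ... | inj₂ (k , m , _ , _ , _ , _ , p , q , _) = poles-of-tie m (λ ()) (glued k p) (glued k q)

  in-link : ∀ {x} → Edge H u v x → ∃[ c ] x ≡ inj₁ (cell c)
  in-link e with H⁻ e
  ... | inj₁ p = ⊥-elim (no-uv p)
  ... | inj₂ p with Edge-map⁻ inj₁ p
  ... | _ , _ , _ , s , refl , refl , refl with Edge-pick s
  ... | _ , m , s' with spokes⁻ m
  ... | c , refl with proj₂ (proj₂ (∈-one s')) | spoke-proper s
  ... | here refl | _ , _ , ne = contradiction refl ne
  ... | there (here refl) | _ , ne , _ = contradiction refl ne
  ... | there (there (here refl)) | _ = c , refl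

  near-pole : ∀ {b k x y} → Edge H (inj₁ (pole b)) (inj₂ (k , x)) y → k ∈ ks × pole b ∈ list³ (proj₁ k) ++ list³ (proj₂ k)
  near-pole {k = k} e with H⁻ e
  ... | inj₁ p = let m , _ , _ , eq = linked (sw₁₂ p) in m , glued k eq
  ... | inj₂ p with Edge-map⁻ inj₁ p
  ... | _ , _ , _ , _ , _ , () , _

  IsRoot : Vertex → Set
  IsRoot x = ∃[ w ] x ≡ inj₁ w

  common : ∀ {x y z} → Edge H u x y → Edge H v x z → IsRoot x
  common {inj₁ w} _ _ = w , refl
  common {inj₂ _} e e' = let m , p = near-pole e ; _ , q = near-pole e' in ⊥-elim (poles-of-tie m (λ ()) p q)

  to-root : Vertex → U
  to-root (inj₁ w) = w
  to-root (inj₂ _) = pole false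

  C₁ : Col Vertex
  C₁ = pullback to-root CP

  root-edge⁻ : ∀ {a b c} → Edge H (inj₁ a) (inj₁ b) (inj₁ c) → Edge (R ++ spokes) a b c
  root-edge⁻ e with H⁻ e
  ... | inj₁ p = Edge-mono ∈-++⁺ˡ (reflectRoot p)
  ... | inj₂ p = Edge-mono (∈-++⁺ʳ R) (Edge-map-inj inj₁ Sum.inj₁-injective p)

  spanned : ∀ c (f : Fin (4 + n) → Vertex) → (∀ i → IsRoot (f i)) → ¬ IsMono H C₁ c f
  spanned c f root m = spoked-good c (proj₁ ∘ root , λ i j k d →
    let e , eq = m i j k d
        pi = proj₂ (root i) ; pj = proj₂ (root j) ; pk = proj₂ (root k)
    in root-edge⁻ (Edge-subst pi pj pk e) ,
       trans (col-cong CP (sym (cong to-root pi)) (sym (cong to-root pj)) (sym (cong to-root pk))) eq)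

  apart : ∀ c (f : Fin (4 + n) → Vertex) → (∀ i j → f i ≡ u → f j ≢ v) → ¬ IsMono H union c f
  apart c f h m = assembled-good c (f , λ i j k d → let e , eq = m i j k d in
    [ id , (λ s → ⊥-elim (no-spoke s)) ]′ (H⁻ e) , eq)
    where
    no-spoke : ∀ {i j k} → ¬ Edge (map (map³ inj₁) spokes) (f i) (f j) (f k)
    no-spoke {i} {j} {k} s with Edge-pick s
    ... | _ , m , s' with ∈-map⁻ (map³ inj₁) m
    ... | _ , m' , refl with spokes⁻ m'
    ... | c , refl = hits (Edge-single f s' d refl refl refl)
      where
      d : Distinct i j k
      d = let x , y , z = H-proper (Edge-mono (∈-++⁺ʳ assembled) s) in x ∘ cong f , y ∘ cong f , z ∘ cong f
      hits : _ → ⊥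
      hits (i' , j' , _ , _ , p , q , _) = h i' j' p q

  module _ (C : Col Vertex) (good : Good (4 + n) assembled C) where

    ρ : Bool
    ρ = colour³ C (map³ inj₁ (starT true))

    val : Bool → Bool
    val true  = ρ
    val false = not ρ

    -- A blue edge is tied to `starT true` directly; a red one to `starT false`, which is in turn
    -- tied to `starT true`.
    main-colour : ∀ {a b c} → Main a b c → col C (inj₁ a) (inj₁ b) (inj₁ c) ≡ val (col CU a b c)
    main-colour {a} {b} {c} mn with col CU a b c in eq | tied-apart C good (there (∈-map⁺ tie (main⁺ mn)))
    ... | true | ne = trans (Bool.¬-not ne) (sym (Bool.¬-not (tied-apart C good (here refl))))
    ... | false | ne = Bool.¬-not ne

    main-edge : ∀ {a b c} → Main a b c → Edge H (inj₁ a) (inj₁ b) (inj₁ c)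
    main-edge mn = Edge-mono ∈-++⁺ˡ (root-edge (edge (there (there (main⁺ mn)))))

    apexed : (Fin r → Cell) → Fin (4 + n) → Vertex
    apexed φ zero          = u
    apexed φ (suc zero)    = v
    apexed φ (suc (suc j)) = inj₁ (cell (φ j))

    -- Both poles and `r` cells are `t` vertices, and each of their triples is a spoke, a cone or a
    -- body.
    double-cone : ∀ β (φ : Fin r → Cell) →
      (∀ {b i j} → i ≢ j → Main (pole b) (cell (φ i)) (cell (φ j)) × col CU (pole b) (cell (φ i)) (cell (φ j)) ≡ β) →
      (∀ {i j k} → Distinct i j k → Main (cell (φ i)) (cell (φ j)) (cell (φ k)) × col CU (cell (φ i)) (cell (φ j)) (cell (φ k)) ≡ β) →
      (∀ j → col C u v (inj₁ (cell (φ j))) ≡ val β) → Mono (4 + n) H C (val β)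
    double-cone β φ cones bodies spks = apexed φ , sort³ (λ i j k → Q (apexed φ i) (apexed φ j) (apexed φ k))
      (λ { {i} {j} {k} (e , p) → sw₁₂ e , trans (col₁₂ C (apexed φ i) (apexed φ j) (apexed φ k)) p })
      (λ { {i} {j} {k} (e , p) → sw₂₃ e , trans (col₂₃ C (apexed φ i) (apexed φ j) (apexed φ k)) p }) ordered
      where
      Q : Vertex → Vertex → Vertex → Set
      Q a b c = Edge H a b c × col C a b c ≡ val β
      ofMain' : ∀ {a b c} → Main a b c × col CU a b c ≡ β → Q (inj₁ a) (inj₁ b) (inj₁ c)
      ofMain' (mn , eq) = main-edge mn , trans (main-colour mn) (cong val eq)
      ordered : ∀ {i j k} → i F.< j → j F.< k → Q (apexed φ i) (apexed φ j) (apexed φ k)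
      ordered {zero} {suc zero} {suc (suc k)} _ _ = spoke-edge (φ k) , spks k
      ordered {zero} {suc (suc j)} {suc (suc k)} _ (s≤s (s≤s q)) = ofMain' (cones (Fin.<⇒≢ q))
      ordered {suc zero} {suc (suc j)} {suc (suc k)} _ (s≤s (s≤s q)) = ofMain' (cones (Fin.<⇒≢ q))
      ordered {suc (suc i)} {suc (suc j)} {suc (suc k)} (s≤s (s≤s p)) (s≤s (s≤s q)) =
        ofMain' (bodies (Fin.<⇒≢ p , Fin.<⇒≢ q , Fin.<⇒≢ (Fin.<-trans p q)))
      ordered {suc zero} {suc zero} (s≤s ())
      ordered {zero} {suc zero} {suc zero} _ (s≤s ())

    spokeColour : Cell → Bool
    spokeColour c = col C u v (inj₁ (cell c))

    row-mono : ∀ i → (∀ j → spokeColour (i , j) ≡ ρ) → Mono (4 + n) H C ρ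
    row-mono i h = double-cone true (i ,_)
      (λ {b} {j} {j'} ne → cone (ne ∘ cong proj₂) ,
        trans (cone-colour {b} {i , j} {i , j'}) (dec-true (i Fin.≟ i) refl))
      (λ {j} {j'} {j''} (p , q , s) → body (p ∘ cong proj₂ , q ∘ cong proj₂ , s ∘ cong proj₂) (inj₁ (refl , refl)) ,
        body-row {i , j} {i , j'} {i , j''} refl refl) h

    transversal-mono : ∀ (j : Fin r → Fin r) → (∀ i → spokeColour (i , j i) ≡ not ρ) → Mono (4 + n) H C (not ρ)
    transversal-mono j h = double-cone false (λ i → i , j i)
      (λ {b} {i} {i'} ne → cone (ne ∘ cong proj₁) ,
        trans (cone-colour {b} {i , j i} {i' , j i'}) (dec-false (i Fin.≟ i') ne))
      (λ {i} {i'} {i''} (p , q , s) → body (p ∘ cong proj₁ , q ∘ cong proj₁ , s ∘ cong proj₁) (inj₂ (p , q , s)) ,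
        body-transversal {i , j i} {i' , j i'} {i'' , j i''} p) h

    mono-copy : ∃ (Mono (4 + n) H C)
    mono-copy with Fin.any? (λ i → Fin.all? λ j → spokeColour (i , j) Bool.≟ ρ)
    ... | yes (i , h) = ρ , row-mono i h
    ... | no none = not ρ , transversal-mono (λ i → proj₁ (escape i)) (λ i → Bool.¬-not (proj₂ (escape i)))
      where
      escape : ∀ i → ∃[ j ] spokeColour (i , j) ≢ ρ
      escape i = Fin.¬∀⟶∃¬ _ _ (λ j → spokeColour (i , j) Bool.≟ ρ) (λ h → none (i , h))

  H-arrows : Arrows (4 + n) H
  H-arrows C = [ mono-copy C , (λ (c , m) → c , Mono-image id C (Edge-mono ∈-++⁺ˡ) m) ]′
    (Decide.good-or-mono vertex≟ (suc n) assembled C)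

  example : Example n
  example = record
    { _≟_ = vertex≟ ; H = H ; isProper = H-proper ; arrows = H-arrows ; u = u ; v = v ; u≢v = λ ()
    ; link = λ c → inj₁ (cell c) ; in-link = in-link ; C₀ = union ; apart = apart
    ; Common = IsRoot ; common = common ; u-common = _ , refl ; v-common = _ , refl ; C₁ = C₁ ; spanned = spanned }

-- The lower bound

tri-12 : ∀ {n} (a b c : Fin n) → tri b a c ≡ tri a b c
tri-12 a b c = trans (sym (Subset.∪-assoc ⁅ b ⁆ ⁅ a ⁆ ⁅ c ⁆))
  (trans (cong (_∪ ⁅ c ⁆) (Subset.∪-comm ⁅ b ⁆ ⁅ a ⁆)) (Subset.∪-assoc ⁅ a ⁆ ⁅ b ⁆ ⁅ c ⁆))

tri-23 : ∀ {n} (a b c : Fin n) → tri a c b ≡ tri a b c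
tri-23 a b c = cong (⁅ a ⁆ ∪_) (Subset.∪-comm ⁅ c ⁆ ⁅ b ⁆)

tri-∈⁺ : ∀ {n} {a b c x : Fin n} → x ∈ list³ (a , b , c) → x ∈ˢ tri a b c
tri-∈⁺ (here refl) = Subset.x∈p∪q⁺ (inj₁ (Subset.x∈⁅x⁆ _))
tri-∈⁺ (there (here refl)) = Subset.x∈p∪q⁺ (inj₂ (Subset.x∈p∪q⁺ (inj₁ (Subset.x∈⁅x⁆ _))))
tri-∈⁺ (there (there (here refl))) = Subset.x∈p∪q⁺ (inj₂ (Subset.x∈p∪q⁺ (inj₂ (Subset.x∈⁅x⁆ _))))

tri-∈⁻ : ∀ {n} {a b c x : Fin n} → x ∈ˢ tri a b c → x ∈ list³ (a , b , c)
tri-∈⁻ {a = a} {b} {c} m with Subset.x∈p∪q⁻ ⁅ a ⁆ (⁅ b ⁆ ∪ ⁅ c ⁆) m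
... | inj₁ p = here (Subset.x∈⁅y⁆⇒x≡y a p)
... | inj₂ q with Subset.x∈p∪q⁻ ⁅ b ⁆ ⁅ c ⁆ q
... | inj₁ p = there (here (Subset.x∈⁅y⁆⇒x≡y b p))
... | inj₂ p = there (there (here (Subset.x∈⁅y⁆⇒x≡y c p)))

tri-perm : ∀ {n} {a b c x y z : Fin n} → Edge ((a , b , c) ∷ []) x y z → tri x y z ≡ tri a b c
tri-perm {a = a} {b} {c} = Edge-elim (λ x y z → tri x y z ≡ tri a b c)
  (λ {x} {y} {z} eq → trans (tri-12 x y z) eq) (λ {x} {y} {z} eq → trans (tri-23 x y z) eq) λ { (here refl) → refl }

tri-injective : ∀ {n} {a b c a' b' c' : Fin n} → tri a b c ≡ tri a' b' c' → Distinct a b c →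
                Edge ((a' , b' , c') ∷ []) a b c
tri-injective {a = a} {b} {c} {a'} {b'} {c'} eq = three-of (move (here refl)) (move (there (here refl))) (move (there (there (here refl))))
  where
  move : ∀ {x} → x ∈ list³ (a , b , c) → x ∈ list³ (a' , b' , c')
  move {x} m = tri-∈⁻ (subst (x ∈ˢ_) eq (tri-∈⁺ m))

∣insert∣ : ∀ {n} (x : Fin n) (p : Subset n) → x ∉ˢ p → ∣ ⁅ x ⁆ ∪ p ∣ ≡ suc ∣ p ∣
∣insert∣ zero (true ∷ p) h = contradiction Vec.here h
∣insert∣ zero (false ∷ p) h = cong (λ q → suc ∣ q ∣) (Subset.∪-identityˡ p)
∣insert∣ (suc x) (true ∷ p) h = cong suc (∣insert∣ x p (λ m → h (Vec.there m)))
∣insert∣ (suc x) (false ∷ p) h = ∣insert∣ x p (λ m → h (Vec.there m))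

∣tri∣ : ∀ {n} {a b c : Fin n} → Distinct a b c → ∣ tri a b c ∣ ≡ 3
∣tri∣ {a = a} {b} {c} (p , q , r) = trans (∣insert∣ a _ a∉) (cong suc (trans (∣insert∣ b _ b∉) (cong suc (Subset.∣⁅x⁆∣≡1 c))))
  where
  b∉ : b ∉ˢ ⁅ c ⁆
  b∉ m = q (Subset.x∈⁅y⁆⇒x≡y c m)
  a∉ : a ∉ˢ ⁅ b ⁆ ∪ ⁅ c ⁆
  a∉ m with Subset.x∈p∪q⁻ ⁅ b ⁆ ⁅ c ⁆ m
  ... | inj₁ m' = p (Subset.x∈⁅y⁆⇒x≡y b m')
  ... | inj₂ m' = r (Subset.x∈⁅y⁆⇒x≡y c m')

unique-lookup : ∀ {A : Set} {xs : List A} → Unique xs → Injective _≡_ _≡_ (List.lookup xs)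
unique-lookup (p ∷ u) {zero} {zero} _ = refl
unique-lookup (p ∷ u) {zero} {suc j} eq = contradiction eq (All.lookup p (∈-lookup j))
unique-lookup (p ∷ u) {suc i} {zero} eq = contradiction (sym eq) (All.lookup p (∈-lookup i))
unique-lookup (p ∷ u) {suc i} {suc j} eq = cong suc (unique-lookup u eq)

module _ {m : ℕ} (p : Fin m → Bool) where

  count⁺ : ∀ {k} (g : Fin k → Fin m) → Injective _≡_ _≡_ g → (∀ i → p (g i) ≡ true) → k ≤ length (filterᵇ p (allFin m))
  count⁺ g inj h = Fin.injective⇒≤ {f = λ i → index (mem i)} λ {i} {j} eq →
    inj (trans (Any.lookup-index (mem i)) (trans (cong (List.lookup (filterᵇ p (allFin m))) eq) (sym (Any.lookup-index (mem j)))))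
    where
    mem : ∀ i → g i ∈ filterᵇ p (allFin m)
    mem i = ∈-filter⁺ (T? ∘ p) (∈-allFin (g i)) (Equivalence.from Bool.T-≡ (h i))

  count⁻ : ∀ {k} (h : ∀ w → p w ≡ true → Fin k) → (∀ {w w'} q q' → h w q ≡ h w' q' → w ≡ w') →
           length (filterᵇ p (allFin m)) ≤ k
  count⁻ h inj = Fin.injective⇒≤ {f = λ i → h (List.lookup (filterᵇ p (allFin m)) i) (holds i)} λ {i} {j} eq →
    unique-lookup (Unique.filter⁺ (T? ∘ p) (Unique.allFin⁺ m)) (inj (holds i) (holds j) eq)
    where
    holds : ∀ i → p (List.lookup (filterᵇ p (allFin m)) i) ≡ true
    holds i = Equivalence.to Bool.T-≡ (proj₂ (∈-filter⁻ (T? ∘ p) {xs = allFin m} (∈-lookup i)))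

  count-pos : 0 < length (filterᵇ p (allFin m)) → ∃[ w ] p w ≡ true
  count-pos lt with filterᵇ p (allFin m) in eq
  ... | w ∷ _ = w , Equivalence.to Bool.T-≡ (proj₂ (∈-filter⁻ (T? ∘ p) {xs = allFin m} (subst (w ∈_) (sym eq) (here refl))))

-- The filter predicate inside `codeg`, so that `codeg E u v` is by definition the length that
-- `count⁺` and `count⁻` bound.
joins : ∀ {m} → EdgeSet m → Fin m → Fin m → Fin m → Bool
joins E u v w = not (does (w Fin.≟ u)) ∧ not (does (w Fin.≟ v)) ∧ E (tri u v w)

joins⁻ : ∀ {m} (E : EdgeSet m) {u v w} → joins E u v w ≡ true → w ≢ u × w ≢ v × E (tri u v w) ≡ true
joins⁻ E {u} {v} {w} eq with w Fin.≟ u | w Fin.≟ v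
... | no p | no q = p , q , eq

joins⁺ : ∀ {m} (E : EdgeSet m) {u v w} → w ≢ u → w ≢ v → E (tri u v w) ≡ true → joins E u v w ≡ true
joins⁺ E {u} {v} {w} p q eq rewrite dec-false (w Fin.≟ u) p | dec-false (w Fin.≟ v) q = eq

if-no : ∀ {A : Set} (d : Dec A) {x y : Bool} → ¬ A → (if does d then x else y) ≡ y
if-no d {x} {y} ¬a = cong (λ b → if b then x else y) (dec-false d ¬a)

if-yes : ∀ {A : Set} (d : Dec A) {x y : Bool} → A → (if does d then x else y) ≡ x
if-yes d {x} {y} a = cong (λ b → if b then x else y) (dec-true d a)

-- Take a maximal family of disjoint r-sets in the link of u v that are red towards u.  There are fewer
-- than r of them; colouring u v w blue for w in the family and red otherwise extends any colouring of
-- the remaining edges without creating monochromatic cliques through u and v.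
module LowerBound (n : ℕ) {m : ℕ} (E : EdgeSet m) (ram : Ramsey (4 + n) E)
  (u v : Fin m) (u≢v : u ≢ v) (few : codeg E u v < (2 + n) * (2 + n)) where

  r : ℕ
  r = 2 + n

  uv? : (s : Subset m) → Dec (u ∈ˢ s × v ∈ˢ s)
  uv? s = (u Subset.∈? s) ×-dec (v Subset.∈? s)

  E' : EdgeSet m
  E' s = E s ∧ not (does (uv? s))

  E'⁻ : ∀ s → E' s ≡ true → E s ≡ true
  E'⁻ s eq with E s
  ... | true = refl

  E'-uv : ∀ {s} → u ∈ˢ s → v ∈ˢ s → E' s ≡ false
  E'-uv {s} p q rewrite dec-true (uv? s) (p , q) = Bool.∧-zeroʳ (E s)

  E'⁺ : ∀ {s} → ¬ (u ∈ˢ s × v ∈ˢ s) → E s ≡ true → E' s ≡ true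
  E'⁺ {s} h eq rewrite dec-false (uv? s) h = trans (Bool.∧-identityʳ (E s)) eq

  module _ (χ : Colouring m) where

    record RedSet (A : Fin r → Fin m) : Set where
      field
        inj   : ∀ i j → A i ≡ A j → i ≡ j
        joined : ∀ i → joins E u v (A i) ≡ true
        red   : ∀ i j → i ≢ j → χ (tri u (A i) (A j)) ≡ true

    redSet? : ∀ A → Dec (RedSet A)
    redSet? A = map′ (λ (p , q , s) → record { inj = p ; joined = q ; red = s })
      (λ R → RedSet.inj R , RedSet.joined R , RedSet.red R)
      ((Fin.all? λ i → Fin.all? λ j → (A i Fin.≟ A j) →-dec (i Fin.≟ j)) ×-dec
       (Fin.all? λ i → joins E u v (A i) Bool.≟ true) ×-dec
       (Fin.all? λ i → Fin.all? λ j → ¬? (i Fin.≟ j) →-dec (χ (tri u (A i) (A j)) Bool.≟ true)))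

    redSet-cong : ∀ {A A'} → (∀ i → A i ≡ A' i) → RedSet A → RedSet A'
    redSet-cong {A} {A'} eq R = record
      { inj = λ i j e → inj i j (trans (eq i) (trans e (sym (eq j))))
      ; joined = λ i → subst (λ w → joins E u v w ≡ true) (eq i) (joined i)
      ; red = λ i j ne → trans (cong₂ (λ a b → χ (tri u a b)) (sym (eq i)) (sym (eq j))) (red i j ne) }
      where open RedSet R

    record Family (k : ℕ) : Set where
      field
        block    : Fin k → Fin r → Fin m
        redSet   : ∀ b → RedSet (block b)
        disjoint : ∀ {b b' i i'} → block b i ≡ block b' i' → b ≡ b'

    Fresh : ∀ {k} → Family k → (Fin r → Fin m) → Set
    Fresh F A = RedSet A × (∀ b i j → A i ≢ Family.block F b j)

    Maximal : ∀ {k} → Family k → Set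
    Maximal F = ∀ A → ¬ Fresh F A

    size-bound : ∀ {k} → Family k → k * r ≤ codeg E u v
    size-bound {k} F = count⁺ (joins E u v) (λ x → block (quo x) (rem x))
      (λ {x} {y} eq → unpack x y (disjoint eq) eq) (λ x → RedSet.joined (redSet (quo x)) (rem x))
      where
      open Family F
      quo : Fin (k * r) → Fin k
      quo x = proj₁ (remQuot {k} r x)
      rem : Fin (k * r) → Fin r
      rem x = proj₂ (remQuot {k} r x)
      unpack : ∀ x y → quo x ≡ quo y → block (quo x) (rem x) ≡ block (quo y) (rem y) → x ≡ y
      unpack x y e eq = trans (sym (Fin.combine-remQuot {k} r x)) (trans (cong₂ F.combine e
        (RedSet.inj (redSet (quo x)) (rem x) (rem y) (trans eq (cong (λ b → block b (rem y)) (sym e)))))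
        (Fin.combine-remQuot {k} r y))

    maximal? : ∀ {k} (F : Family k) → (∃[ A ] Fresh F A) ⊎ Maximal F
    maximal? F with any? (λ A → fresh? (lookup A)) (allVecs (allFin m) r)
      where
      fresh? : ∀ A → Dec (Fresh F A)
      fresh? A = redSet? A ×-dec (Fin.all? λ b → Fin.all? λ i → Fin.all? λ j → ¬? (A i Fin.≟ Family.block F b j))
    ... | yes p = let A , fr = satisfied p in inj₁ (lookup A , fr)
    ... | no none = inj₂ λ A (R , fr) → none (lose (∈-allVecs⁺ (tabulate A) (λ i → ∈-allFin _))
      (redSet-cong (λ i → sym (lookup∘tabulate A i)) R ,
       λ b i j eq → fr b i j (trans (sym (lookup∘tabulate A i)) eq)))

    extend : ∀ {k} (F : Family k) {A} → Fresh F A → Family (suc k)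
    extend {k} F {A} (R , fr) = record
      { block = block' ; redSet = λ { zero → R ; (suc b) → redSet b }
      ; disjoint = λ { {zero} {zero} _ → refl ; {zero} {suc b} eq → contradiction eq (fr b _ _)
                     ; {suc b} {zero} eq → contradiction (sym eq) (fr b _ _) ; {suc b} {suc b'} eq → cong suc (disjoint eq) } }
      where
      open Family F
      block' : Fin (suc k) → Fin r → Fin m
      block' zero    = A
      block' (suc b) = block b

    maximal : ∀ fuel k → k + fuel ≡ r → Family k → ∃[ k' ] (k' < r × Σ (Family k') Maximal)
    -- The fuel is used up only at `k = r`, where the disjoint blocks would fill `r * r` vertices of
    -- the link.
    maximal zero k eq F = contradiction (subst (λ k → k * r ≤ codeg E u v) (trans (sym (ℕ.+-identityʳ k)) eq) (size-bound F)) (ℕ.<⇒≱ few)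
    maximal (suc fuel) k eq F = [ (λ (A , fr) → maximal fuel (suc k) (trans (sym (ℕ.+-suc k fuel)) eq) (extend F fr)) ,
      (λ mx → k , subst (suc k ≤_) (trans (sym (ℕ.+-suc k fuel)) eq) (ℕ.m≤m+n (suc k) fuel) , F , mx) ]′ (maximal? F)

    abstract
      family : ∃[ k ] (k < r × Σ (Family k) Maximal)
      family = maximal r 0 refl record { block = λ () ; redSet = λ () ; disjoint = λ { {()} } }

    k : ℕ
    k = proj₁ family

    F : Family k
    F = proj₁ (proj₂ (proj₂ family))

    open Family F

    covered? : (s : Subset m) → Dec (∃[ b ] ∃[ j ] block b j ∈ˢ s)
    covered? s = Fin.any? λ b → Fin.any? λ j → block b j Subset.∈? s

    χ' : Colouring m
    χ' s = if does (uv? s) then not (does (covered? s)) else χ s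

    χ'-other : ∀ {s} → ¬ (u ∈ˢ s × v ∈ˢ s) → χ' s ≡ χ s
    χ'-other {s} = if-no (uv? s)

    χ'-uv : ∀ w → χ' (tri u v w) ≡ not (does (covered? (tri u v w)))
    χ'-uv w = if-yes (uv? (tri u v w)) (tri-∈⁺ (here refl) , tri-∈⁺ (there (here refl)))

    module _ {c} (f : Fin (4 + n) → Fin m) (f-inj : Injective _≡_ _≡_ f)
      (mono : ∀ i j k → i ≢ j → j ≢ k → i ≢ k → E (tri (f i) (f j) (f k)) ≡ true × χ' (tri (f i) (f j) (f k)) ≡ c) where

      avoids : (∀ i j → f i ≡ u → f j ≢ v) → MonoCopy (4 + n) E' χ
      avoids h = c , f , f-inj , λ i j k p q s → let e , eq = mono i j k p q s in
        E'⁺ no-uv e , trans (sym (χ'-other no-uv)) eq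
        where
        at : ∀ {i j k w} → w ∈ˢ tri (f i) (f j) (f k) → ∃[ l ] f l ≡ w
        at x with tri-∈⁻ x
        ... | here eq = _ , sym eq
        ... | there (here eq) = _ , sym eq
        ... | there (there (here eq)) = _ , sym eq
        no-uv : ∀ {i j k} → ¬ (u ∈ˢ tri (f i) (f j) (f k) × v ∈ˢ tri (f i) (f j) (f k))
        no-uv (x , y) = h _ _ (proj₂ (at x)) (proj₂ (at y))

      module _ {i j} (fi : f i ≡ u) (fj : f j ≡ v) where

        i≢j : i ≢ j
        i≢j refl = u≢v (trans (sym fi) fj)

        rest : Fin r → Fin (4 + n)
        rest q = punchIn i (punchIn (punchOut i≢j) q)

        rest≢i : ∀ q → rest q ≢ i
        rest≢i q = Fin.punchInᵢ≢i i _

        rest≢j : ∀ q → rest q ≢ j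
        rest≢j q eq = Fin.punchInᵢ≢i (punchOut i≢j) q
          (Fin.punchIn-injective i _ _ (trans eq (sym (Fin.punchIn-punchOut i≢j))))

        A : Fin r → Fin m
        A q = f (rest q)

        A-inj : ∀ q q' → A q ≡ A q' → q ≡ q'
        A-inj q q' eq = Fin.punchIn-injective (punchOut i≢j) _ _ (Fin.punchIn-injective i _ _ (f-inj eq))

        A≢u : ∀ q → A q ≢ u
        A≢u q eq = rest≢i q (f-inj (trans eq (sym fi)))

        A≢v : ∀ q → A q ≢ v
        A≢v q eq = rest≢j q (f-inj (trans eq (sym fj)))

        through : ∀ q → E (tri u v (A q)) ≡ true × χ' (tri u v (A q)) ≡ c
        through q = subst (λ x → E (tri x v (A q)) ≡ true × χ' (tri x v (A q)) ≡ c) fi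
          (subst (λ y → E (tri (f i) y (A q)) ≡ true × χ' (tri (f i) y (A q)) ≡ c) fj
            (mono i j (rest q) i≢j (rest≢j q ∘ sym) (rest≢i q ∘ sym)))

        beside : ∀ q q' → q ≢ q' → χ (tri u (A q) (A q')) ≡ c
        beside q q' ne = trans (sym (χ'-other λ (_ , y) → off-v (tri-∈⁻ y)))
          (subst (λ x → χ' (tri x (A q) (A q')) ≡ c) fi
            (proj₂ (mono i (rest q) (rest q') (rest≢i q ∘ sym) (λ eq → ne (A-inj q q' (cong f eq))) (rest≢i q' ∘ sym))))
          where
          off-v : ¬ v ∈ list³ (u , A q , A q')
          off-v (here eq) = u≢v (sym eq)
          off-v (there (here eq)) = A≢v q (sym eq)
          off-v (there (there (here eq))) = A≢v q' (sym eq)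

        joined-A : ∀ q → joins E u v (A q) ≡ true
        joined-A q = joins⁺ E (A≢u q) (A≢v q) (proj₁ (through q))

        red-case : c ≡ true → ⊥
        red-case refl = proj₂ (proj₂ (proj₂ family)) A (record { inj = A-inj ; joined = joined-A ; red = beside } , fresh)
          where
          -- Red on `u v (A q)` means that `A q` is not covered by the family.
          fresh : ∀ b q q' → A q ≢ block b q'
          fresh b q q' eq = case trans (sym (proj₂ (through q))) (trans (χ'-uv (A q)) (cong not
            (dec-true (covered? _) (b , q' , tri-∈⁺ (there (there (here (sym eq)))))))) of λ ()

        blue-case : c ≡ false → ⊥
        blue-case refl = clash (Fin.pigeonhole (proj₁ (proj₂ family)) (proj₁ ∘ home))
          where
          -- Block vertices lie in the link and so are neither `u` nor `v`; a covered triple is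
          -- therefore covered at `A q`.
          home : ∀ q → ∃[ b ] ∃[ q' ] block b q' ≡ A q
          home q with covered? (tri u v (A q)) | trans (sym (χ'-uv (A q))) (proj₂ (through q))
          ... | yes (b , q' , mem) | _ with tri-∈⁻ mem | joins⁻ E (RedSet.joined (redSet b) q')
          ... | here eq | ne , _ = contradiction eq ne
          ... | there (here eq) | _ , ne , _ = contradiction eq ne
          ... | there (there (here eq)) | _ = b , q' , eq
          clash : (∃₂ λ q q' → q F.< q' × proj₁ (home q) ≡ proj₁ (home q')) → ⊥
          clash (q , q' , lt , eq) with home q | home q'
          clash (q , q' , lt , refl) | b , l , p | .b , l' , p' =
            -- Two vertices of one block form a red triple with `u`, whereas the clique makes it
            -- blue.
            case trans (sym (RedSet.red (redSet b) l l' λ { refl → q≢q' (A-inj q q' (trans (sym p) p')) }))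
              (trans (cong₂ (λ x y → χ (tri u x y)) p p') (beside q q' q≢q')) of λ ()
            where
            q≢q' : q ≢ q'
            q≢q' = Fin.<⇒≢ lt

        impossible : ⊥
        impossible = split c red-case blue-case
          where
          split : ∀ c → (c ≡ true → ⊥) → (c ≡ false → ⊥) → ⊥
          split true  p _ = p refl
          split false _ q = q refl

      copy : MonoCopy (4 + n) E' χ
      copy with Fin.any? (λ i → Fin.any? λ j → (f i Fin.≟ u) ×-dec (f j Fin.≟ v))
      ... | yes (i , j , p , q) = ⊥-elim (impossible p q)
      ... | no none = avoids λ i j p q → none (i , j , p , q)

  E'-ramsey : Ramsey (4 + n) E'
  E'-ramsey χ = let c , f , f-inj , mono = ram (χ' χ) in copy χ f f-inj mono

lower-bound : ∀ n {m} (E : EdgeSet m) → MinimalRamsey (4 + n) E → ∀ u v → u ≢ v → 0 < codeg E u v →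
              (2 + n) * (2 + n) ≤ codeg E u v
lower-bound n {m} E (_ , ram , minimal) u v u≢v pos with ℕ.≤-<-connex ((2 + n) * (2 + n)) (codeg E u v)
... | inj₁ le = le
... | inj₂ few = contradiction E'-ramsey (minimal ⊤ E' (E'⁻ , (λ _ _ → Subset.⊆⊤) , inj₂ (tri u v w , in-E ,
        E'-uv (tri-∈⁺ (here refl)) (tri-∈⁺ (there (here refl))))))
  where
  open LowerBound n E ram u v u≢v few
  wit = count-pos (joins E u v) pos
  w = proj₁ wit
  in-E = proj₂ (proj₂ (joins⁻ E (proj₂ wit)))

-- Minimal Ramsey hypergraphs

dec-true⁻ : ∀ {A : Set} (d : Dec A) → does d ≡ true → A
dec-true⁻ (yes a) _ = a

Edge-flip : ∀ {V : Set} {T : Triple V} {a b c} → Edge (T ∷ []) a b c → Edge³ ((a , b , c) ∷ []) T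
Edge-flip (edge (here refl)) = edge (here refl)
Edge-flip (sw₁₂ e) = Edge-one (sw₁₂ (edge (here refl))) (Edge-flip e)
Edge-flip (sw₂₃ e) = Edge-one (sw₂₃ (edge (here refl))) (Edge-flip e)

module _ {V : Set} (_≟_ : DecidableEquality V) where

  other? : (e x : Triple V) → Dec (¬ Edge³ (e ∷ []) x)
  other? e (a , b , c) = ¬? (edge? _≟_ (e ∷ []) a b c)

  -- Deletes every listing of the edge, permuted or repeated, so that the edge really disappears
  -- from the edge set.
  remove : Triple V → List (Triple V) → List (Triple V)
  remove e = filter (other? e)

  remove⁺ : ∀ {e es a b c} → Edge es a b c → ¬ Edge (e ∷ []) a b c → Edge (remove e es) a b c
  remove⁺ {e} ed ne with Edge-pick ed
  ... | x , m , p = Edge-one (edge (∈-filter⁺ (other? e) m λ q → ne (Edge-one q p))) p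

  Critical : ℕ → List (Triple V) → Set
  Critical t E = Arrows t E × (∀ {e} → e ∈ E → ∃ (Good t (remove e E)))

  removable : ∀ k es xs → (∀ {e} → e ∈ xs → ∃ (Good (3 + k) (remove e es))) ⊎
              (∃[ e ] (e ∈ xs × Arrows (3 + k) (remove e es)))
  removable k es [] = inj₁ λ ()
  removable k es (x ∷ xs) with Decide.arrows-or-good _≟_ k (remove x es) | removable k es xs
  ... | inj₁ arr | _ = inj₂ (x , here refl , arr)
  ... | inj₂ _ | inj₂ (e , m , arr) = inj₂ (e , there m , arr)
  ... | inj₂ g | inj₁ h = inj₁ λ { (here refl) → g ; (there m) → h m }

  minimise : ∀ k fuel es → length es ≤ fuel → Arrows (3 + k) es → ∃[ E ] ((∀ {e} → e ∈ E → e ∈ es) × Critical (3 + k) E)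
  minimise k fuel es le arr with removable k es es
  ... | inj₁ h = es , id , arr , h
  minimise k zero [] le arr | inj₂ (e , () , arr')
  minimise k (suc fuel) es le arr | inj₂ (e , m , arr') =
    let E , sub , crit = minimise k fuel (remove e es) (ℕ.≤-pred (ℕ.≤-trans shorter le)) arr'
    in E , (λ x → proj₁ (∈-filter⁻ (other? e) {xs = es} (sub x))) , crit
    where
    shorter : length (remove e es) < length es
    shorter = List.filter-notAll (other? e) es (lose m λ ne → ne (edge (here refl)))

vertices⁻ : ∀ {V : Set} es {x : V} → x ∈ vertices es → ∃[ y ] ∃[ z ] Edge es x y z
vertices⁻ ((a , b , c) ∷ es) (here refl) = b , c , edge (here refl)
vertices⁻ ((a , b , c) ∷ es) (there (here refl)) = a , c , sw₁₂ (edge (here refl))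
vertices⁻ ((a , b , c) ∷ es) (there (there (here refl))) = a , b , rot (rot (edge (here refl)))
vertices⁻ (_ ∷ es) (there (there (there m))) = let y , z , e = vertices⁻ es m in y , z , Edge-mono there e

-- From a critical list of triples to a minimal Ramsey hypergraph on `Fin m`

module Encode {V : Set} (_≟_ : DecidableEquality V) (k : ℕ) (E : List (Triple V)) (E-proper : Proper E)
  (critical-E : Critical _≟_ (3 + k) E) where

  t : ℕ
  t = 3 + k

  abstract
    -- Only vertices that lie in edges are numbered; minimality under deletion of vertices rests on
    -- this.
    vs : List V
    vs = deduplicate _≟_ (vertices E)

    vs-unique : Unique vs
    vs-unique = DecUnique.deduplicate-! _≟_ (vertices E)

    vs⁺ : ∀ {x} → x ∈ vertices E → x ∈ vs
    vs⁺ = ∈-deduplicate⁺ _≟_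

    vs⁻ : ∀ {x} → x ∈ vs → x ∈ vertices E
    vs⁻ = ∈-deduplicate⁻ _≟_ (vertices E)

  m : ℕ
  m = length vs

  label : Fin m → V
  label = List.lookup vs

  label-injective : Injective _≡_ _≡_ label
  label-injective = unique-lookup vs-unique

  label-surjective : ∀ {x} → x ∈ vertices E → ∃[ a ] label a ≡ x
  label-surjective x = index (vs⁺ x) , sym (Any.lookup-index (vs⁺ x))

  _≟ˢ_ : DecidableEquality (Subset m)
  _≟ˢ_ = Vec.≡-dec Bool._≟_

  abstract
    decode? : (P : Fin m → Fin m → Fin m → Set) → (∀ a b c → Dec (P a b c)) → (s : Subset m) →
              Dec (∃[ a ] ∃[ b ] ∃[ c ] (s ≡ tri a b c × P a b c))
    decode? P P? s = Fin.any? λ a → Fin.any? λ b → Fin.any? λ c → (s ≟ˢ tri a b c) ×-dec P? a b c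

  LabelEdge : Fin m → Fin m → Fin m → Set
  LabelEdge a b c = Edge E (label a) (label b) (label c)

  edge-dec : (s : Subset m) → Dec (∃[ a ] ∃[ b ] ∃[ c ] (s ≡ tri a b c × LabelEdge a b c))
  edge-dec = decode? LabelEdge (λ a b c → edge? _≟_ E (label a) (label b) (label c))

  ES : EdgeSet m
  ES s = does (edge-dec s)

  label-distinct : ∀ {a b c} → LabelEdge a b c → Distinct a b c
  label-distinct e = let p , q , r = E-proper e in p ∘ cong label , q ∘ cong label , r ∘ cong label

  ES⁺ : ∀ {a b c} → LabelEdge a b c → ES (tri a b c) ≡ true
  ES⁺ {a} {b} {c} e = dec-true (edge-dec (tri a b c)) (a , b , c , refl , e)

  ES⁻ : ∀ {s} → ES s ≡ true → ∃[ a ] ∃[ b ] ∃[ c ] (s ≡ tri a b c × LabelEdge a b c)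
  ES⁻ {s} = dec-true⁻ (edge-dec s)

  ES-tri⁻ : ∀ {a b c} → Distinct a b c → ES (tri a b c) ≡ true → LabelEdge a b c
  ES-tri⁻ d eq with ES⁻ eq
  ... | _ , _ , _ , eq' , e = Edge-one e (Edge-map⁺ label (tri-injective eq' d))

  uniform : Uniform3 ES
  uniform s eq with ES⁻ eq
  ... | _ , _ , _ , refl , e = ∣tri∣ (label-distinct e)

  find : V → Maybe (Fin m)
  find x with Fin.any? (λ a → label a ≟ x)
  ... | yes (a , _) = just a
  ... | no _ = nothing

  find-label : ∀ a → find (label a) ≡ just a
  find-label a with Fin.any? (λ a' → label a' ≟ label a)
  ... | yes (a' , eq) = cong just (label-injective eq)
  ... | no none = contradiction (a , refl) none

  -- The default `false` is taken only on triples with an unnumbered vertex, none of which is an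
  -- edge of `E`.
  decoded : Colouring m → Maybe (Fin m) → Maybe (Fin m) → Maybe (Fin m) → Bool
  decoded χ (just a) (just b) (just c) = χ (tri a b c)
  decoded χ _ _ _ = false

  decoded-12 : ∀ χ a b c → decoded χ b a c ≡ decoded χ a b c
  decoded-12 χ (just a) (just b) (just c) = cong χ (tri-12 a b c)
  decoded-12 χ (just _) (just _) nothing = refl
  decoded-12 χ (just _) nothing _ = refl
  decoded-12 χ nothing (just _) _ = refl
  decoded-12 χ nothing nothing _ = refl

  decoded-23 : ∀ χ a b c → decoded χ a c b ≡ decoded χ a b c
  decoded-23 χ (just a) (just b) (just c) = cong χ (tri-23 a b c)
  decoded-23 χ nothing _ _ = refl
  decoded-23 χ (just _) nothing nothing = refl
  decoded-23 χ (just _) nothing (just _) = refl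
  decoded-23 χ (just _) (just _) nothing = refl

  toCol : Colouring m → Col V
  toCol χ = record
    { col = λ a b c → decoded χ (find a) (find b) (find c)
    ; col₁₂ = λ a b c → decoded-12 χ (find a) (find b) (find c)
    ; col₂₃ = λ a b c → decoded-23 χ (find a) (find b) (find c) }

  toCol-label : ∀ χ a b c → col (toCol χ) (label a) (label b) (label c) ≡ χ (tri a b c)
  toCol-label χ a b c rewrite find-label a | find-label b | find-label c = refl

  clique-labels : ∀ (f : Fin t → V) → Clique E f → ∀ i → ∃[ a ] label a ≡ f i
  clique-labels f cl i = let j , l , d = others i in label-surjective (proj₁ (∈-vertices (cl i j l d)))

  ramsey-ES : Ramsey t ES
  ramsey-ES χ = let c , f , mono = proj₁ critical-E (toCol χ) in c , copy c f mono
    where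
    copy : ∀ c f → IsMono E (toCol χ) c f → ∃[ g ] (Injective _≡_ _≡_ g × (∀ (a b d : Fin t) → a ≢ b → b ≢ d → a ≢ d →
       (ES (tri (g a) (g b) (g d)) ≡ true) × (χ (tri (g a) (g b) (g d)) ≡ c)))
    copy c f mono = g , g-inj , λ a b d p q s → let e , eq = mono a b d (p , q , s) in
      ES⁺ (Edge-subst (sym (lab a)) (sym (lab b)) (sym (lab d)) e) ,
      trans (sym (toCol-label χ (g a) (g b) (g d))) (trans (col-cong (toCol χ) (lab a) (lab b) (lab d)) eq)
      where
      cl : Clique E f
      cl i j l d = proj₁ (mono i j l d)
      g : Fin t → Fin m
      g i = proj₁ (clique-labels f cl i)
      lab : ∀ i → label (g i) ≡ f i
      lab i = proj₂ (clique-labels f cl i)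
      g-inj : Injective _≡_ _≡_ g
      g-inj {i} {j} eq = clique-injective E-proper cl (trans (sym (lab i)) (trans (cong label eq) (lab j)))

  module _ (C : Col V) where

    red-dec : (s : Subset m) → Dec (∃[ a ] ∃[ b ] ∃[ c ] (s ≡ tri a b c × col C (label a) (label b) (label c) ≡ true))
    red-dec = decode? _ (λ a b c → col C (label a) (label b) (label c) Bool.≟ true)

    fromCol : Colouring m
    fromCol s = does (red-dec s)

    fromCol-tri : ∀ {a b c} → Distinct a b c → fromCol (tri a b c) ≡ col C (label a) (label b) (label c)
    fromCol-tri {a} {b} {c} d with col C (label a) (label b) (label c) in eq
    ... | true = dec-true (red-dec (tri a b c)) (a , b , c , refl , eq)
    ... | false = dec-false (red-dec (tri a b c)) λ (a' , b' , c' , eq' , red) →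
      case trans (sym eq) (col-const {C = pullback label C} (λ { (here refl) → red }) (tri-injective eq' d)) of λ ()

  -- With `x` a listing of the lost edge, a monochromatic copy in `E'` lies in `remove x E`, for
  -- which criticality provides a good colouring.
  missing-edge : ∀ (E' : EdgeSet m) → (∀ s → E' s ≡ true → ES s ≡ true) → ∀ {s} → ES s ≡ true → E' s ≡ false → ¬ Ramsey t E'
  missing-edge E' sub {s} in-E not-E' ram with ES⁻ in-E
  ... | a , b , c , refl , e with Edge-pick e
  ... | x , x∈ , p with proj₂ critical-E x∈
  ... | C , good with ram (fromCol C)
  ... | d , f , f-inj , mono = good d (label ∘ f , λ i j l dist@(y , z , w) →
    let e' , eq = mono i j l y z w
        df = (λ q → y (f-inj q)) , (λ q → z (f-inj q)) , (λ q → w (f-inj q))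
    in remove⁺ _≟_ (ES-tri⁻ df (sub _ e')) (λ q → same-edge q e') , trans (sym (fromCol-tri C df)) eq)
    where
    same-edge : ∀ {i j l} → Edge (x ∷ []) (label i) (label j) (label l) → ¬ E' (tri i j l) ≡ true
    same-edge {i} {j} {l} q eq = case trans (sym eq) (trans (cong E' (tri-perm same)) not-E') of λ ()
      where
      same : Edge ((a , b , c) ∷ []) i j l
      same = Edge-map-inj label label-injective (Edge-one (Edge-flip p) q)

  minimal : MinimalRamsey t ES
  minimal = uniform , ramsey-ES , λ S E' (sub , within , proper') ram → go S E' sub within ram proper'
    where
    go : ∀ S E' → (∀ s → E' s ≡ true → ES s ≡ true) → (∀ s → E' s ≡ true → s ⊆ˢ S) → Ramsey t E' →
         (S ≢ ⊤ ⊎ ∃[ s ] (ES s ≡ true × E' s ≡ false)) → ⊥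
    go S E' sub within ram (inj₂ (s , p , q)) = missing-edge E' sub p q ram
    go S E' sub within ram (inj₁ S≢⊤) with Fin.any? (λ v → ¬? (v Subset.∈? S))
    ... | no none = S≢⊤ (Subset.⊆-antisym Subset.⊆⊤ λ {v} _ → dec-in v (v Subset.∈? S))
      where
      dec-in : ∀ v → Dec (v ∈ˢ S) → v ∈ˢ S
      dec-in v (yes p) = p
      dec-in v (no p) = contradiction (v , p) none
    -- A vertex outside `S` lies in some edge, and that edge is then absent from `E'`.
    ... | yes (v , v∉S) with vertices⁻ E (vs⁻ (∈-lookup v))
    ... | y , z , e with label-surjective (proj₁ (proj₂ (∈-vertices e))) | label-surjective (proj₂ (proj₂ (∈-vertices e)))
    ... | b , refl | c , refl = missing-edge E' sub (ES⁺ e)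
      (Bool.¬-not λ eq → v∉S (within _ eq (tri-∈⁺ (here refl)))) ram

minimal-in : ∀ k {V : Set} (_≟_ : DecidableEquality V) (H : List (Triple V)) → Arrows (3 + k) H →
  ∃[ E ] ((∀ {e} → e ∈ E → e ∈ H) × Critical _≟_ (3 + k) E)
minimal-in k _≟_ H arr = minimise _≟_ k (length H) H ℕ.≤-refl arr

-- Codegrees in a minimal subhypergraph of the example

module Extremal {n : ℕ} (X : Example n) where
  open Example X

  r : ℕ
  r = 2 + n

  abstract
    minimised : ∃[ E ] ((∀ {e} → e ∈ E → e ∈ H) × Critical _≟_ (4 + n) E)
    minimised = minimal-in (suc n) _≟_ H arrows

  E : List (Triple V)
  E = proj₁ minimised

  E⊆H : ∀ {a b c} → Edge E a b c → Edge H a b c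
  E⊆H = Edge-mono (proj₁ (proj₂ minimised))

  E-proper : Proper E
  E-proper e = isProper (E⊆H e)

  open Encode _≟_ (suc n) E E-proper (proj₂ (proj₂ minimised)) hiding (t)

  -- Monochromatic cliques under `C₀` contain both `u` and `v`, so `E`, which still arrows, keeps an
  -- edge through them.
  uv-edge : ∃[ w ] Edge E u v w
  uv-edge = let c , f , mono = proj₁ (proj₂ (proj₂ minimised)) C₀ in
    from c f mono (Fin.any? λ i → Fin.any? λ j → (f i ≟ u) ×-dec (f j ≟ v))
    where
    from : ∀ c (f : Fin (4 + n) → V) → IsMono E C₀ c f → Dec (∃[ i ] ∃[ j ] (f i ≡ u × f j ≡ v)) → ∃[ w ] Edge E u v w
    from c f mono (no none) = ⊥-elim (apart c f (λ i j p q → none (i , j , p , q))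
      λ i j k d → let e , eq = mono i j k d in E⊆H e , eq)
    from c f mono (yes (i , j , p , q)) = f _ , Edge-subst p q refl
      (proj₁ (mono i j _ (proj₂ (third λ { refl → u≢v (trans (sym p) q) }))))

  ends : ∃[ a ] ∃[ b ] ∃[ w ] (label a ≡ u × label b ≡ v × Edge E u v (label w))
  ends = let _ , e = uv-edge ; x , y , z = ∈-vertices e
             a , p = label-surjective x ; b , q = label-surjective y ; w , s = label-surjective z
    in a , b , w , p , q , Edge-subst refl refl (sym s) e

  a b : Fin m
  a = proj₁ ends
  b = proj₁ (proj₂ ends)

  label-a : label a ≡ u
  label-a = proj₁ (proj₂ (proj₂ (proj₂ ends)))

  label-b : label b ≡ v
  label-b = proj₁ (proj₂ (proj₂ (proj₂ (proj₂ ends))))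

  a≢b : a ≢ b
  a≢b eq = u≢v (trans (sym label-a) (trans (cong label eq) label-b))

  codeg-witness : ∀ {x y} → 0 < codeg ES x y → x ≢ y → ∃[ w ] LabelEdge x y w
  codeg-witness pos x≢y = let w , j = count-pos (joins ES _ _) pos ; p , q , e = joins⁻ ES j in
    w , ES-tri⁻ (x≢y , q ∘ sym , p ∘ sym) e

  codeg-pos : 0 < codeg ES a b
  codeg-pos = count⁺ (joins ES a b) {1} (λ _ → w) (λ { {zero} {zero} _ → refl }) λ _ →
      joins⁺ ES (proj₂ (proj₂ d) ∘ sym) (proj₁ (proj₂ d) ∘ sym) (ES⁺ e)
    where
    w = proj₁ (proj₂ (proj₂ ends))
    e : LabelEdge a b w
    e = Edge-subst (sym label-a) (sym label-b) refl (proj₂ (proj₂ (proj₂ (proj₂ (proj₂ ends)))))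
    d = label-distinct e

  codeg-≤ : codeg ES a b ≤ r * r
  codeg-≤ = count⁻ (joins ES a b) (λ w j → F.combine (proj₁ (cell-of w j)) (proj₂ (cell-of w j))) λ {w} {w'} j j' eq →
    label-injective (trans (linked-to w j) (trans (cong link (cell-≡ w j w' j' eq)) (sym (linked-to w' j'))))
    where
    located : ∀ w → joins ES a b w ≡ true → ∃[ c ] label w ≡ link c
    located w j = let p , q , e = joins⁻ ES j in
      in-link (E⊆H (Edge-subst label-a label-b refl (ES-tri⁻ (a≢b , q ∘ sym , p ∘ sym) e)))
    cell-of : ∀ w → joins ES a b w ≡ true → Fin r × Fin r
    cell-of w j = proj₁ (located w j)
    linked-to : ∀ w j → label w ≡ link (cell-of w j)
    linked-to w j = proj₂ (located w j)
    cell-≡ : ∀ w j w' j' → F.combine (proj₁ (cell-of w j)) (proj₂ (cell-of w j)) ≡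
             F.combine (proj₁ (cell-of w' j')) (proj₂ (cell-of w' j')) → cell-of w j ≡ cell-of w' j'
    cell-≡ w j w' j' eq = let p , q = Fin.combine-injective _ _ _ _ eq in cong₂ _,_ p q

  -- Minimising might have dropped some of the edges at `u v`; the lower bound, applied to the
  -- minimal hypergraph, shows that none was lost.
  codeg-ab : codeg ES a b ≡ r * r
  codeg-ab = ℕ.≤-antisym codeg-≤ (lower-bound n ES minimal a b a≢b codeg-pos)

  -- If all codegrees were positive, every vertex would be adjacent to both u and v.
  codeg-zero : ∃[ x ] ∃[ y ] (x ≢ y × codeg ES x y ≡ 0)
  codeg-zero = from (Fin.any? λ x → Fin.any? λ y → ¬? (x Fin.≟ y) ×-dec (codeg ES x y ℕ.≟ 0))
    where
    from : Dec (∃[ x ] ∃[ y ] (x ≢ y × codeg ES x y ≡ 0)) → ∃[ x ] ∃[ y ] (x ≢ y × codeg ES x y ≡ 0)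
    from (yes p) = p
    -- The monochromatic clique under `C₁` would consist of common vertices only, which `spanned`
    -- excludes.
    from (no none) = let c , f , mono = proj₁ (proj₂ (proj₂ minimised)) C₁ in ⊥-elim (spanned c f
      (λ i → let z , eq = clique-labels f (λ i j k d → proj₁ (mono i j k d)) i in
        subst Common eq (all-common z (a Fin.≟ z) (b Fin.≟ z)))
      λ i j k d → let e , eq = mono i j k d in E⊆H e , eq)
      where
      adjacent : ∀ x y → x ≢ y → ∃[ w ] LabelEdge x y w
      adjacent x y ne = codeg-witness (ℕ.n≢0⇒n>0 λ eq → none (x , y , ne , eq)) ne
      all-common : ∀ z → Dec (a ≡ z) → Dec (b ≡ z) → Common (label z)
      all-common z (yes eq) _ = subst Common (trans (sym label-a) (cong label eq)) u-common
      all-common z (no _) (yes eq) = subst Common (trans (sym label-b) (cong label eq)) v-common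
      all-common z (no p) (no q) = let _ , e = adjacent a z p ; _ , e' = adjacent b z q in
        common (E⊆H (Edge-subst label-a refl refl e)) (E⊆H (Edge-subst label-b refl refl e'))

square : ∀ r → r ^ 2 ≡ r * r
square r = cong (r *_) (ℕ.*-identityʳ r)

theorem1p2 : (t : ℕ) → 4 ≤ t → S22 t 0 × S22' t ((t ∸ 2) ^ 2)
theorem1p2 (suc (suc (suc (suc n)))) (s≤s (s≤s (s≤s (s≤s z≤n)))) =
  ((m , ES , minimal , codeg-zero , λ _ _ → z≤n) , λ _ _ → z≤n) ,
  ((m , ES , minimal , (a , b , a≢b , trans codeg-ab (sym (square r)) , subst (0 <_) (sym (square r)) (s≤s z≤n)) ,
      (λ k (x , y , ne , eq , pos) → bound ES minimal ne eq pos)) ,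
   (λ k (_ , E' , min , (x , y , ne , eq , pos) , _) → bound E' min ne eq pos))
  where
  open Extremal (Construction.example n)
  open Encode (Example._≟_ (Construction.example n)) (suc n) E E-proper (proj₂ (proj₂ minimised)) using (m; ES; minimal)
  bound : ∀ {k m} (E : EdgeSet m) → MinimalRamsey (4 + n) E → ∀ {x y} → x ≢ y → codeg E x y ≡ k → 0 < k → r ^ 2 ≤ k
  bound E min {x} {y} ne refl pos = subst (_≤ codeg E x y) (sym (square r)) (lower-bound n E min x y ne pos)
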